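{- Weighted-throughput active-time scheduling on laminar intervals, with $n$ jobs, active-time budget $K$ and capacity $m$ per slot, can be solved exactly in $f(K,m)\cdot n^{O(1)}$ time for some function $f$ depending only on $K$ and $m$.
   Context: Weighted-throughput active-time scheduling: an instance consists of a set of $n$ jobs $J=\{1,\dots,n\}$, where job $j$ has an integer release time $r_j$, an integer deadline $d_j$, a positive integer processing time $p_j$ and a nonnegative weight $w_j$; a positive integer capacity $m$; and an integer active-time budget $K$. Time is partitioned into discrete integer slots, and the window of $j$ is the set of slots $W_j=[r_j,d_j]=\{r_j,\dots,d_j\}$. A schedule assigns to each slot at most $m$ jobs, each receiving one unit of processing in that slot, with jobs only processed inside their windows; jobs may be preempted at slot boundaries. A slot is active if at least one job is processed in it; at most $K$ slots may be active. A job $j$ is completed if it receives $p_j$ units of processing in slots of $W_j$. The objective is to maximize the total weight of completed jobs. The instance is on laminar intervals if for any two jobs $i,j\in J$ the windows $W_i$ and $W_j$ are either disjoint or one contains the other. -}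

module Defs where

open import Data.Bool.Base using (Bool; true; false; if_then_else_)
open import Data.Fin.Base using (Fin; toℕ)
open import Data.Fin.Subset using (Subset; Nonempty; _∈_; ∣_∣)
open import Data.Fin.Subset.Properties using (_∈?_)
open import Data.Integer.Base as ℤ using (ℤ; +_)
import Data.Integer.Properties as ℤ
open import Data.List.Base using (List; []; _∷_; length; map; filter; foldr; applyUpTo; tabulate)
open import Data.List.Membership.Propositional using () renaming (_∈_ to _∈ˡ_)
open import Data.List.Relation.Binary.Disjoint.Propositional using (Disjoint)
open import Data.List.Relation.Binary.Subset.Propositional using (_⊆_)
open import Data.List.Relation.Unary.All using (All; []; _∷_; lookup)
open import Data.Nat.Base as ℕ using (ℕ; suc; NonZero)
import Data.Nat.Properties as ℕ
open import Data.Product.Base using (Σ-syntax; ∃-syntax; _×_; _,_)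
open import Data.Rational.Base as ℚ using (ℚ; 0ℚ)
import Data.Rational.Properties as ℚ
open import Data.Sum.Base using (_⊎_)
open import Function.Bundles using (_⇔_)
open import Relation.Binary.PropositionalEquality.Core using (_≡_)
open import Relation.Nullary.Decidable.Core using (Dec; does)

record Instance : Set where
  field
    n m K           : ℕ
    release         : Fin n → ℤ
    deadline        : Fin n → ℤ
    processing      : Fin n → ℕ
    weight          : Fin n → ℚ
    m-positive      : NonZero m
    processing-pos  : ∀ j → NonZero (processing j)
    weight-nonneg   : ∀ j → 0ℚ ℚ.≤ weight j

-- The slots a, a + 1, …, b in increasing order; empty when b < a.
slots : ℤ → ℤ → List ℤ
slots a b = applyUpTo (λ i → a ℤ.+ + i) ℤ.∣ + 0 ℤ.⊔ (ℤ.suc b ℤ.- a) ∣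

module _ (I : Instance) where
  open Instance I

  window : Fin n → List ℤ
  window j = slots (release j) (deadline j)

  Laminar : Set
  Laminar = ∀ i j → Disjoint (window i) (window j)
                  ⊎ window i ⊆ window j
                  ⊎ window j ⊆ window i

  -- The set of jobs that receive their unit of processing in each slot.
  Schedule : Set
  Schedule = ℤ → Subset n

  Active : Schedule → ℤ → Set
  Active S t = Nonempty (S t)

  record Feasible (S : Schedule) : Set where
    field
      capacity  : ∀ t → ∣ S t ∣ ℕ.≤ m
      in-window : ∀ t j → j ∈ S t → t ∈ˡ window j
      budget    : ∃[ ts ] (length ts ℕ.≤ K × (∀ t → Active S t → t ∈ˡ ts))

  units : Schedule → Fin n → ℕ
  units S j = length (filter (λ t → j ∈? S t) (window j))

  Completed : Schedule → Fin n → Set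
  Completed S j = processing j ℕ.≤ units S j

  completed? : ∀ S j → Dec (Completed S j)
  completed? S j = processing j ℕ.≤? units S j

  value : Schedule → ℚ
  value S = foldr ℚ._+_ 0ℚ
    (tabulate λ j → if does (completed? S j) then weight j else 0ℚ)

  Optimal : Schedule → Set
  Optimal S = Feasible S × (∀ S′ → Feasible S′ → value S′ ℚ.≤ value S)

------------------------------------------------------------------------
-- Model of computation: a simply typed call-by-value λ-calculus with
-- general recursion, lists, integers and rationals, with an
-- environment-based big-step semantics that counts evaluation steps.
--
-- Each rule below costs one step plus the cost of its premises.  For a
-- fixed program, each rule is O(1) operations of a unit-cost RAM: values
-- are pointers, an environment has length bounded by the program text, and
-- the only arithmetic is +, - and ≤.  There is no multiplication, so number
-- sizes stay polynomial in the input size and the number of steps.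

infixr 6 _⊗_
infixr 5 _⇒_

data Ty : Set where
  int rat bool : Ty
  _⊗_ _⇒_      : Ty → Ty → Ty
  list         : Ty → Ty

Ctx : Set
Ctx = List Ty

data Prim : Ty → Ty → Ty → Set where
  addℤ subℤ : Prim int int int
  leqℤ      : Prim int int bool
  addℚ subℚ : Prim rat rat rat
  leqℚ      : Prim rat rat bool

data Tm (Γ : Ctx) : Ty → Set where
  var   : ∀ {τ} → τ ∈ˡ Γ → Tm Γ τ
  let′  : ∀ {σ τ} → Tm Γ σ → Tm (σ ∷ Γ) τ → Tm Γ τ
  -- A recursive function: its body sees the argument (innermost) and the
  -- function itself.
  fun   : ∀ {σ τ} → Tm (σ ∷ (σ ⇒ τ) ∷ Γ) τ → Tm Γ (σ ⇒ τ)
  app   : ∀ {σ τ} → Tm Γ (σ ⇒ τ) → Tm Γ σ → Tm Γ τ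
  int   : ℤ → Tm Γ int
  rat   : ℚ → Tm Γ rat
  bool  : Bool → Tm Γ bool
  prim  : ∀ {ρ σ τ} → Prim ρ σ τ → Tm Γ ρ → Tm Γ σ → Tm Γ τ
  ite   : ∀ {τ} → Tm Γ bool → Tm Γ τ → Tm Γ τ → Tm Γ τ
  pair  : ∀ {σ τ} → Tm Γ σ → Tm Γ τ → Tm Γ (σ ⊗ τ)
  fst   : ∀ {σ τ} → Tm Γ (σ ⊗ τ) → Tm Γ σ
  snd   : ∀ {σ τ} → Tm Γ (σ ⊗ τ) → Tm Γ τ
  nil   : ∀ {τ} → Tm Γ (list τ)
  cons  : ∀ {τ} → Tm Γ τ → Tm Γ (list τ) → Tm Γ (list τ)
  case  : ∀ {σ τ} → Tm Γ (list σ) → Tm Γ τ → Tm (σ ∷ list σ ∷ Γ) τ → Tm Γ τ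

data Val : Ty → Set where
  int  : ℤ → Val int
  rat  : ℚ → Val rat
  bool : Bool → Val bool
  _,_  : ∀ {σ τ} → Val σ → Val τ → Val (σ ⊗ τ)
  list : ∀ {τ} → List (Val τ) → Val (list τ)
  clo  : ∀ {Γ σ τ} → All Val Γ → Tm (σ ∷ (σ ⇒ τ) ∷ Γ) τ → Val (σ ⇒ τ)

Env : Ctx → Set
Env = All Val

⟦_⟧ : ∀ {ρ σ τ} → Prim ρ σ τ → Val ρ → Val σ → Val τ
⟦ addℤ ⟧ (int x) (int y) = int (x ℤ.+ y)
⟦ subℤ ⟧ (int x) (int y) = int (x ℤ.- y)
⟦ leqℤ ⟧ (int x) (int y) = bool (does (x ℤ.≤? y))
⟦ addℚ ⟧ (rat x) (rat y) = rat (x ℚ.+ y)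
⟦ subℚ ⟧ (rat x) (rat y) = rat (x ℚ.- y)
⟦ leqℚ ⟧ (rat x) (rat y) = bool (does (x ℚ.≤? y))

infix 4 _⊢_⇓_∣_

-- ρ ⊢ e ⇓ v ∣ t : in environment ρ, e evaluates to v in exactly t steps.
data _⊢_⇓_∣_ {Γ : Ctx} (ρ : Env Γ) : ∀ {τ} → Tm Γ τ → Val τ → ℕ → Set where

  ⇓var : ∀ {τ} (x : τ ∈ˡ Γ) → ρ ⊢ var x ⇓ lookup ρ x ∣ 1

  ⇓let : ∀ {σ τ} {e : Tm Γ σ} {b : Tm (σ ∷ Γ) τ} {v w t u} →
         ρ ⊢ e ⇓ v ∣ t → v ∷ ρ ⊢ b ⇓ w ∣ u →
         ρ ⊢ let′ e b ⇓ w ∣ suc (t ℕ.+ u)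

  ⇓fun : ∀ {σ τ} (b : Tm (σ ∷ (σ ⇒ τ) ∷ Γ) τ) → ρ ⊢ fun b ⇓ clo ρ b ∣ 1

  ⇓app : ∀ {Δ σ τ} {ρ′ : Env Δ} {b : Tm (σ ∷ (σ ⇒ τ) ∷ Δ) τ}
         {f : Tm Γ (σ ⇒ τ)} {e v w s t u} →
         ρ ⊢ f ⇓ clo ρ′ b ∣ s → ρ ⊢ e ⇓ v ∣ t →
         v ∷ clo ρ′ b ∷ ρ′ ⊢ b ⇓ w ∣ u →
         ρ ⊢ app f e ⇓ w ∣ suc (s ℕ.+ t ℕ.+ u)

  ⇓int : ∀ i → ρ ⊢ int i ⇓ int i ∣ 1

  ⇓rat : ∀ q → ρ ⊢ rat q ⇓ rat q ∣ 1

  ⇓bool : ∀ b → ρ ⊢ bool b ⇓ bool b ∣ 1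

  ⇓prim : ∀ {π σ τ} (o : Prim π σ τ) {e₁ e₂ v₁ v₂ t u} →
          ρ ⊢ e₁ ⇓ v₁ ∣ t → ρ ⊢ e₂ ⇓ v₂ ∣ u →
          ρ ⊢ prim o e₁ e₂ ⇓ ⟦ o ⟧ v₁ v₂ ∣ suc (t ℕ.+ u)

  ⇓true : ∀ {τ} {c : Tm Γ bool} {e₁ e₂ : Tm Γ τ} {v t u} →
          ρ ⊢ c ⇓ bool true ∣ t → ρ ⊢ e₁ ⇓ v ∣ u →
          ρ ⊢ ite c e₁ e₂ ⇓ v ∣ suc (t ℕ.+ u)

  ⇓false : ∀ {τ} {c : Tm Γ bool} {e₁ e₂ : Tm Γ τ} {v t u} →
           ρ ⊢ c ⇓ bool false ∣ t → ρ ⊢ e₂ ⇓ v ∣ u →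
           ρ ⊢ ite c e₁ e₂ ⇓ v ∣ suc (t ℕ.+ u)

  ⇓pair : ∀ {σ τ} {e₁ : Tm Γ σ} {e₂ : Tm Γ τ} {v₁ v₂ t u} →
          ρ ⊢ e₁ ⇓ v₁ ∣ t → ρ ⊢ e₂ ⇓ v₂ ∣ u →
          ρ ⊢ pair e₁ e₂ ⇓ (v₁ , v₂) ∣ suc (t ℕ.+ u)

  ⇓fst : ∀ {σ τ} {e : Tm Γ (σ ⊗ τ)} {v w t} →
         ρ ⊢ e ⇓ (v , w) ∣ t → ρ ⊢ fst e ⇓ v ∣ suc t

  ⇓snd : ∀ {σ τ} {e : Tm Γ (σ ⊗ τ)} {v w t} →
         ρ ⊢ e ⇓ (v , w) ∣ t → ρ ⊢ snd e ⇓ w ∣ suc t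

  ⇓nil : ∀ {τ} → ρ ⊢ nil {τ = τ} ⇓ list [] ∣ 1

  ⇓cons : ∀ {τ} {e₁ : Tm Γ τ} {e₂ v vs t u} →
          ρ ⊢ e₁ ⇓ v ∣ t → ρ ⊢ e₂ ⇓ list vs ∣ u →
          ρ ⊢ cons e₁ e₂ ⇓ list (v ∷ vs) ∣ suc (t ℕ.+ u)

  ⇓case-nil : ∀ {σ τ} {e : Tm Γ (list σ)} {e₁ : Tm Γ τ} {e₂ v t u} →
              ρ ⊢ e ⇓ list [] ∣ t → ρ ⊢ e₁ ⇓ v ∣ u →
              ρ ⊢ case e e₁ e₂ ⇓ v ∣ suc (t ℕ.+ u)

  ⇓case-cons : ∀ {σ τ} {e : Tm Γ (list σ)} {e₁ : Tm Γ τ} {e₂ v vs w t u} →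
               ρ ⊢ e ⇓ list (v ∷ vs) ∣ t → v ∷ list vs ∷ ρ ⊢ e₂ ⇓ w ∣ u →
               ρ ⊢ case e e₁ e₂ ⇓ w ∣ suc (t ℕ.+ u)

------------------------------------------------------------------------
-- A program reads K, m and the list of jobs (release, deadline, processing
-- time, weight), and returns the list of all pairs (slot, job) of a
-- schedule, jobs being named 0, …, n - 1.

Job : Ty
Job = int ⊗ int ⊗ int ⊗ rat

Program : Set
Program = Tm (int ∷ int ∷ list Job ∷ []) (list (int ⊗ int))

input : Instance → Env (int ∷ int ∷ list Job ∷ [])
input I = int (+ K) ∷ int (+ m) ∷ list (tabulate job) ∷ []
  where
  open Instance I
  job : Fin n → Val Job
  job j = int (release j) , int (deadline j) , int (+ processing j) , rat (weight j)

output : List (ℤ × ℤ) → Val (list (int ⊗ int))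
output xs = list (map (λ (t , j) → int t , int j) xs)

Represents : (I : Instance) → List (ℤ × ℤ) → Schedule I → Set
Represents I xs S =
  ∀ x → x ∈ˡ xs ⇔ (∃[ t ] ∃[ j ] (j ∈ S t × x ≡ (t , + toℕ j)))

SolvesWithin : Program → Instance → ℕ → Set
SolvesWithin P I T =
  ∃[ t ] ∃[ xs ] Σ[ S ∈ Schedule I ]
    (input I ⊢ P ⇓ output xs ∣ t × t ℕ.≤ T × Represents I xs S × Optimal I S)

{-# OPTIONS --safe #-}

-- Moving its active slots to the right, one can place a schedule on the candidate slots
-- d − i with d a deadline and i < K.  Jobs are processed by increasing window length.  By
-- laminarity the candidates in the window of the next job form a union of components, sets
-- of candidates that all later windows contain or avoid as a whole.  Hence later jobs see
-- only the loads of the active slots of a component, not their positions, and it suffices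
-- to keep one best partial schedule per profile of loads: at most K numbers of size at most m.
--
-- The algorithm is an expression of a first-order language with a total semantics, compiled
-- into Tm.  If all lists that an expression folds over have length at most B, then its
-- compiled form takes at most B ^ d steps, where d depends only on the expression.
module Submission where

open import Defs
open import Data.Bool.Base using (Bool; true; false; if_then_else_; T)
open import Data.Bool.Properties using (T?)
open import Data.Empty using (⊥)
open import Data.Fin.Base using (Fin; toℕ)
import Data.Fin.Properties as Fin
open import Data.Fin.Subset using (Subset; ∣_∣) renaming (_∈_ to _∈ˢ_)
open import Data.Fin.Subset.Properties using (nonempty?) renaming (_∈?_ to _∈ˢ?_)
open import Data.Integer.Base as ℤ using (ℤ; +_; -[1+_])
import Data.Integer.Properties as ℤ
open import Algebra.Properties.AbelianGroup ℤ.+-0-abelianGroup using (∙-cancelˡ)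
import Data.Integer.Tactic.RingSolver as ℤRing
open import Data.List.Base
  using (List; []; _∷_; _++_; length; map; foldr; foldl; concatMap; filter; filterᵇ;
         upTo; downFrom; tabulate; allFin; deduplicate)
open import Data.List.Membership.DecPropositional ℤ._≟_ using (_∈?_)
open import Data.List.Membership.Propositional using (find; lose) renaming (_∈_ to _∈ˡ_; _∉_ to _∉ˡ_)
open import Data.List.Membership.Propositional.Properties
  using (∈-∃++; ∈-++⁺ˡ; ∈-++⁺ʳ; ∈-++⁻; ∈-map⁺; ∈-map⁻; ∈-concatMap⁺; ∈-concatMap⁻; ∈-filter⁺; ∈-filter⁻;
         ∈-tabulate⁺; ∈-tabulate⁻; ∈-deduplicate⁺; ∈-deduplicate⁻; ∈-applyUpTo⁺; ∈-applyUpTo⁻;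
         ∈-upTo⁺; ∈-downFrom⁺)
open import Data.List.Properties
  using (length-++; length-map; length-downFrom; length-applyUpTo; length-tabulate; map-++; map-∘;
         map-tabulate; tabulate-cong; filter-++; filter-accept; concatMap-++; ∷-injective; ∷-injectiveʳ)
open import Data.List.Relation.Binary.Permutation.Propositional
  using (_↭_; refl; prep; swap; ↭-refl; ↭-sym; ↭-trans; ↭-prep; ↭-swap; ↭-reflexive; ↭⇒↭ₛ)
  renaming (trans to ↭-tr)
open import Data.List.Relation.Binary.Permutation.Propositional.Properties
  using (filter-↭; ↭-length; ∈-resp-↭; All-resp-↭; ++⁺ˡ; shift; ++-comm; ++-assoc) renaming (++⁺ to ↭-++⁺)
import Data.List.Relation.Binary.Permutation.Setoid.Properties as Permutationₛ
open import Data.List.Relation.Binary.Pointwise as Pointwise using (Pointwise; []; _∷_)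
open import Data.List.Relation.Binary.Sublist.Propositional using ([]; _∷_; _∷ʳ_; minimum) renaming (_⊆_ to _⊑_)
import Data.List.Relation.Binary.Sublist.Propositional.Properties as Sub
open import Data.List.Relation.Unary.All as All using (All; []; _∷_; lookup)
import Data.List.Relation.Unary.All.Properties as All
open import Data.List.Relation.Unary.AllPairs as AllPairs using (AllPairs; []; _∷_)
open import Data.List.Relation.Unary.Any using (here; there)
open import Data.List.Relation.Unary.Sorted.TotalOrder.Properties using (Sorted⇒AllPairs)
open import Data.List.Relation.Unary.Unique.DecPropositional.Properties ℤ._≟_ using (deduplicate-!)
open import Data.List.Relation.Unary.Unique.Propositional using (Unique)
import Data.List.Relation.Unary.Unique.Propositional.Properties as Unique
import Data.List.Sort ℤ.≤-decTotalOrder as Sort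
open import Data.Nat using (ℕ; _*_; _^_; _⊔_)
open import Data.Nat.Base as ℕ using (zero; suc; _+_; _≤_; _<_; z≤n; s≤s; NonZero; >-nonZero)
import Data.Nat.Properties as ℕ
open import Data.Nat.Tactic.RingSolver using (solve-∀)
open import Data.Product using (Σ-syntax; ∃-syntax)
open import Data.Product.Base using (_×_; _,_; proj₁; proj₂; uncurry)
open import Data.Product.Properties using (≡-dec)
open import Data.List.Membership.DecPropositional (≡-dec ℤ._≟_ ℤ._≟_) using () renaming (_∈?_ to _∈²?_)
open import Data.Rational.Base as ℚ using (ℚ; 0ℚ)
import Data.Rational.Properties as ℚ
open import Data.Sum.Base using (_⊎_; inj₁; inj₂)
open import Data.Unit.Base using (⊤; tt)
import Data.Vec.Base as Vec
import Data.Vec.Properties as Vec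
open import Function.Base using (_∘_; id)
open import Function.Bundles using (mk⇔)
open import Relation.Binary.PropositionalEquality
  using (_≡_; _≢_; refl; sym; trans; cong; cong₂; subst; setoid; module ≡-Reasoning)
open import Relation.Nullary.Decidable using (dec-true; dec-false; isYes≗does)
open import Relation.Nullary.Decidable.Core using (Dec; does; proof; yes; no; _×-dec_; toWitness)
open import Relation.Nullary.Negation.Core using (¬_; contradiction)
open import Relation.Nullary.Reflects using (Reflects; ofʸ; ofⁿ)

-- Optimality rests on two independent halves. Soundness (`Valid`): every entry is a genuine partial
-- schedule that earns at least the weight it claims. Completeness (`Covers`): once an arbitrary
-- feasible competitor has been moved to candidate slots, each table holds, under the profile that
-- the competitor has there, an entry of at least the competitor's weight. That entry may use other
-- slots and complete other jobs. Agreement of the profiles is enough, because the next job can then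
-- copy the competitor's choices position by position (`choose`).
--
-- For this the slots must be present before their jobs are: each candidate is declared open or
-- closed at the outset, open ones with load 0, and the budget is checked where components are
-- merged.
--
-- A profile is a list over 0, ..., m of length at most K, so the size of a table is bounded in K
-- and m alone. Hence all folded lists have length at most `factor K m * (n ⊔ 1)`, linear in n, and
-- a power of it whose exponent is fixed by the program splits into f(K, m) times a power of n.

-- First-order expressions and their total semantics.

⟦_⟧ᵀ : Ty → Set
⟦ int ⟧ᵀ    = ℤ
⟦ rat ⟧ᵀ    = ℚ
⟦ bool ⟧ᵀ   = Bool
⟦ σ ⊗ τ ⟧ᵀ  = ⟦ σ ⟧ᵀ × ⟦ τ ⟧ᵀ
-- Expressions never build functions, and with no values here `encode` does not have to produce
-- closures.
⟦ σ ⇒ τ ⟧ᵀ  = ⊥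
⟦ list τ ⟧ᵀ = List ⟦ τ ⟧ᵀ

encode : ∀ τ → ⟦ τ ⟧ᵀ → Val τ
encode int      i  = int i
encode rat      q  = rat q
encode bool     b  = bool b
encode (σ ⊗ τ)  p  = encode σ (proj₁ p) , encode τ (proj₂ p)
encode (list τ) xs = list (map (encode τ) xs)

Values : Ctx → Set
Values = All ⟦_⟧ᵀ

-- First-order expressions whose only recursion is over lists and ranges:
-- unlike Tm they have a total semantics in Agda types.
data Exp (Γ : Ctx) : Ty → Set where
  var   : ∀ {τ} → τ ∈ˡ Γ → Exp Γ τ
  let′  : ∀ {σ τ} → Exp Γ σ → Exp (σ ∷ Γ) τ → Exp Γ τ
  call  : ∀ {Δ τ} → All (Exp Γ) Δ → Exp Δ τ → Exp Γ τ
  int   : ℤ → Exp Γ int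
  rat   : ℚ → Exp Γ rat
  bool  : Bool → Exp Γ bool
  prim  : ∀ {ρ σ τ} → Prim ρ σ τ → Exp Γ ρ → Exp Γ σ → Exp Γ τ
  ite   : ∀ {τ} → Exp Γ bool → Exp Γ τ → Exp Γ τ → Exp Γ τ
  pair  : ∀ {σ τ} → Exp Γ σ → Exp Γ τ → Exp Γ (σ ⊗ τ)
  fst   : ∀ {σ τ} → Exp Γ (σ ⊗ τ) → Exp Γ σ
  snd   : ∀ {σ τ} → Exp Γ (σ ⊗ τ) → Exp Γ τ
  nil   : ∀ {τ} → Exp Γ (list τ)
  cons  : ∀ {τ} → Exp Γ τ → Exp Γ (list τ) → Exp Γ (list τ)
  case  : ∀ {σ τ} → Exp Γ (list σ) → Exp Γ τ → Exp (σ ∷ list σ ∷ Γ) τ → Exp Γ τ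
  -- The step of a fold sees the element (innermost) and the accumulator.
  foldʳ : ∀ {σ τ} → Exp Γ (list σ) → Exp Γ τ → Exp (σ ∷ τ ∷ Γ) τ → Exp Γ τ
  foldˡ : ∀ {σ τ} → Exp Γ (list σ) → Exp Γ τ → Exp (σ ∷ τ ∷ Γ) τ → Exp Γ τ
  range : Exp Γ int → Exp Γ (list int)

⟦_⟧ᴾ : ∀ {ρ σ τ} → Prim ρ σ τ → ⟦ ρ ⟧ᵀ → ⟦ σ ⟧ᵀ → ⟦ τ ⟧ᵀ
⟦ addℤ ⟧ᴾ x y = x ℤ.+ y
⟦ subℤ ⟧ᴾ x y = x ℤ.- y
⟦ leqℤ ⟧ᴾ x y = does (x ℤ.≤? y)
⟦ addℚ ⟧ᴾ x y = x ℚ.+ y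
⟦ subℚ ⟧ᴾ x y = x ℚ.- y
⟦ leqℚ ⟧ᴾ x y = does (x ℚ.≤? y)

-- Level-polymorphic in the result because `Bounded` also uses it to compute a type.
matchList : ∀ {b} {A : Set} {B : Set b} → List A → B → (A → List A → B) → B
matchList []       b f = b
matchList (x ∷ xs) b f = f x xs

-- Descending, so that the compiled loop can subtract 1, cons the result and recurse on it.
below : ℤ → List ℤ
below (+ k)    = map +_ (downFrom k)
below -[1+ _ ] = []

mutual
  eval : ∀ {Γ τ} → Exp Γ τ → Values Γ → ⟦ τ ⟧ᵀ
  eval (var x)       ρ = lookup ρ x
  eval (let′ e b)    ρ = eval b (eval e ρ ∷ ρ)
  eval (call as f)   ρ = eval f (evals as ρ)
  eval (int i)       ρ = i
  eval (rat q)       ρ = q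
  eval (bool b)      ρ = b
  eval (prim o a b)  ρ = ⟦ o ⟧ᴾ (eval a ρ) (eval b ρ)
  eval (ite c a b)   ρ = if eval c ρ then eval a ρ else eval b ρ
  eval (pair a b)    ρ = eval a ρ , eval b ρ
  eval (fst e)       ρ = proj₁ (eval e ρ)
  eval (snd e)       ρ = proj₂ (eval e ρ)
  eval nil           ρ = []
  eval (cons a b)    ρ = eval a ρ ∷ eval b ρ
  eval (case e a b)  ρ = matchList (eval e ρ) (eval a ρ) λ x xs → eval b (x ∷ xs ∷ ρ)
  eval (foldʳ e z s) ρ = foldr (λ x acc → eval s (x ∷ acc ∷ ρ)) (eval z ρ) (eval e ρ)
  eval (foldˡ e z s) ρ = foldl (λ acc x → eval s (x ∷ acc ∷ ρ)) (eval z ρ) (eval e ρ)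
  eval (range e)     ρ = below (eval e ρ)

  evals : ∀ {Γ Δ} → All (Exp Γ) Δ → Values Γ → Values Δ
  evals []       ρ = []
  evals (a ∷ as) ρ = eval a ρ ∷ evals as ρ

-- Compilation

Renaming : Ctx → Ctx → Set
Renaming Γ Θ = ∀ {σ} → σ ∈ˡ Γ → σ ∈ˡ Θ

#0 : ∀ {Γ : Ctx} {a} → a ∈ˡ a ∷ Γ
#0 = here refl

#1 : ∀ {Γ : Ctx} {a b} → b ∈ˡ a ∷ b ∷ Γ
#1 = there #0

#2 : ∀ {Γ : Ctx} {a b c} → c ∈ˡ a ∷ b ∷ c ∷ Γ
#2 = there #1

#3 : ∀ {Γ : Ctx} {a b c d} → d ∈ˡ a ∷ b ∷ c ∷ d ∷ Γ
#3 = there #2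

under₂ : ∀ {Γ Θ σ τ} → Renaming Γ Θ → Renaming (σ ∷ τ ∷ Γ) (σ ∷ τ ∷ Θ)
under₂ r (here refl)         = #0
under₂ r (there (here refl)) = #1
under₂ r (there (there x))   = there (there (r x))

-- The body of a fold runs with the list, its tail and the function itself
-- below the element and the accumulator.
underFold : ∀ {Γ Θ σ τ a b c} → Renaming Γ Θ →
            Renaming (σ ∷ τ ∷ Γ) (τ ∷ σ ∷ a ∷ b ∷ c ∷ Θ)
underFold r (here refl)         = #1
underFold r (there (here refl)) = #0
underFold r (there (there x))   = there (there (there (there (there (r x)))))

under : ∀ {Γ Θ σ} → Renaming Γ Θ → Renaming (σ ∷ Γ) (σ ∷ Θ)
under r (here refl) = #0
under r (there x)   = there (r x)

foldʳ-body : ∀ {Θ σ τ} → Tm (list σ ∷ (list σ ⇒ τ) ∷ Θ) τ →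
             Tm (τ ∷ σ ∷ list σ ∷ list σ ∷ (list σ ⇒ τ) ∷ Θ) τ →
             Tm (list σ ∷ (list σ ⇒ τ) ∷ Θ) τ
foldʳ-body z s = case (var #0) z (let′ (app (var #3) (var #1)) s)

-- Binding the accumulator with `let′` puts it directly above the element, as in `foldʳ-body`, so
-- that `underFold` serves both folds.
foldˡ-body : ∀ {Θ σ τ} → Tm (τ ∷ σ ∷ list σ ∷ (list σ ⊗ τ) ∷ (list σ ⊗ τ ⇒ τ) ∷ Θ) τ →
             Tm ((list σ ⊗ τ) ∷ (list σ ⊗ τ ⇒ τ) ∷ Θ) τ
foldˡ-body s = case (fst (var #0)) (snd (var #0))
                    (app (var #3) (pair (var #1) (let′ (snd (var #2)) s)))

range-body : ∀ {Θ} → Tm (int ∷ (int ⇒ list int) ∷ Θ) (list int)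
range-body = ite (prim leqℤ (var #0) (int (+ 0))) nil
                 (let′ (prim subℤ (var #0) (int (+ 1))) (cons (var #0) (app (var #2) (var #0))))

mutual
  compile : ∀ {Γ Θ τ} → Exp Γ τ → Renaming Γ Θ → Tm Θ τ
  compile (var x)       r = var (r x)
  compile (let′ e b)    r = let′ (compile e r) (compile b (under r))
  compile (call as f)   r = compileArgs as r (compile f ∈-++⁺ˡ)
  compile (int i)       r = int i
  compile (rat q)       r = rat q
  compile (bool b)      r = bool b
  compile (prim o a b)  r = prim o (compile a r) (compile b r)
  compile (ite c a b)   r = ite (compile c r) (compile a r) (compile b r)
  compile (pair a b)    r = pair (compile a r) (compile b r)
  compile (fst e)       r = fst (compile e r)
  compile (snd e)       r = snd (compile e r)
  compile nil           r = nil
  compile (cons a b)    r = cons (compile a r) (compile b r)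
  compile (case e a b)  r = case (compile e r) (compile a r) (compile b (under₂ r))
  compile (foldʳ e z s) r =
    app (fun (foldʳ-body (compile z (λ x → there (there (r x)))) (compile s (underFold r))))
        (compile e r)
  compile (foldˡ e z s) r =
    app (fun (foldˡ-body (compile s (underFold r)))) (pair (compile e r) (compile z r))
  compile (range e)     r = app (fun range-body) (compile e r)

  -- A call is inlined as nested bindings. The last argument is bound outermost, so that the first
  -- ends up innermost and the body meets the arguments in the order of `Δ`. Each argument is
  -- compiled below the ones after it, hence the renaming past `Δ`.
  compileArgs : ∀ {Γ Δ Θ τ} → All (Exp Γ) Δ → Renaming Γ Θ → Tm (Δ ++ Θ) τ → Tm Θ τ
  compileArgs []                 r b = b
  compileArgs {Δ = _ ∷ Δ} (a ∷ as) r b =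
    compileArgs as r (let′ (compile a (λ x → ∈-++⁺ʳ Δ (r x))) b)

-- Exponents of the running time, and the bounds on lists that it presupposes.

mutual
  -- Exponents of subexpressions are added instead of maximised, which is crude but needs no case
  -- distinction. A loop contributes 2: one factor `B` for the number of rounds and one that absorbs
  -- the constant overheads.
  degree : ∀ {Γ τ} → Exp Γ τ → ℕ
  degree (var x)       = 0
  degree (let′ e b)    = suc (degree e + degree b)
  degree (call as f)   = degreeArgs as (degree f)
  degree (int i)       = 0
  degree (rat q)       = 0
  degree (bool b)      = 0
  degree (prim o a b)  = suc (degree a + degree b)
  degree (ite c a b)   = suc (degree c + (degree a + degree b))
  degree (pair a b)    = suc (degree a + degree b)
  degree (fst e)       = suc (degree e)
  degree (snd e)       = suc (degree e)
  degree nil           = 0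
  degree (cons a b)    = suc (degree a + degree b)
  degree (case e a b)  = suc (degree e + (degree a + degree b))
  degree (foldʳ e z s) = 2 + (degree e + (degree z + degree s))
  degree (foldˡ e z s) = 2 + (degree e + (degree z + degree s))
  degree (range e)     = 2 + degree e

  degreeArgs : ∀ {Γ Δ} → All (Exp Γ) Δ → ℕ → ℕ
  degreeArgs []       d = d
  degreeArgs (a ∷ as) d = degreeArgs as (suc (degree a + d))

module _ (B : ℕ) where

  -- Only the accumulators that the fold really meets have to satisfy `P`. The bounds on tables
  -- would fail for arbitrary ones.
  Boundedʳ : ∀ {A C : Set} → (A → C → C) → C → (A → C → Set) → List A → Set
  Boundedʳ f z P []       = ⊤
  Boundedʳ f z P (x ∷ xs) = Boundedʳ f z P xs × P x (foldr f z xs)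

  Boundedˡ : ∀ {A C : Set} → (C → A → C) → C → (A → C → Set) → List A → Set
  Boundedˡ f z P []       = ⊤
  Boundedˡ f z P (x ∷ xs) = P x z × Boundedˡ f (f z x) P xs

  mutual
    -- Both branches of `ite` are demanded, so a list must be short even where a guard would skip
    -- it. Only `case` consults the value, for its cons branch.
    Bounded : ∀ {Γ τ} → Exp Γ τ → Values Γ → Set
    Bounded (var x)       ρ = ⊤
    Bounded (let′ e b)    ρ = Bounded e ρ × Bounded b (eval e ρ ∷ ρ)
    Bounded (call as f)   ρ = BoundedArgs as ρ × Bounded f (evals as ρ)
    Bounded (int i)       ρ = ⊤
    Bounded (rat q)       ρ = ⊤
    Bounded (bool b)      ρ = ⊤
    Bounded (prim o a b)  ρ = Bounded a ρ × Bounded b ρ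
    Bounded (ite c a b)   ρ = Bounded c ρ × Bounded a ρ × Bounded b ρ
    Bounded (pair a b)    ρ = Bounded a ρ × Bounded b ρ
    Bounded (fst e)       ρ = Bounded e ρ
    Bounded (snd e)       ρ = Bounded e ρ
    Bounded nil           ρ = ⊤
    Bounded (cons a b)    ρ = Bounded a ρ × Bounded b ρ
    Bounded (case e a b)  ρ = Bounded e ρ × Bounded a ρ ×
      matchList (eval e ρ) ⊤ (λ x xs → Bounded b (x ∷ xs ∷ ρ))
    Bounded (foldʳ e z s) ρ = Bounded e ρ × Bounded z ρ × length (eval e ρ) ≤ B ×
      Boundedʳ (λ x acc → eval s (x ∷ acc ∷ ρ)) (eval z ρ)
               (λ x acc → Bounded s (x ∷ acc ∷ ρ)) (eval e ρ)
    Bounded (foldˡ e z s) ρ = Bounded e ρ × Bounded z ρ × length (eval e ρ) ≤ B ×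
      Boundedˡ (λ acc x → eval s (x ∷ acc ∷ ρ)) (eval z ρ)
               (λ x acc → Bounded s (x ∷ acc ∷ ρ)) (eval e ρ)
    Bounded (range e)     ρ = Bounded e ρ × length (below (eval e ρ)) ≤ B

    BoundedArgs : ∀ {Γ Δ} → All (Exp Γ) Δ → Values Γ → Set
    BoundedArgs []       ρ = ⊤
    BoundedArgs (a ∷ as) ρ = Bounded a ρ × BoundedArgs as ρ

  -- Induction over the suffixes of a fixed list: a step may use that its elements belong to the
  -- whole list, that the suffix is strictly shorter, and what the accumulator is.
  Boundedʳ-intro : ∀ {A C : Set} {f : A → C → C} {z P} (Inv : List A → C → Set) (xs : List A) →
    Inv [] z →
    (∀ x ys acc → (∀ {y} → y ∈ˡ x ∷ ys → y ∈ˡ xs) → length ys < length xs → acc ≡ foldr f z ys →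
       Inv ys acc → P x acc × Inv (x ∷ ys) (f x acc)) →
    Boundedʳ f z P xs
  Boundedʳ-intro {f = f} {z} {P} Inv xs base step = proj₁ (go xs id ℕ.≤-refl)
    where
    go : ∀ ys → (∀ {x} → x ∈ˡ ys → x ∈ˡ xs) → length ys ≤ length xs → Boundedʳ f z P ys × Inv ys (foldr f z ys)
    go []       sub len = tt , base
    go (y ∷ ys) sub len with go ys (sub ∘ there) (ℕ.<⇒≤ len)
    ... | b , inv with step y ys (foldr f z ys) sub len refl inv
    ... | p , inv′ = (b , p) , inv′

  Boundedʳ-all : ∀ {A C : Set} {f : A → C → C} {z P} (xs : List A) →
                 (∀ x acc → P x acc) → Boundedʳ f z P xs
  Boundedʳ-all []       h = tt
  Boundedʳ-all (x ∷ xs) h = Boundedʳ-all xs h , h x _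

  Boundedˡ-all : ∀ {A C : Set} {f : C → A → C} {z P} (xs : List A) →
                 (∀ x acc → P x acc) → Boundedˡ f z P xs
  Boundedˡ-all []       h = tt
  Boundedˡ-all (x ∷ xs) h = h x _ , Boundedˡ-all xs h

-- Correctness and running time of compiled expressions

Evaluates : ∀ {Γ τ} → Env Γ → Tm Γ τ → Val τ → ℕ → Set
Evaluates δ e v T = ∃[ t ] (δ ⊢ e ⇓ v ∣ t × t ≤ T)

Agrees : ∀ {Γ Θ} → Values Γ → Env Θ → Renaming Γ Θ → Set
Agrees {Γ} ρ δ r = ∀ {σ} (x : σ ∈ˡ Γ) → lookup δ (r x) ≡ encode σ (lookup ρ x)

lookup-++ˡ : ∀ {Γ Δ σ} (ρ : Env Γ) (δ : Env Δ) (x : σ ∈ˡ Γ) → lookup (All.++⁺ ρ δ) (∈-++⁺ˡ x) ≡ lookup ρ x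
lookup-++ˡ (v ∷ ρ) δ (here refl) = refl
lookup-++ˡ (v ∷ ρ) δ (there x)   = lookup-++ˡ ρ δ x

lookup-++ʳ : ∀ {Γ Δ σ} (ρ : Env Γ) (δ : Env Δ) (x : σ ∈ˡ Δ) → lookup (All.++⁺ ρ δ) (∈-++⁺ʳ Γ x) ≡ lookup δ x
lookup-++ʳ []      δ x = refl
lookup-++ʳ (v ∷ ρ) δ x = lookup-++ʳ ρ δ x

encodeAll : ∀ {Γ} → Values Γ → Env Γ
encodeAll = All.map (encode _)

agrees-under : ∀ {Γ Θ σ} {ρ : Values Γ} {δ : Env Θ} {r : Renaming Γ Θ} {v : ⟦ σ ⟧ᵀ} →
               Agrees ρ δ r → Agrees (v ∷ ρ) (encode σ v ∷ δ) (under r)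
agrees-under a (here refl) = refl
agrees-under a (there x)   = a x

agrees-under₂ : ∀ {Γ Θ σ τ} {ρ : Values Γ} {δ : Env Θ} {r : Renaming Γ Θ} {v : ⟦ σ ⟧ᵀ} {w : ⟦ τ ⟧ᵀ} →
                Agrees ρ δ r → Agrees (v ∷ w ∷ ρ) (encode σ v ∷ encode τ w ∷ δ) (under₂ r)
agrees-under₂ a (here refl)         = refl
agrees-under₂ a (there (here refl)) = refl
agrees-under₂ a (there (there x))   = a x

agrees-underFold : ∀ {Γ Θ σ τ α β γ} {ρ : Values Γ} {δ : Env Θ} {r : Renaming Γ Θ}
                   {v : ⟦ σ ⟧ᵀ} {w : ⟦ τ ⟧ᵀ} {a : Val α} {b : Val β} {c : Val γ} →
                   Agrees ρ δ r →
                   Agrees (v ∷ w ∷ ρ) (encode τ w ∷ encode σ v ∷ a ∷ b ∷ c ∷ δ) (underFold r)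
agrees-underFold h (here refl)         = refl
agrees-underFold h (there (here refl)) = refl
agrees-underFold h (there (there x))   = h x

encode-prim : ∀ {ρ σ τ} (o : Prim ρ σ τ) x y →
              ⟦ o ⟧ (encode ρ x) (encode σ y) ≡ encode τ (⟦ o ⟧ᴾ x y)
encode-prim addℤ x y = refl
encode-prim subℤ x y = refl
encode-prim leqℤ x y = refl
encode-prim addℚ x y = refl
encode-prim subℚ x y = refl
encode-prim leqℚ x y = refl

-- The 40 leaves room for the 2 + 17 + 16 = 35 multiples of `Q` that `loop` collects; `step₁` and
-- `step₂` ask for 2 and 3.
module Cost (B : ℕ) (40≤B : 40 ≤ B) where

  instance
    B≢0 : NonZero B
    B≢0 = >-nonZero (ℕ.≤-trans (s≤s z≤n) 40≤B)

  1≤B^ : ∀ d → 1 ≤ B ^ d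
  1≤B^ d = ℕ.m^n>0 B d

  weakenˡ : ∀ {t} a b → t ≤ B ^ a → t ≤ B ^ (a + b)
  weakenˡ a b t≤ = ℕ.≤-trans t≤ (ℕ.^-monoʳ-≤ B (ℕ.m≤m+n a b))

  weakenʳ : ∀ {t} a b → t ≤ B ^ b → t ≤ B ^ (a + b)
  weakenʳ a b t≤ = ℕ.≤-trans t≤ (ℕ.^-monoʳ-≤ B (ℕ.m≤n+m b a))

  step₁ : ∀ {t} a → t ≤ B ^ a → suc t ≤ B ^ suc a
  step₁ {t} a t≤ = begin
    suc t         ≤⟨ ℕ.+-mono-≤ (1≤B^ a) t≤ ⟩
    B ^ a + B ^ a ≡⟨ cong (_+_ (B ^ a)) (ℕ.+-identityʳ _) ⟨
    2 * B ^ a     ≤⟨ ℕ.*-monoˡ-≤ (B ^ a) (ℕ.≤-trans (s≤s (s≤s z≤n)) 40≤B) ⟩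
    B * B ^ a     ∎
    where open ℕ.≤-Reasoning

  step₂ : ∀ {t u} a b → t ≤ B ^ a → u ≤ B ^ b → suc (t + u) ≤ B ^ suc (a + b)
  step₂ {t} {u} a b t≤ u≤ = begin
    suc (t + u)   ≤⟨ ℕ.+-mono-≤ (1≤B^ (a + b)) (ℕ.+-mono-≤ (weakenˡ a b t≤) (weakenʳ a b u≤)) ⟩
    Q + (Q + Q)   ≡⟨ cong (λ x → Q + (Q + x)) (ℕ.+-identityʳ Q) ⟨
    3 * Q         ≤⟨ ℕ.*-monoˡ-≤ Q (ℕ.≤-trans (s≤s (s≤s (s≤s z≤n))) 40≤B) ⟩
    B * Q         ∎
    where open ℕ.≤-Reasoning
          Q = B ^ (a + b)

  -- The overhead of a round of a compiled fold or range is at most 16 steps.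
  loop : ∀ {l t} Q → l ≤ B → 1 ≤ Q → t ≤ 2 * Q + (l * (16 + Q) + 16) → t ≤ B * (B * Q)
  loop {l} {t} Q l≤ 1≤Q t≤ = begin
    t                                              ≤⟨ t≤ ⟩
    2 * Q + (l * (16 + Q) + 16)                    ≤⟨ ℕ.+-mono-≤ (ℕ.m≤n*m (2 * Q) B)
                                                        (ℕ.+-mono-≤ (ℕ.*-mono-≤ l≤ (ℕ.+-monoˡ-≤ Q (ℕ.*-monoʳ-≤ 16 1≤Q)))
                                                                    (ℕ.≤-trans (ℕ.*-monoʳ-≤ 16 1≤Q) (ℕ.m≤n*m (16 * Q) B))) ⟩
    B * (2 * Q) + (B * (16 * Q + Q) + B * (16 * Q)) ≡⟨ arith B Q ⟩
    B * (35 * Q)                                   ≤⟨ ℕ.*-monoʳ-≤ B (ℕ.*-monoˡ-≤ Q (ℕ.≤-trans (ℕ.m≤m+n 35 5) 40≤B)) ⟩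
    B * (B * Q)                                    ∎
    where open ℕ.≤-Reasoning
          arith : ∀ b q → b * (2 * q) + (b * (16 * q + q) + b * (16 * q)) ≡ b * (35 * q)
          arith = solve-∀

  -- Here `c` is what a loop spends besides its step and its recursive call: 6 for a right fold, 10
  -- for a left fold. A range spends 13.
  round : ∀ {c t u Q l k} → c ≤ 16 → t ≤ l * (16 + Q) + k → u ≤ Q →
          c + (t + u) ≤ suc l * (16 + Q) + k
  round {c} {t} {u} {Q} {l} {k} c≤ t≤ u≤ = begin
    c + (t + u)                       ≤⟨ ℕ.+-mono-≤ c≤ (ℕ.+-mono-≤ t≤ u≤) ⟩
    16 + (l * (16 + Q) + k + Q)       ≡⟨ arith l Q k ⟩
    suc l * (16 + Q) + k              ∎
    where open ℕ.≤-Reasoning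
          arith : ∀ l Q k → 16 + (l * (16 + Q) + k + Q) ≡ suc l * (16 + Q) + k
          arith = solve-∀

  finish : ∀ {c t u Q X} → c ≤ 8 → t ≤ Q → u ≤ Q + (X + 8) → c + (t + u) ≤ 2 * Q + (X + 16)
  finish {c} {t} {u} {Q} {X} c≤ t≤ u≤ = begin
    c + (t + u)             ≤⟨ ℕ.+-mono-≤ c≤ (ℕ.+-mono-≤ t≤ u≤) ⟩
    8 + (Q + (Q + (X + 8))) ≡⟨ arith Q X ⟩
    2 * Q + (X + 16)        ∎
    where open ℕ.≤-Reasoning
          arith : ∀ Q X → 8 + (Q + (Q + (X + 8))) ≡ 2 * Q + (X + 16)
          arith = solve-∀

  mutual
    -- Induction on the expression. The renaming has to be arbitrary, because the body of a loop
    -- runs in an environment that also holds the list, its tail and the closure of the loop.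
    compile-evaluates : ∀ {Γ Θ τ} (e : Exp Γ τ) (ρ : Values Γ) → Bounded B e ρ →
      {r : Renaming Γ Θ} {δ : Env Θ} → Agrees ρ δ r →
      Evaluates δ (compile e r) (encode τ (eval e ρ)) (B ^ degree e)
    compile-evaluates (var x) ρ b {r} {δ} a =
      1 , subst (δ ⊢ var (r x) ⇓_∣ 1) (a x) (⇓var (r x)) , ℕ.≤-refl
    compile-evaluates (let′ e b) ρ (be , bb) a
      with compile-evaluates e ρ be a
    ... | t , d , t≤ with compile-evaluates b (eval e ρ ∷ ρ) bb (agrees-under a)
    ... | u , d′ , u≤ = _ , ⇓let d d′ , step₂ (degree e) (degree b) t≤ u≤
    compile-evaluates (call as f) ρ (bas , bf) {r} {δ} a =
      compileArgs-evaluates as ρ bas a (compile f ∈-++⁺ˡ) (degree f)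
        (compile-evaluates f (evals as ρ) bf
          (λ x → trans (lookup-++ˡ (encodeAll (evals as ρ)) δ x) (All.lookup-map (evals as ρ) x)))
    compile-evaluates (int i) ρ b a = 1 , ⇓int i , ℕ.≤-refl
    compile-evaluates (rat q) ρ b a = 1 , ⇓rat q , ℕ.≤-refl
    compile-evaluates (bool c) ρ b a = 1 , ⇓bool c , ℕ.≤-refl
    compile-evaluates (prim o e₁ e₂) ρ (b₁ , b₂) {r} {δ} a
      with compile-evaluates e₁ ρ b₁ a | compile-evaluates e₂ ρ b₂ a
    ... | t , d , t≤ | u , d′ , u≤ =
      _ , subst (δ ⊢ prim o (compile e₁ r) (compile e₂ r) ⇓_∣ suc (t + u)) (encode-prim o _ _) (⇓prim o d d′) ,
      step₂ (degree e₁) (degree e₂) t≤ u≤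
    compile-evaluates {τ = τ} (ite c e₁ e₂) ρ (bc , b₁ , b₂) {r} {δ} a
      with eval c ρ | compile-evaluates c ρ bc {r} {δ} a
         | compile-evaluates e₁ ρ b₁ {r} {δ} a | compile-evaluates e₂ ρ b₂ {r} {δ} a
    ... | true  | t , d , t≤ | u , d′ , u≤ | _ =
      _ , ⇓true d d′ , step₂ (degree c) (degree e₁ + degree e₂) t≤ (weakenˡ (degree e₁) (degree e₂) u≤)
    ... | false | t , d , t≤ | _ | u , d′ , u≤ =
      _ , ⇓false d d′ , step₂ (degree c) (degree e₁ + degree e₂) t≤ (weakenʳ (degree e₁) (degree e₂) u≤)
    compile-evaluates (pair e₁ e₂) ρ (b₁ , b₂) a
      with compile-evaluates e₁ ρ b₁ a | compile-evaluates e₂ ρ b₂ a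
    ... | t , d , t≤ | u , d′ , u≤ = _ , ⇓pair d d′ , step₂ (degree e₁) (degree e₂) t≤ u≤
    compile-evaluates (fst e) ρ b a with compile-evaluates e ρ b a
    ... | t , d , t≤ = _ , ⇓fst d , step₁ (degree e) t≤
    compile-evaluates (snd e) ρ b a with compile-evaluates e ρ b a
    ... | t , d , t≤ = _ , ⇓snd d , step₁ (degree e) t≤
    compile-evaluates nil ρ b a = 1 , ⇓nil , ℕ.≤-refl
    compile-evaluates (cons e₁ e₂) ρ (b₁ , b₂) a
      with compile-evaluates e₁ ρ b₁ a | compile-evaluates e₂ ρ b₂ a
    ... | t , d , t≤ | u , d′ , u≤ = _ , ⇓cons d d′ , step₂ (degree e₁) (degree e₂) t≤ u≤
    compile-evaluates (case e e₁ e₂) ρ (be , b₁ , b₂) {r} {δ} a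
      with eval e ρ | compile-evaluates e ρ be {r} {δ} a | compile-evaluates e₁ ρ b₁ {r} {δ} a | b₂
    ... | []     | t , d , t≤ | u , d′ , u≤ | _ =
      _ , ⇓case-nil d d′ , step₂ (degree e) (degree e₁ + degree e₂) t≤ (weakenˡ (degree e₁) (degree e₂) u≤)
    ... | x ∷ xs | t , d , t≤ | _ | b₃ with compile-evaluates e₂ (x ∷ xs ∷ ρ) b₃ (agrees-under₂ a)
    ... | u , d′ , u≤ =
      _ , ⇓case-cons d d′ , step₂ (degree e) (degree e₁ + degree e₂) t≤ (weakenʳ (degree e₁) (degree e₂) u≤)
    compile-evaluates (foldʳ e z s) ρ (be , bz , l≤ , bs) {r} {δ} a
      with compile-evaluates e ρ be {r} {δ} a
         | foldʳ-evaluates z s ρ {r} {δ} a bz (eval e ρ) bs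
             (weakenʳ (degree e) (degree z + degree s) (weakenˡ (degree z) (degree s) ℕ.≤-refl))
             (weakenʳ (degree e) (degree z + degree s) (weakenʳ (degree z) (degree s) ℕ.≤-refl))
    ... | t , d , t≤ | u , d′ , u≤ =
      _ , ⇓app (⇓fun _) d d′ ,
      loop _ l≤ (1≤B^ (degree e + (degree z + degree s)))
        (finish {2} (ℕ.m≤m+n 2 6) (weakenˡ (degree e) (degree z + degree s) t≤)
                (bound (length (eval e ρ) * _) _ u≤))
      where
      bound : ∀ X Q {u} → u ≤ X + (2 + Q) → u ≤ Q + (X + 8)
      bound X Q u≤ = ℕ.≤-trans u≤ (ℕ.≤-trans (ℕ.m≤m+n _ 6) (ℕ.≤-reflexive (arith X Q)))
        where arith : ∀ X Q → X + (2 + Q) + 6 ≡ Q + (X + 8)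
              arith = solve-∀
    compile-evaluates (foldˡ {τ = τ} e z s) ρ (be , bz , l≤ , bs) {r} {δ} a
      with compile-evaluates e ρ be {r} {δ} a | compile-evaluates z ρ bz {r} {δ} a
         | foldˡ-evaluates s ρ {r} {δ} a (eval z ρ) (eval e ρ) bs
             (weakenʳ (degree e) (degree z + degree s) (weakenʳ (degree z) (degree s) ℕ.≤-refl))
    ... | t , d , t≤ | v , d″ , v≤ | u , d′ , u≤ =
      _ , ⇓app (⇓fun _) (⇓pair d d″) d′ ,
      loop _ l≤ (1≤B^ (degree e + (degree z + degree s)))
        (ℕ.≤-trans (ℕ.≤-reflexive (cong (_+_ 3) (ℕ.+-assoc t v u)))
          (finish {3} (ℕ.m≤m+n 3 5) (weakenˡ (degree e) (degree z + degree s) t≤)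
            (ℕ.+-mono-≤ (weakenʳ (degree e) (degree z + degree s) (weakenˡ (degree z) (degree s) v≤))
                        (ℕ.≤-trans u≤ (ℕ.+-monoʳ-≤ _ (ℕ.m≤m+n 5 3))))))
    compile-evaluates (range e) ρ (be , l≤) {r} {δ} a
      with eval e ρ | compile-evaluates e ρ be {r} {δ} a | l≤
    ... | -[1+ k ] | t , d , t≤ | _ =
      _ , ⇓app (⇓fun _) d (⇓true (⇓prim leqℤ (⇓var #0) (⇓int (+ 0))) ⇓nil) ,
      loop {0} _ z≤n (1≤B^ (degree e))
        (finish {2} {X = 0} (ℕ.m≤m+n 2 6) t≤ (ℕ.≤-trans (ℕ.m≤m+n 5 3) (ℕ.m≤n+m 8 (B ^ degree e))))
    ... | + k      | t , d , t≤ | l≤′ with range-evaluates {δ = δ} k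
    ... | u , d′ , u≤ =
      _ , ⇓app (⇓fun _) d d′ ,
      loop {k} _ (subst (ℕ._≤ B) (trans (length-map +_ (downFrom k)) (length-downFrom k)) l≤′) (1≤B^ (degree e))
        (finish {2} (ℕ.m≤m+n 2 6) t≤
          (ℕ.≤-trans u≤ (ℕ.≤-trans (ℕ.+-mono-≤ (ℕ.*-monoʳ-≤ k (ℕ.m≤m+n 16 (B ^ degree e))) (ℕ.m≤m+n 5 3))
                                   (ℕ.m≤n+m _ (B ^ degree e)))))

    compileArgs-evaluates : ∀ {Γ Δ Θ τ} (as : All (Exp Γ) Δ) (ρ : Values Γ) → BoundedArgs B as ρ →
      {r : Renaming Γ Θ} {δ : Env Θ} → Agrees ρ δ r →
      (b : Tm (Δ ++ Θ) τ) {v : Val τ} (d : ℕ) →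
      Evaluates (All.++⁺ (encodeAll (evals as ρ)) δ) b v (B ^ d) →
      Evaluates δ (compileArgs as r b) v (B ^ degreeArgs as d)
    compileArgs-evaluates []       ρ bs       a b d ev = ev
    compileArgs-evaluates (e ∷ as) ρ (be , bs) {r} {δ} a b d (u , ev , u≤)
      with compile-evaluates e ρ be
             (λ x → trans (lookup-++ʳ (encodeAll (evals as ρ)) δ (r x)) (a x))
    ... | t , ev′ , t≤ =
      compileArgs-evaluates as ρ bs a _ (suc (degree e + d))
        (_ , ⇓let ev′ ev , step₂ (degree e) d t≤ u≤)

    foldʳ-evaluates : ∀ {Γ Θ σ τ} (z : Exp Γ τ) (s : Exp (σ ∷ τ ∷ Γ) τ) (ρ : Values Γ)
      {r : Renaming Γ Θ} {δ : Env Θ} → Agrees ρ δ r → Bounded B z ρ → (xs : List ⟦ σ ⟧ᵀ) →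
      Boundedʳ B (λ x acc → eval s (x ∷ acc ∷ ρ)) (eval z ρ) (λ x acc → Bounded B s (x ∷ acc ∷ ρ)) xs →
      ∀ {Q} → B ^ degree z ≤ Q → B ^ degree s ≤ Q →
      let body = foldʳ-body (compile z (λ x → there (there (r x)))) (compile s (underFold r)) in
      Evaluates (list (map (encode σ) xs) ∷ clo δ body ∷ δ) body
                (encode τ (foldr (λ x acc → eval s (x ∷ acc ∷ ρ)) (eval z ρ) xs))
                (length xs * (16 + Q) + (2 + Q))
    foldʳ-evaluates z s ρ a bz [] bs z≤ s≤ with compile-evaluates z ρ bz a
    ... | t , d , t≤ = _ , ⇓case-nil (⇓var #0) d , s≤s (s≤s (ℕ.≤-trans t≤ z≤))
    foldʳ-evaluates z s ρ {r} {δ} a bz (x ∷ xs) (bs , b) z≤ s≤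
      with foldʳ-evaluates z s ρ {r} {δ} a bz xs bs z≤ s≤
         | compile-evaluates s (x ∷ _ ∷ ρ) b (agrees-underFold a)
    ... | t , d , t≤ | u , d′ , u≤ =
      _ , ⇓case-cons (⇓var #0) (⇓let (⇓app (⇓var #3) (⇓var #1) d) d′) ,
      round {6} {l = length xs} (ℕ.m≤m+n 6 10) t≤ (ℕ.≤-trans u≤ s≤)

    foldˡ-evaluates : ∀ {Γ Θ σ τ} (s : Exp (σ ∷ τ ∷ Γ) τ) (ρ : Values Γ)
      {r : Renaming Γ Θ} {δ : Env Θ} → Agrees ρ δ r → (z : ⟦ τ ⟧ᵀ) (xs : List ⟦ σ ⟧ᵀ) →
      Boundedˡ B (λ acc x → eval s (x ∷ acc ∷ ρ)) z (λ x acc → Bounded B s (x ∷ acc ∷ ρ)) xs →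
      ∀ {Q} → B ^ degree s ≤ Q →
      let body = foldˡ-body (compile s (underFold r)) in
      Evaluates ((list (map (encode σ) xs) , encode τ z) ∷ clo δ body ∷ δ) body
                (encode τ (foldl (λ acc x → eval s (x ∷ acc ∷ ρ)) z xs))
                (length xs * (16 + Q) + 5)
    foldˡ-evaluates s ρ a z [] bs s≤ =
      _ , ⇓case-nil (⇓fst (⇓var #0)) (⇓snd (⇓var #0)) , ℕ.≤-refl
    foldˡ-evaluates s ρ {r} {δ} a z (x ∷ xs) (b , bs) {Q} s≤
      with compile-evaluates s (x ∷ z ∷ ρ) b (agrees-underFold a)
         | foldˡ-evaluates s ρ {r} {δ} a (eval s (x ∷ z ∷ ρ)) xs bs s≤
    ... | u , d′ , u≤ | t , d , t≤ =
      _ , ⇓case-cons (⇓fst (⇓var #0)) (⇓app (⇓var #3) (⇓pair (⇓var #1) (⇓let (⇓snd (⇓var #2)) d′)) d) ,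
      ℕ.≤-trans (ℕ.≤-reflexive (cong (_+_ 10) (ℕ.+-comm u t)))
                (round {10} {l = length xs} (ℕ.m≤m+n 10 6) t≤ (ℕ.≤-trans u≤ s≤))

    range-evaluates : ∀ {Θ} {δ : Env Θ} (k : ℕ) →
      Evaluates (int (+ k) ∷ clo δ range-body ∷ δ) range-body (encode (list int) (below (+ k))) (k * 16 + 5)
    range-evaluates zero    = _ , ⇓true (⇓prim leqℤ (⇓var #0) (⇓int (+ 0))) ⇓nil , ℕ.≤-refl
    range-evaluates {δ = δ} (suc k) with range-evaluates {δ = δ} k
    ... | t , d , t≤ =
      _ , ⇓false (⇓prim leqℤ (⇓var #0) (⇓int (+ 0)))
            (⇓let (⇓prim subℤ (⇓var #0) (⇓int (+ 1)))
                  (⇓cons (⇓var #0) (⇓app (⇓var #2) (⇓var #0) d))) ,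
      ℕ.+-mono-≤ (ℕ.m≤m+n 13 3) t≤

-- The algorithm, as functions on the values of first-order types

-- An active slot with the number and the list of the jobs processed in it.
slot : Ty
slot = int ⊗ int ⊗ list int

-- A partial schedule on its active slots, with the weight of its completed jobs.
entry : Ty
entry = rat ⊗ list slot

table : Ty
table = list entry

task : Ty
task = int ⊗ Job

-- Candidate slots, the jobs processed so far that can use them, and the table of the
-- partial schedules of these jobs.
component : Ty
component = list int ⊗ list task ⊗ table

Slot Entry Table Task Component : Set
Slot      = ⟦ slot ⟧ᵀ
Entry     = ⟦ entry ⟧ᵀ
Table     = ⟦ table ⟧ᵀ
Task      = ⟦ task ⟧ᵀ
Component = ⟦ component ⟧ᵀ

name start end work : Task → ℤ
name  (i , _)             = i
start (_ , r , _)         = r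
end   (_ , _ , d , _)     = d
work  (_ , _ , _ , p , _) = p

gain : Task → ℚ
gain (_ , _ , _ , _ , w) = w

-- Two comparisons, since `Prim` has no equality test.
sameℤ : ℤ → ℤ → Bool
sameℤ x y = if does (x ℤ.≤? y) then does (y ℤ.≤? x) else false

-- Expressions fold over one list at a time, so two lists are compared by a left fold over the first
-- that consumes the second. The flag says whether all loads have agreed so far; what remains of the
-- second list is checked by `sameKey`.
matchSlot : Bool × List Slot → Slot → Bool × List Slot
matchSlot st x = matchList (proj₂ st) (false , [])
  λ y ys → (if sameℤ (proj₁ (proj₂ y)) (proj₁ (proj₂ x)) then proj₁ st else false) , ys

sameKey : List Slot → List Slot → Bool
sameKey xs ys = matchList (proj₂ st) (proj₁ st) λ _ _ → false
  where st = foldl matchSlot (true , ys) xs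

dominated : Entry → Table → Bool
dominated e = foldr (λ x acc →
  if (if sameKey (proj₂ e) (proj₂ x) then does (proj₁ e ℚ.≤? proj₁ x) else false)
  then true else acc) false

discard : Entry → Table → Table
discard e = foldr (λ x acc → if sameKey (proj₂ e) (proj₂ x) then acc else x ∷ acc) []

-- Keeps the keys of a table distinct, so that its length is at most the number of possible
-- profiles.
insert : Entry → Table → Table
insert e T = if dominated e T then T else e ∷ discard e T

size : ∀ {A : Set} → List A → ℤ
size = foldr (λ _ n → + 1 ℤ.+ n) (+ 0)

append : ∀ {A : Set} → List A → List A → List A
append xs ys = foldr (λ x acc → x ∷ acc) ys xs

join : Entry → Entry → Entry
join e₁ e₂ = proj₁ e₁ ℚ.+ proj₁ e₂ , append (proj₂ e₁) (proj₂ e₂)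

-- The place where the budget is enforced: a union of more than K open slots is dropped.
mergeEntry : ℤ → Entry → Entry → Table → Table
mergeEntry K e₁ e₂ T =
  if does (size (append (proj₂ e₁) (proj₂ e₂)) ℤ.≤? K) then insert (join e₁ e₂) T else T

mergeTables : ℤ → Table → Table → Table
mergeTables K A B = foldr (λ e₁ acc → foldr (mergeEntry K e₁) acc B) [] A

spare : Slot → ℤ × List Slot → ℤ × List Slot
spare s q = proj₁ q , s ∷ proj₂ q

serve : ℤ → Slot → ℤ × List Slot → ℤ × List Slot
serve j s q = + 1 ℤ.+ proj₁ q ,
  (proj₁ s , + 1 ℤ.+ proj₁ (proj₂ s) , j ∷ proj₂ (proj₂ s)) ∷ proj₂ q

-- All ways to process job j in some of the slots, with the number of units it gets.
choices : ℤ → ℤ → List Slot → List (ℤ × List Slot)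
choices m j = foldr (λ s acc → foldr (λ q out →
  if does (+ 1 ℤ.+ proj₁ (proj₂ s) ℤ.≤? m) then serve j s q ∷ spare s q ∷ out else spare s q ∷ out) [] acc)
  ((+ 0 , []) ∷ [])

reward : Task → ℚ → ℤ → ℚ
reward j w k = if does (work j ℤ.≤? k) then w ℚ.+ gain j else w

addTask : ℤ → Task → Table → Table
addTask m j = foldr (λ e acc → foldr (λ q acc′ →
  insert (reward j (proj₁ e) (proj₁ q) , proj₂ q) acc′) acc (choices m (name j) (proj₂ e))) []

noComponent : Component
noComponent = [] , [] , (0ℚ , []) ∷ []

mergeComponent : ℤ → Component → Component → Component
mergeComponent K c c′ =
  append (proj₁ c) (proj₁ c′) , append (proj₁ (proj₂ c)) (proj₁ (proj₂ c′)) ,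
  mergeTables K (proj₂ (proj₂ c)) (proj₂ (proj₂ c′))

mergeComponents : ℤ → List Component → Component
mergeComponents K = foldr (mergeComponent K) noComponent

covers : Task → List ℤ → Bool
covers j = foldr (λ t acc →
  if does (start j ℤ.≤? t) then if does (t ℤ.≤? end j) then acc else false else false) true

inner outer : Task → List Component → List Component
inner j = foldr (λ c acc → if covers j (proj₁ c) then c ∷ acc else acc) []
outer j = foldr (λ c acc → if covers j (proj₁ c) then acc else c ∷ acc) []

-- If no component lies inside the window, the new component has no slots. It is then covered
-- vacuously by the next window and absorbed there.
process : ℤ → ℤ → Task → List Component → List Component
process K m j cs = (proj₁ c , j ∷ proj₁ (proj₂ c) , addTask m j (proj₂ (proj₂ c))) ∷ outer j cs
  where c = mergeComponents K (inner j cs)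

span : Task → ℤ
span j = end j ℤ.- start j

-- The accumulator pairs the traversed list with the same list after insertion.
insertBefore : Task → Task → List Task × List Task → List Task × List Task
insertBefore x y acc = y ∷ proj₁ acc ,
  (if does (span y ℤ.≤? span x) then x ∷ y ∷ proj₁ acc else y ∷ proj₂ acc)

insertTask : Task → List Task → List Task
insertTask x ys = proj₂ (foldr (insertBefore x) ([] , x ∷ []) ys)

-- The right fold meets the last job first, so the counter starts at the number of jobs and is
-- decremented before it becomes a name.
numberAndInsert : ⟦ Job ⟧ᵀ → ℤ × List Task → ℤ × List Task
numberAndInsert j acc = proj₁ acc ℤ.- + 1 , insertTask (proj₁ acc ℤ.- + 1 , j) (proj₂ acc)

-- Sorted by decreasing window length: a right fold meets the shortest windows first.
tasks : List ⟦ Job ⟧ᵀ → List Task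
tasks js = proj₂ (foldr numberAndInsert (size js , []) js)

addSlot : ℤ → List ℤ → List ℤ
addSlot t ts = if foldr (λ u acc → if sameℤ u t then true else acc) false ts then ts else t ∷ ts

candidates : ℤ → List ⟦ Job ⟧ᵀ → List ℤ
candidates K = foldr (λ j acc → foldr (λ i acc′ → addSlot (proj₁ (proj₂ j) ℤ.- i) acc′) acc (below K)) []

-- The two decisions about a slot before any job is processed: open with load 0, or closed. The
-- length of a key therefore counts open slots, including those still empty.
singleton : ℤ → Component
singleton t = t ∷ [] , [] , (0ℚ , (t , + 0 , []) ∷ []) ∷ (0ℚ , []) ∷ []

best : Table → Entry
best = foldr (λ e acc → if does (proj₁ acc ℚ.≤? proj₁ e) then e else acc) (0ℚ , [])

assignment : List Slot → List (ℤ × ℤ)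
assignment = foldr (λ s acc → foldr (λ j acc′ → (proj₁ s , j) ∷ acc′) acc (proj₂ (proj₂ s))) []

components : ℤ → ℤ → List Task → List ℤ → List Component
components K m js ts = foldr (process K m) (foldr (λ t acc → singleton t ∷ acc) [] ts) js

final : ℤ → ℤ → List Task → List ℤ → Table
final K m js ts = proj₂ (proj₂ (mergeComponents K (components K m js ts)))

bestSchedule : Table → List (ℤ × ℤ)
bestSchedule T = assignment (proj₂ (best T))

solve : ℤ → ℤ → List ⟦ Job ⟧ᵀ → List (ℤ × ℤ)
solve K m js = bestSchedule (final K m (tasks js) (candidates K js))

-- The algorithm as an expression

x0 : ∀ {Γ : Ctx} {a} → Exp (a ∷ Γ) a
x0 = var #0

x1 : ∀ {Γ : Ctx} {a b} → Exp (a ∷ b ∷ Γ) b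
x1 = var #1

x2 : ∀ {Γ : Ctx} {a b c} → Exp (a ∷ b ∷ c ∷ Γ) c
x2 = var #2

x3 : ∀ {Γ : Ctx} {a b c d} → Exp (a ∷ b ∷ c ∷ d ∷ Γ) d
x3 = var #3

x4 : ∀ {Γ : Ctx} {a b c d e} → Exp (a ∷ b ∷ c ∷ d ∷ e ∷ Γ) e
x4 = var (there #3)

x5 : ∀ {Γ : Ctx} {a b c d e f} → Exp (a ∷ b ∷ c ∷ d ∷ e ∷ f ∷ Γ) f
x5 = var (there (there #3))

x6 : ∀ {Γ : Ctx} {a b c d e f g} → Exp (a ∷ b ∷ c ∷ d ∷ e ∷ f ∷ g ∷ Γ) g
x6 = var (there (there (there #3)))

sameℤᴱ : Exp (int ∷ int ∷ []) bool
sameℤᴱ = ite (prim leqℤ x0 x1) (prim leqℤ x1 x0) (bool false)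

matchSlotᴱ : Exp (slot ∷ (bool ⊗ list slot) ∷ []) (bool ⊗ list slot)
matchSlotᴱ = case (snd x1) (pair (bool false) nil)
  (pair (ite (call (fst (snd x0) ∷ fst (snd x2) ∷ []) sameℤᴱ) (fst x3) (bool false)) x1)

sameKeyᴱ : Exp (list slot ∷ list slot ∷ []) bool
sameKeyᴱ = let′ (foldˡ x0 (pair (bool true) x1) (call (x0 ∷ x1 ∷ []) matchSlotᴱ))
                (case (snd x0) (fst x0) (bool false))

insertᴱ : Exp (entry ∷ table ∷ []) table
insertᴱ = ite (foldʳ x1 (bool false)
                (ite (ite (call (snd x2 ∷ snd x0 ∷ []) sameKeyᴱ) (prim leqℚ (fst x2) (fst x0)) (bool false))
                     (bool true) x1))
              x1
              (cons x0 (foldʳ x1 nil (ite (call (snd x2 ∷ snd x0 ∷ []) sameKeyᴱ) x1 (cons x0 x1))))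

sizeᴱ : ∀ {τ} → Exp (list τ ∷ []) int
sizeᴱ = foldʳ x0 (int (+ 0)) (prim addℤ (int (+ 1)) x1)

appendᴱ : ∀ {τ} → Exp (list τ ∷ list τ ∷ []) (list τ)
appendᴱ = foldʳ x0 x1 (cons x0 x1)

mergeEntryᴱ : Exp (int ∷ entry ∷ entry ∷ table ∷ []) table
mergeEntryᴱ = let′ (call (snd x1 ∷ snd x2 ∷ []) appendᴱ)
  (ite (prim leqℤ (call (x0 ∷ []) sizeᴱ) x1)
       (call (pair (prim addℚ (fst x2) (fst x3)) x0 ∷ x4 ∷ []) insertᴱ)
       x4)

mergeTablesᴱ : Exp (int ∷ table ∷ table ∷ []) table
mergeTablesᴱ = foldʳ x1 nil (foldʳ x4 x1 (call (x4 ∷ x2 ∷ x0 ∷ x1 ∷ []) mergeEntryᴱ))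

choicesᴱ : Exp (int ∷ int ∷ list slot ∷ []) (list (int ⊗ list slot))
choicesᴱ = foldʳ x2 (cons (pair (int (+ 0)) nil) nil) (foldʳ x1 nil
  (let′ (cons (pair (fst x0) (cons x2 (snd x0))) x1)
        (ite (prim leqℤ (prim addℤ (int (+ 1)) (fst (snd x3))) x5)
             (cons (pair (prim addℤ (int (+ 1)) (fst x1))
                         (cons (pair (fst x3) (pair (prim addℤ (int (+ 1)) (fst (snd x3)))
                                                    (cons x6 (snd (snd x3)))))
                               (snd x1)))
                   x0)
             x0)))

addTaskᴱ : Exp (int ∷ task ∷ table ∷ []) table
addTaskᴱ = foldʳ x2 nil (foldʳ (call (x2 ∷ fst x3 ∷ snd x0 ∷ []) choicesᴱ) x1
  (call (pair (ite (prim leqℤ (fst (snd (snd (snd x5)))) (fst x0))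
                   (prim addℚ (fst x2) (snd (snd (snd (snd x5)))))
                   (fst x2))
              (snd x0) ∷ x1 ∷ []) insertᴱ))

mergeComponentsᴱ : Exp (int ∷ list component ∷ []) component
mergeComponentsᴱ = foldʳ x1 (pair nil (pair nil (cons (pair (rat 0ℚ) nil) nil)))
  (pair (call (fst x0 ∷ fst x1 ∷ []) appendᴱ)
  (pair (call (fst (snd x0) ∷ fst (snd x1) ∷ []) appendᴱ)
        (call (x2 ∷ snd (snd x0) ∷ snd (snd x1) ∷ []) mergeTablesᴱ)))

coversᴱ : Exp (task ∷ list int ∷ []) bool
coversᴱ = foldʳ x1 (bool true)
  (ite (prim leqℤ (fst (snd x2)) x0) (ite (prim leqℤ x0 (fst (snd (snd x2)))) x1 (bool false)) (bool false))

innerᴱ outerᴱ : Exp (task ∷ list component ∷ []) (list component)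
innerᴱ = foldʳ x1 nil (ite (call (x2 ∷ fst x0 ∷ []) coversᴱ) (cons x0 x1) x1)
outerᴱ = foldʳ x1 nil (ite (call (x2 ∷ fst x0 ∷ []) coversᴱ) x1 (cons x0 x1))

processᴱ : Exp (int ∷ int ∷ task ∷ list component ∷ []) (list component)
processᴱ = let′ (call (x0 ∷ call (x2 ∷ x3 ∷ []) innerᴱ ∷ []) mergeComponentsᴱ)
  (cons (pair (fst x0) (pair (cons x3 (fst (snd x0))) (call (x2 ∷ x3 ∷ snd (snd x0) ∷ []) addTaskᴱ)))
        (call (x3 ∷ x4 ∷ []) outerᴱ))

spanᴱ : Exp (task ∷ []) int
spanᴱ = prim subℤ (fst (snd (snd x0))) (fst (snd x0))

insertTaskᴱ : Exp (task ∷ list task ∷ []) (list task)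
insertTaskᴱ = snd (foldʳ x1 (pair nil (cons x0 nil))
  (pair (cons x0 (fst x1))
        (ite (prim leqℤ (call (x0 ∷ []) spanᴱ) (call (x2 ∷ []) spanᴱ))
             (cons x2 (cons x0 (fst x1)))
             (cons x0 (snd x1)))))

tasksᴱ : Exp (list Job ∷ []) (list task)
tasksᴱ = snd (foldʳ x0 (pair (call (x0 ∷ []) sizeᴱ) nil)
  (let′ (prim subℤ (fst x1) (int (+ 1)))
        (pair x0 (call (pair x0 x1 ∷ snd x2 ∷ []) insertTaskᴱ))))

addSlotᴱ : Exp (int ∷ list int ∷ []) (list int)
addSlotᴱ = ite (foldʳ x1 (bool false) (ite (call (x0 ∷ x2 ∷ []) sameℤᴱ) (bool true) x1)) x1 (cons x0 x1)

candidatesᴱ : Exp (int ∷ list Job ∷ []) (list int)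
candidatesᴱ = foldʳ x1 nil (foldʳ (range x2) x1
  (call (prim subℤ (fst (snd x2)) x0 ∷ x1 ∷ []) addSlotᴱ))

singletonsᴱ : Exp (list int ∷ []) (list component)
singletonsᴱ = foldʳ x0 nil
  (cons (pair (cons x0 nil) (pair nil
          (cons (pair (rat 0ℚ) (cons (pair x0 (pair (int (+ 0)) nil)) nil))
          (cons (pair (rat 0ℚ) nil) nil))))
        x1)

bestᴱ : Exp (table ∷ []) entry
bestᴱ = foldʳ x0 (pair (rat 0ℚ) nil) (ite (prim leqℚ (fst x1) (fst x0)) x0 x1)

assignmentᴱ : Exp (list slot ∷ []) (list (int ⊗ int))
assignmentᴱ = foldʳ x0 nil (foldʳ (snd (snd x0)) x1 (cons (pair (fst x2) x0) x1))

componentsᴱ : Exp (int ∷ int ∷ list task ∷ list int ∷ []) (list component)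
componentsᴱ = foldʳ x2 (call (x3 ∷ []) singletonsᴱ) (call (x2 ∷ x3 ∷ x0 ∷ x1 ∷ []) processᴱ)

finalᴱ : Exp (int ∷ int ∷ list task ∷ list int ∷ []) table
finalᴱ = snd (snd (call (x0 ∷ call (x0 ∷ x1 ∷ x2 ∷ x3 ∷ []) componentsᴱ ∷ []) mergeComponentsᴱ))

bestScheduleᴱ : Exp (table ∷ []) (list (int ⊗ int))
bestScheduleᴱ = call (snd (call (x0 ∷ []) bestᴱ) ∷ []) assignmentᴱ

solveᴱ : Exp (int ∷ int ∷ list Job ∷ []) (list (int ⊗ int))
solveᴱ = call (call (x0 ∷ x1 ∷ call (x2 ∷ []) tasksᴱ ∷ call (x0 ∷ x2 ∷ []) candidatesᴱ ∷ []) finalᴱ ∷ []) bestScheduleᴱ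

-- Definitional, because the algorithm is written with the same `foldr`, `foldl`, `matchList` and
-- conditionals that `eval` produces.
eval-solve : ∀ K m js → eval solveᴱ (K ∷ m ∷ js ∷ []) ≡ solve K m js
eval-solve K m js = refl

-- Tables of partial schedules

unique-⊆⇒length-≤ : ∀ {A : Set} {xs ys : List A} → Unique xs → (∀ {x} → x ∈ˡ xs → x ∈ˡ ys) →
                    length xs ≤ length ys
unique-⊆⇒length-≤ []          sub = z≤n
unique-⊆⇒length-≤ {xs = x ∷ xs} (x∉ ∷ uniq) sub with ∈-∃++ (sub (here refl))
... | as , bs , refl = begin
  suc (length xs)              ≤⟨ s≤s (unique-⊆⇒length-≤ uniq sub′) ⟩
  suc (length (as ++ bs))      ≡⟨ cong suc (length-++ as) ⟩
  suc (length as + length bs)  ≡⟨ ℕ.+-suc (length as) (length bs) ⟨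
  length as + length (x ∷ bs)  ≡⟨ length-++ as ⟨
  length (as ++ x ∷ bs)        ∎
  where
  open ℕ.≤-Reasoning
  sub′ : ∀ {y} → y ∈ˡ xs → y ∈ˡ as ++ bs
  sub′ y∈ with ∈-++⁻ as (sub (there y∈))
  ... | inj₁ y∈as         = ∈-++⁺ˡ y∈as
  ... | inj₂ (here refl)  = contradiction refl (All.lookup x∉ y∈)
  ... | inj₂ (there y∈bs) = ∈-++⁺ʳ as y∈bs

append≡++ : ∀ {A : Set} (xs ys : List A) → append xs ys ≡ xs ++ ys
append≡++ []       ys = refl
append≡++ (x ∷ xs) ys = cong (x ∷_) (append≡++ xs ys)

size≡length : ∀ {A : Set} (xs : List A) → size xs ≡ + length xs
size≡length []       = refl
size≡length (x ∷ xs) = cong (ℤ._+_ (+ 1)) (size≡length xs)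

foldr-preserves : ∀ {A B : Set} (P : B → Set) (f : A → B → B) {z} (xs : List A) →
                  (∀ {x b} → x ∈ˡ xs → P b → P (f x b)) → P z → P (foldr f z xs)
foldr-preserves P f []       pres pz = pz
foldr-preserves P f (x ∷ xs) pres pz = pres (here refl) (foldr-preserves P f xs (pres ∘ there) pz)

foldr-establishes : ∀ {A B : Set} (P : B → Set) (f : A → B → B) {z x} (xs : List A) → x ∈ˡ xs →
                    (∀ b → P (f x b)) → (∀ {y b} → P b → P (f y b)) → P (foldr f z xs)
foldr-establishes P f (x ∷ xs) (here refl) est pres = est _
foldr-establishes P f (y ∷ xs) (there x∈)  est pres = pres (foldr-establishes P f xs x∈ est pres)

sameℤ-reflects : ∀ x y → Reflects (x ≡ y) (sameℤ x y)
sameℤ-reflects x y with x ℤ.≤? y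
... | no x≰y = ofⁿ λ x≡y → x≰y (ℤ.≤-reflexive x≡y)
... | yes x≤y with y ℤ.≤? x
...   | yes y≤x = ofʸ (ℤ.≤-antisym x≤y y≤x)
...   | no  y≰x = ofⁿ λ x≡y → y≰x (ℤ.≤-reflexive (sym x≡y))

key : List Slot → List ℤ
key = map (proj₁ ∘ proj₂)

matched : Bool × List Slot → Bool
matched st = matchList (proj₂ st) (proj₁ st) λ _ _ → false

mismatched : ∀ xs ys → matched (foldl matchSlot (false , ys) xs) ≡ false
mismatched []       []       = refl
mismatched []       (y ∷ ys) = refl
mismatched (x ∷ xs) []       = mismatched xs []
mismatched (x ∷ xs) (y ∷ ys) with sameℤ (proj₁ (proj₂ y)) (proj₁ (proj₂ x))
... | true  = mismatched xs ys
... | false = mismatched xs ys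

sameKey-reflects : ∀ xs ys → Reflects (key xs ≡ key ys) (sameKey xs ys)
sameKey-reflects []       []       = ofʸ refl
sameKey-reflects []       (y ∷ ys) = ofⁿ λ ()
sameKey-reflects (x ∷ xs) []       = subst (Reflects _) (sym (mismatched xs [])) (ofⁿ λ ())
sameKey-reflects (x ∷ xs) (y ∷ ys)
  with sameℤ (proj₁ (proj₂ y)) (proj₁ (proj₂ x)) | sameℤ-reflects (proj₁ (proj₂ y)) (proj₁ (proj₂ x))
... | false | ofⁿ y≢x = subst (Reflects _) (sym (mismatched xs ys)) (ofⁿ (y≢x ∘ sym ∘ proj₁ ∘ ∷-injective))
... | true  | ofʸ y≡x with sameKey xs ys | sameKey-reflects xs ys
...   | true  | ofʸ eq  = ofʸ (cong₂ _∷_ (sym y≡x) eq)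
...   | false | ofⁿ neq = ofⁿ (neq ∘ ∷-injectiveʳ)

-- Domination instead of membership: another partial schedule may stand in for the intended one if
-- it has the same key and weighs at least as much.
record Covers (T : Table) (κ : List ℤ) (q : ℚ) : Set where
  constructor covered
  field
    {witness} : Entry
    member    : witness ∈ˡ T
    key≡      : key (proj₂ witness) ≡ κ
    weight≥   : q ℚ.≤ proj₁ witness

dominated-covers : ∀ e T → dominated e T ≡ true → Covers T (key (proj₂ e)) (proj₁ e)
dominated-covers e (x ∷ T) dom with sameKey (proj₂ e) (proj₂ x) | sameKey-reflects (proj₂ e) (proj₂ x)
... | false | _ with dominated-covers e T dom
...   | covered y∈ k w = covered (there y∈) k w
dominated-covers e (x ∷ T) dom | true | ofʸ k with does (proj₁ e ℚ.≤? proj₁ x) | proof (proj₁ e ℚ.≤? proj₁ x)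
...   | true  | ofʸ w = covered (here refl) (sym k) w
...   | false | _ with dominated-covers e T dom
...     | covered y∈ k′ w = covered (there y∈) k′ w

-- Makes `discard` harmless in `insert`: whatever it removes weighs no more than the new entry.
undominated : ∀ e T → dominated e T ≡ false → ∀ {x} → x ∈ˡ T → key (proj₂ e) ≡ key (proj₂ x) →
              proj₁ x ℚ.≤ proj₁ e
undominated e (x ∷ T) dom x∈ k with sameKey (proj₂ e) (proj₂ x) | sameKey-reflects (proj₂ e) (proj₂ x)
undominated e (x ∷ T) dom (here refl) k | false | ofⁿ ¬k = contradiction k ¬k
undominated e (x ∷ T) dom (there y∈)  k | false | _      = undominated e T dom y∈ k
undominated e (x ∷ T) dom x∈ k | true | ofʸ _ with does (proj₁ e ℚ.≤? proj₁ x) | proof (proj₁ e ℚ.≤? proj₁ x)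
undominated e (x ∷ T) ()  x∈ k | true | ofʸ _ | true | _
undominated e (x ∷ T) dom (here refl) k | true | ofʸ _ | false | ofⁿ w≰ = ℚ.<⇒≤ (ℚ.≰⇒> w≰)
undominated e (x ∷ T) dom (there y∈)  k | true | ofʸ _ | false | _ = undominated e T dom y∈ k

∈-discard⁻ : ∀ e T {x} → x ∈ˡ discard e T → x ∈ˡ T × key (proj₂ e) ≢ key (proj₂ x)
∈-discard⁻ e (y ∷ T) x∈ with sameKey (proj₂ e) (proj₂ y) | sameKey-reflects (proj₂ e) (proj₂ y)
∈-discard⁻ e (y ∷ T) x∈ | true | _ with ∈-discard⁻ e T x∈
... | x∈T , ≢ = there x∈T , ≢
∈-discard⁻ e (y ∷ T) (here refl) | false | ofⁿ ≢ = here refl , ≢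
∈-discard⁻ e (y ∷ T) (there x∈)  | false | _ with ∈-discard⁻ e T x∈
... | x∈T , ≢ = there x∈T , ≢

∈-discard⁺ : ∀ e T {x} → x ∈ˡ T → key (proj₂ e) ≢ key (proj₂ x) → x ∈ˡ discard e T
∈-discard⁺ e (y ∷ T) x∈ ≢ with sameKey (proj₂ e) (proj₂ y) | sameKey-reflects (proj₂ e) (proj₂ y)
∈-discard⁺ e (y ∷ T) (here refl) ≢ | true  | ofʸ k = contradiction k ≢
∈-discard⁺ e (y ∷ T) (there x∈)  ≢ | true  | _     = ∈-discard⁺ e T x∈ ≢
∈-discard⁺ e (y ∷ T) (here refl) ≢ | false | _     = here refl
∈-discard⁺ e (y ∷ T) (there x∈)  ≢ | false | _     = there (∈-discard⁺ e T x∈ ≢)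

∈-insert⁻ : ∀ e T {x} → x ∈ˡ insert e T → x ≡ e ⊎ x ∈ˡ T
∈-insert⁻ e T x∈ with dominated e T
∈-insert⁻ e T x∈          | true  = inj₂ x∈
∈-insert⁻ e T (here refl) | false = inj₁ refl
∈-insert⁻ e T (there x∈)  | false = inj₂ (proj₁ (∈-discard⁻ e T x∈))

insert-covers : ∀ e T → Covers (insert e T) (key (proj₂ e)) (proj₁ e)
insert-covers e T with dominated e T in eq
... | true  = dominated-covers e T eq
... | false = covered (here refl) refl ℚ.≤-refl

insert-keeps : ∀ e {T κ q} → Covers T κ q → Covers (insert e T) κ q
insert-keeps e {T} (covered {x} x∈ refl w) with dominated e T in eq
... | true  = covered x∈ refl w
... | false with sameKey (proj₂ e) (proj₂ x) | sameKey-reflects (proj₂ e) (proj₂ x)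
...   | true  | ofʸ k = covered (here refl) k (ℚ.≤-trans w (undominated e T eq x∈ k))
...   | false | ofⁿ ≢ = covered (there (∈-discard⁺ e T x∈ ≢)) refl w

best-∈ : ∀ T → best T ∈ˡ T ⊎ best T ≡ (0ℚ , [])
best-∈ []      = inj₂ refl
best-∈ (e ∷ T) with does (proj₁ (best T) ℚ.≤? proj₁ e) | best-∈ T
... | true  | _       = inj₁ (here refl)
... | false | inj₁ b∈ = inj₁ (there b∈)
... | false | inj₂ eq = inj₂ eq

best-maximal : ∀ T {e} → e ∈ˡ T → proj₁ e ℚ.≤ proj₁ (best T)
best-maximal (e ∷ T) e∈ with does (proj₁ (best T) ℚ.≤? proj₁ e) | proof (proj₁ (best T) ℚ.≤? proj₁ e)
best-maximal (e ∷ T) (here refl) | true  | _      = ℚ.≤-refl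
best-maximal (e ∷ T) (there e∈)  | true  | ofʸ le = ℚ.≤-trans (best-maximal T e∈) le
best-maximal (e ∷ T) (here refl) | false | ofⁿ ≰  = ℚ.<⇒≤ (ℚ.≰⇒> ≰)
best-maximal (e ∷ T) (there e∈)  | false | _      = best-maximal T e∈

covers-best : ∀ {T κ q} → Covers T κ q → q ℚ.≤ proj₁ (best T)
covers-best {T} (covered e∈ _ q≤) = ℚ.≤-trans q≤ (best-maximal T e∈)

best-induction : ∀ (P : Entry → Set) T → P (0ℚ , []) → (∀ {e} → e ∈ˡ T → P e) → P (best T)
best-induction P T base h with best T | best-∈ T
... | _ | inj₁ b∈   = h b∈
... | _ | inj₂ refl = base

Keys : Table → List (List ℤ)
Keys = map (key ∘ proj₂)

discard-unique : ∀ e T → Unique (Keys T) → Unique (Keys (discard e T))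
discard-unique e []      uniq = []
discard-unique e (x ∷ T) (x∉ ∷ uniq) with sameKey (proj₂ e) (proj₂ x)
... | true  = discard-unique e T uniq
... | false = All.tabulate (λ k∈ → fresh (∈-map⁻ _ k∈)) ∷ discard-unique e T uniq
  where
  fresh : ∀ {k} → (∃[ y ] (y ∈ˡ discard e T × k ≡ key (proj₂ y))) → key (proj₂ x) ≢ k
  fresh (y , y∈ , refl) = All.lookup x∉ (∈-map⁺ (key ∘ proj₂) (proj₁ (∈-discard⁻ e T y∈)))

insert-unique : ∀ e T → Unique (Keys T) → Unique (Keys (insert e T))
insert-unique e T uniq with dominated e T
... | true  = uniq
... | false = All.tabulate (λ k∈ → fresh (∈-map⁻ _ k∈)) ∷ discard-unique e T uniq
  where
  fresh : ∀ {k} → (∃[ y ] (y ∈ˡ discard e T × k ≡ key (proj₂ y))) → key (proj₂ e) ≢ k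
  fresh (y , y∈ , refl) = proj₂ (∈-discard⁻ e T y∈)

module _ (K : ℕ) where

  mergeTables-unique : ∀ A B → Unique (Keys (mergeTables (+ K) A B))
  mergeTables-unique A B = foldr-preserves (Unique ∘ Keys) _ A
    (λ {e₁} _ → foldr-preserves (Unique ∘ Keys) _ B λ {e₂} {T} _ → step e₁ e₂ T) []
    where
    step : ∀ e₁ e₂ T → Unique (Keys T) → Unique (Keys (mergeEntry (+ K) e₁ e₂ T))
    step e₁ e₂ T uniq with size (append (proj₂ e₁) (proj₂ e₂)) ℤ.≤? + K
    ... | yes _ = insert-unique (join e₁ e₂) T uniq
    ... | no  _ = uniq

  mergeTables-sound : ∀ (P : Entry → Set) A B →
    (∀ {e₁ e₂} → e₁ ∈ˡ A → e₂ ∈ˡ B → length (proj₂ (join e₁ e₂)) ≤ K → P (join e₁ e₂)) →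
    ∀ {e} → e ∈ˡ mergeTables (+ K) A B → P e
  mergeTables-sound P A B h = foldr-preserves (λ T → ∀ {e} → e ∈ˡ T → P e) _ A
    (λ {e₁} e₁∈ → foldr-preserves (λ T → ∀ {e} → e ∈ˡ T → P e) _ B λ {e₂} {T} e₂∈ PT → step e₁∈ e₂∈ T PT) λ ()
    where
    step : ∀ {e₁ e₂} → e₁ ∈ˡ A → e₂ ∈ˡ B → ∀ T → (∀ {e} → e ∈ˡ T → P e) → 
           ∀ {e} → e ∈ˡ mergeEntry (+ K) e₁ e₂ T → P e
    step {e₁} {e₂} e₁∈ e₂∈ T PT e∈ with size (append (proj₂ e₁) (proj₂ e₂)) ℤ.≤? + K
    ... | no  _ = PT e∈
    ... | yes s≤K with ∈-insert⁻ (join e₁ e₂) T e∈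
    ...   | inj₁ refl = h e₁∈ e₂∈ (ℤ.drop‿+≤+ (subst (ℤ._≤ + K) (size≡length (append (proj₂ e₁) (proj₂ e₂))) s≤K))
    ...   | inj₂ e∈T  = PT e∈T

  mergeTables-covers : ∀ {A B κ₁ κ₂ q₁ q₂} → Covers A κ₁ q₁ → Covers B κ₂ q₂ → length (κ₁ ++ κ₂) ≤ K →
    Covers (mergeTables (+ K) A B) (κ₁ ++ κ₂) (q₁ ℚ.+ q₂)
  mergeTables-covers {A} {B} {q₁ = q₁} {q₂} (covered {e₁} e₁∈ refl w₁) (covered {e₂} e₂∈ refl w₂) len =
    foldr-establishes P _ A e₁∈
      (λ T → foldr-establishes P _ B e₂∈ establish (λ {e₂} {T} → keep e₁ e₂ T))
      (λ {e₁} → foldr-preserves P _ B λ {e₂} {T} _ → keep e₁ e₂ T)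
    where
    P : Table → Set
    P T = Covers T (key (proj₂ e₁) ++ key (proj₂ e₂)) (q₁ ℚ.+ q₂)
    keep : ∀ e₁ e₂ T → P T → P (mergeEntry (+ K) e₁ e₂ T)
    keep e₁ e₂ T c with size (append (proj₂ e₁) (proj₂ e₂)) ℤ.≤? + K
    ... | yes _ = insert-keeps (join e₁ e₂) c
    ... | no  _ = c
    key-append : key (append (proj₂ e₁) (proj₂ e₂)) ≡ key (proj₂ e₁) ++ key (proj₂ e₂)
    key-append = trans (cong key (append≡++ (proj₂ e₁) (proj₂ e₂))) (map-++ _ (proj₂ e₁) (proj₂ e₂))
    fits : size (append (proj₂ e₁) (proj₂ e₂)) ℤ.≤ + K
    fits = subst (ℤ._≤ + K) (sym (trans (size≡length (append (proj₂ e₁) (proj₂ e₂)))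
             (cong +_ (trans (sym (length-map _ (append (proj₂ e₁) (proj₂ e₂)))) (cong length key-append)))))
             (ℤ.+≤+ len)
    establish : ∀ T → P (mergeEntry (+ K) e₁ e₂ T)
    establish T with size (append (proj₂ e₁) (proj₂ e₂)) ℤ.≤? + K
    ... | no s≰ = contradiction fits s≰
    ... | yes _ with insert-covers (join e₁ e₂) T
    ...   | covered e∈ k w = covered e∈ (trans k key-append) (ℚ.≤-trans (ℚ.+-mono-≤ w₁ w₂) w)

-- An inductive description of `choices`, so that later proofs recurse on a derivation and not on
-- nested folds.
data Chosen (m : ℕ) (j : ℤ) : List Slot → ℕ → List Slot → Set where
  []   : Chosen m j [] 0 []
  skip : ∀ s {ss k ss′} → Chosen m j ss k ss′ → Chosen m j (s ∷ ss) k (s ∷ ss′)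
  use  : ∀ t c js {ss k ss′} → + 1 ℤ.+ c ℤ.≤ + m → Chosen m j ss k ss′ →
         Chosen m j ((t , c , js) ∷ ss) (suc k) ((t , + 1 ℤ.+ c , j ∷ js) ∷ ss′)

module _ (m : ℕ) (j : ℤ) where

  extend : Slot → ℤ × List Slot → List (ℤ × List Slot) → List (ℤ × List Slot)
  extend s q out = if does (+ 1 ℤ.+ proj₁ (proj₂ s) ℤ.≤? + m)
                   then serve j s q ∷ spare s q ∷ out else spare s q ∷ out

  choices-sound : ∀ ss {q} → q ∈ˡ choices (+ m) j ss → ∃[ k ] ∃[ ss′ ] (Chosen m j ss k ss′ × q ≡ (+ k , ss′))
  choices-sound []                   (here refl) = 0 , [] , [] , refl
  choices-sound (s@(t , c , js) ∷ ss) q∈ =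
    foldr-preserves P (extend s) (choices (+ m) j ss) (λ {q} {out} → step q out) (λ ()) q∈
    where
    P : List (ℤ × List Slot) → Set
    P out = ∀ {q} → q ∈ˡ out → ∃[ k ] ∃[ ss′ ] (Chosen m j (s ∷ ss) k ss′ × q ≡ (+ k , ss′))
    step : ∀ q out → q ∈ˡ choices (+ m) j ss → P out → P (extend s q out)
    step q out q∈ Pout q′∈ with choices-sound ss q∈ | + 1 ℤ.+ c ℤ.≤? + m
    step q out q∈ Pout (here refl)         | k , ss′ , ch , refl | yes c< = _ , _ , use t c js c< ch , refl
    step q out q∈ Pout (there (here refl)) | k , ss′ , ch , refl | yes c< = _ , _ , skip s ch , refl
    step q out q∈ Pout (there (there q′∈)) | k , ss′ , ch , refl | yes c< = Pout q′∈
    step q out q∈ Pout (here refl)         | k , ss′ , ch , refl | no _ = _ , _ , skip s ch , refl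
    step q out q∈ Pout (there q′∈)         | k , ss′ , ch , refl | no _ = Pout q′∈

  choices-complete : ∀ {ss k ss′} → Chosen m j ss k ss′ → (+ k , ss′) ∈ˡ choices (+ m) j ss
  choices-complete [] = here refl
  choices-complete (skip s {ss} {k} {ss′} ch) =
    foldr-establishes ((+ k , s ∷ ss′) ∈ˡ_) (extend s) (choices (+ m) j ss) (choices-complete ch) est
      (λ {q} {out} → keep q out)
    where
    est : ∀ out → (+ k , s ∷ ss′) ∈ˡ extend s (+ k , ss′) out
    est out with + 1 ℤ.+ proj₁ (proj₂ s) ℤ.≤? + m
    ... | yes _ = there (here refl)
    ... | no  _ = here refl
    keep : ∀ q out {x} → x ∈ˡ out → x ∈ˡ extend s q out
    keep q out x∈ with + 1 ℤ.+ proj₁ (proj₂ s) ℤ.≤? + m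
    ... | yes _ = there (there x∈)
    ... | no  _ = there x∈
  choices-complete (use t c js {ss} {k} {ss′} c< ch) =
    foldr-establishes ((+ suc k , (t , + 1 ℤ.+ c , j ∷ js) ∷ ss′) ∈ˡ_) (extend s) (choices (+ m) j ss) (choices-complete ch) est
      (λ {q} {out} → keep q out)
    where
    s : Slot
    s = t , c , js
    est : ∀ out → (+ suc k , (t , + 1 ℤ.+ c , j ∷ js) ∷ ss′) ∈ˡ extend s (+ k , ss′) out
    est out with + 1 ℤ.+ c ℤ.≤? + m
    ... | yes _ = here refl
    ... | no c≮ = contradiction c< c≮
    keep : ∀ q out {x} → x ∈ˡ out → x ∈ˡ extend s q out
    keep q out x∈ with + 1 ℤ.+ c ℤ.≤? + m
    ... | yes _ = there (there x∈)
    ... | no  _ = there x∈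

module _ (m : ℕ) (j : Task) where

  addTask-unique : ∀ T → Unique (Keys (addTask (+ m) j T))
  addTask-unique T = foldr-preserves (Unique ∘ Keys) _ T
    (λ {e} _ → foldr-preserves (Unique ∘ Keys) _ (choices (+ m) (name j) (proj₂ e)) λ {q} {T′} _ → insert-unique _ T′) []

  addTask-sound : ∀ (P : Entry → Set) T →
    (∀ {e k ss} → e ∈ˡ T → Chosen m (name j) (proj₂ e) k ss → P (reward j (proj₁ e) (+ k) , ss)) →
    ∀ {e} → e ∈ˡ addTask (+ m) j T → P e
  addTask-sound P T h = foldr-preserves All′ _ T
    (λ {e} e∈ → foldr-preserves All′ _ (choices (+ m) (name j) (proj₂ e)) λ {q} {T′} → step e∈ q T′) λ ()
    where
    All′ : Table → Set
    All′ T = ∀ {e} → e ∈ˡ T → P e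
    step : ∀ {e} → e ∈ˡ T → ∀ q T′ → q ∈ˡ choices (+ m) (name j) (proj₂ e) → All′ T′ →
           All′ (insert (reward j (proj₁ e) (proj₁ q) , proj₂ q) T′)
    step {e} e∈ q T′ q∈ PT x∈ with choices-sound m (name j) (proj₂ e) q∈ | ∈-insert⁻ _ T′ x∈
    ... | k , ss , ch , refl | inj₁ refl = h e∈ ch
    ... | _                  | inj₂ x∈T′ = PT x∈T′

  addTask-covers : ∀ {e k ss} T → e ∈ˡ T → Chosen m (name j) (proj₂ e) k ss →
                   Covers (addTask (+ m) j T) (key ss) (reward j (proj₁ e) (+ k))
  addTask-covers {e} {k} {ss} T e∈ ch = foldr-establishes P _ T e∈
    (λ T′ → foldr-establishes P _ (choices (+ m) (name j) (proj₂ e)) (choices-complete m (name j) ch)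
              (insert-covers (reward j (proj₁ e) (+ k) , ss)) (insert-keeps _))
    (λ {e′} → foldr-preserves P _ (choices (+ m) (name j) (proj₂ e′)) λ _ → insert-keeps _)
    where
    P : Table → Set
    P T = Covers T (key ss) (reward j (proj₁ e) (+ k))

-- Components and the soundness of their tables

total : ∀ {A : Set} → (A → ℚ) → List A → ℚ
total f xs = foldr ℚ._+_ 0ℚ (map f xs)

total-++ : ∀ {A : Set} (f : A → ℚ) xs ys → total f (xs ++ ys) ≡ total f xs ℚ.+ total f ys
total-++ f []       ys = sym (ℚ.+-identityˡ _)
total-++ f (x ∷ xs) ys = trans (cong (ℚ._+_ (f x)) (total-++ f xs ys)) (sym (ℚ.+-assoc (f x) _ _))

total-mono : ∀ {A : Set} {f g : A → ℚ} xs → (∀ {x} → x ∈ˡ xs → f x ℚ.≤ g x) → total f xs ℚ.≤ total g xs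
total-mono []       h = ℚ.≤-refl
total-mono (x ∷ xs) h = ℚ.+-mono-≤ (h (here refl)) (total-mono xs (h ∘ there))

total-↭ : ∀ {A : Set} (f : A → ℚ) {xs ys} → xs ↭ ys → total f xs ≡ total f ys
total-↭ f refl         = refl
total-↭ f (prep x p)   = cong (ℚ._+_ (f x)) (total-↭ f p)
total-↭ f (swap x y p) = trans (sym (ℚ.+-assoc (f x) (f y) _)) (trans (cong₂ ℚ._+_ (ℚ.+-comm (f x) (f y)) (total-↭ f p)) (ℚ.+-assoc (f y) (f x) _))
total-↭ f (↭-tr p q)   = trans (total-↭ f p) (total-↭ f q)

concatMap-↭ : ∀ {A B : Set} (f : A → List B) {xs ys} → xs ↭ ys → concatMap f xs ↭ concatMap f ys
concatMap-↭ f refl       = ↭-refl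
concatMap-↭ f (prep x p) = ++⁺ˡ (f x) (concatMap-↭ f p)
concatMap-↭ f (swap {xs} {ys} x y p) =
  ↭-trans (↭-sym (++-assoc (f x) (f y) _))
  (↭-trans (↭-++⁺ (++-comm (f x) (f y)) (concatMap-↭ f p))
           (++-assoc (f y) (f x) _))
concatMap-↭ f (↭-tr p q) = ↭-trans (concatMap-↭ f p) (concatMap-↭ f q)

Unique-⊑ : ∀ {A : Set} {xs ys : List A} → xs ⊑ ys → Unique ys → Unique xs
Unique-⊑ []         []         = []
Unique-⊑ (y ∷ʳ s)   (_ ∷ u)    = Unique-⊑ s u
Unique-⊑ (refl ∷ s) (x∉ ∷ u)   = Sub.All-resp-⊆ s x∉ ∷ Unique-⊑ s u

slotsOf : Component → List ℤ
slotsOf = proj₁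

tasksOf : Component → List Task
tasksOf = proj₁ ∘ proj₂

tableOf : Component → Table
tableOf = proj₂ ∘ proj₂

jobsAt : Slot → List ℤ
jobsAt = proj₂ ∘ proj₂

Within : Task → ℤ → Set
Within j t = start j ℤ.≤ t × t ℤ.≤ end j

covers-reflects : ∀ j X → Reflects (All (Within j) X) (covers j X)
covers-reflects j []      = ofʸ []
covers-reflects j (t ∷ X) with start j ℤ.≤? t | t ℤ.≤? end j | covers j X | covers-reflects j X
... | yes r | yes d | true  | ofʸ a  = ofʸ ((r , d) ∷ a)
... | yes r | yes d | false | ofⁿ ¬a = ofⁿ λ { (_ ∷ a) → ¬a a }
... | yes r | no ¬d | _     | _      = ofⁿ λ { ((_ , d) ∷ _) → ¬d d }
... | no ¬r | _     | _     | _      = ofⁿ λ { ((r , _) ∷ _) → ¬r r }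

∈-inner⁻ : ∀ j cs {c} → c ∈ˡ inner j cs → c ∈ˡ cs × All (Within j) (slotsOf c)
∈-inner⁻ j (c ∷ cs) c∈ with covers j (slotsOf c) | covers-reflects j (slotsOf c)
∈-inner⁻ j (c ∷ cs) (here refl) | true  | ofʸ a = here refl , a
∈-inner⁻ j (c ∷ cs) (there c∈)  | true  | _ with ∈-inner⁻ j cs c∈
... | c∈cs , a = there c∈cs , a
∈-inner⁻ j (c ∷ cs) c∈          | false | _ with ∈-inner⁻ j cs c∈
... | c∈cs , a = there c∈cs , a

∈-outer⁻ : ∀ j cs {c} → c ∈ˡ outer j cs → c ∈ˡ cs × ¬ All (Within j) (slotsOf c)
∈-outer⁻ j (c ∷ cs) c∈ with covers j (slotsOf c) | covers-reflects j (slotsOf c)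
∈-outer⁻ j (c ∷ cs) (here refl) | false | ofⁿ ¬a = here refl , ¬a
∈-outer⁻ j (c ∷ cs) (there c∈)  | false | _ with ∈-outer⁻ j cs c∈
... | c∈cs , ¬a = there c∈cs , ¬a
∈-outer⁻ j (c ∷ cs) c∈          | true  | _ with ∈-outer⁻ j cs c∈
... | c∈cs , ¬a = there c∈cs , ¬a

inner++outer : ∀ j cs → inner j cs ++ outer j cs ↭ cs
inner++outer j []       = ↭-refl
inner++outer j (c ∷ cs) with covers j (slotsOf c)
... | true  = ↭-prep c (inner++outer j cs)
... | false = ↭-trans (shift c (inner j cs) (outer j cs)) (↭-prep c (inner++outer j cs))

length-outer : ∀ j cs → length (outer j cs) ≤ length cs
length-outer j []       = z≤n
length-outer j (c ∷ cs) with covers j (slotsOf c)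
... | true  = ℕ.m≤n⇒m≤1+n (length-outer j cs)
... | false = s≤s (length-outer j cs)

count : ℤ → List Slot → ℕ
count i ss = length (filter (λ s → i ∈? jobsAt s) ss)

count-++ : ∀ i ss ss′ → count i (ss ++ ss′) ≡ count i ss + count i ss′
count-++ i ss ss′ = trans (cong length (filter-++ _ ss ss′)) (length-++ (filter _ ss))

count-here : ∀ i s ss → i ∈ˡ jobsAt s → count i (s ∷ ss) ≡ suc (count i ss)
count-here i s ss i∈ = cong length (filter-accept (λ s → i ∈? jobsAt s) i∈)

count-∷-mono : ∀ i s s′ {ss ss′} → (i ∈ˡ jobsAt s → i ∈ˡ jobsAt s′) → count i ss ≤ count i ss′ →
               count i (s ∷ ss) ≤ count i (s′ ∷ ss′)
count-∷-mono i s s′ sub c≤ with i ∈? jobsAt s | i ∈? jobsAt s′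
... | yes _  | yes _  = s≤s c≤
... | yes i∈ | no i∉  = contradiction (sub i∈) i∉
... | no  _  | yes _  = ℕ.m≤n⇒m≤1+n c≤
... | no  _  | no  _  = c≤

earned : List Slot → Task → ℚ
earned ss j = if does (work j ℤ.≤? + count (name j) ss) then gain j else 0ℚ

earned-nonneg : ∀ ss j → 0ℚ ℚ.≤ gain j → 0ℚ ℚ.≤ earned ss j
earned-nonneg ss j 0≤g with work j ℤ.≤? + count (name j) ss
... | yes _ = 0≤g
... | no  _ = ℚ.≤-refl

if-mono : ∀ {P Q : Set} (P? : Dec P) (Q? : Dec Q) {w} → 0ℚ ℚ.≤ w → (P → Q) →
          (if does P? then w else 0ℚ) ℚ.≤ (if does Q? then w else 0ℚ)
if-mono (yes p) (yes q) 0≤w imp = ℚ.≤-refl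
if-mono (yes p) (no ¬q) 0≤w imp = contradiction (imp p) ¬q
if-mono (no ¬p) (yes q) 0≤w imp = 0≤w
if-mono (no ¬p) (no ¬q) 0≤w imp = ℚ.≤-refl

earned-mono : ∀ ss ss′ j → 0ℚ ℚ.≤ gain j → count (name j) ss ≤ count (name j) ss′ →
              earned ss j ℚ.≤ earned ss′ j
earned-mono ss ss′ j 0≤g c≤ = if-mono (work j ℤ.≤? + count (name j) ss) (work j ℤ.≤? + count (name j) ss′) 0≤g
  λ p≤ → ℤ.≤-trans p≤ (ℤ.+≤+ c≤)

-- Laminarity oriented by the processing order. With shorter windows processed first, the case of a
-- window strictly inside an earlier one disappears.
Nested : List Task → Task → Set
Nested D j = ∀ {i} → i ∈ˡ D → (∀ t → Within i t → Within j t) ⊎ (∀ t → Within i t → ¬ Within j t)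

Nesting : List Task → Set
Nesting []      = ⊤
Nesting (j ∷ D) = Nested D j × Nesting D

record ValidSlot (m : ℕ) (Y : List Task) (s : Slot) : Set where
  constructor validSlot
  field
    counted  : proj₁ (proj₂ s) ≡ + length (jobsAt s)
    capacity : length (jobsAt s) ≤ m
    origin   : ∀ {i} → i ∈ˡ jobsAt s → ∃[ j ] (j ∈ˡ Y × name j ≡ i × Within j (proj₁ s))

-- A sublist of `X`, and not merely a subset, so that distinct candidates give distinct slots. The
-- weight is only a lower bound on the earnings: this suffices for optimality and avoids proving
-- that a job does not yet occur in the slots to which it is added.
record Valid (K m : ℕ) (X : List ℤ) (Y : List Task) (e : Entry) : Set where
  constructor valid
  field
    slots⊑     : map proj₁ (proj₂ e) ⊑ X
    few        : length (proj₂ e) ≤ K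
    validSlots : All (ValidSlot m Y) (proj₂ e)
    weight≤    : proj₁ e ℚ.≤ total (earned (proj₂ e)) Y

NonNegative : List Task → Set
NonNegative Y = ∀ {j} → j ∈ˡ Y → 0ℚ ℚ.≤ gain j

weaken-slot : ∀ {m Y Y′ s} → (∀ {j} → j ∈ˡ Y → j ∈ˡ Y′) → ValidSlot m Y s → ValidSlot m Y′ s
weaken-slot sub (validSlot c k o) = validSlot c k λ i∈ → let j , j∈ , n , w = o i∈ in j , sub j∈ , n , w

empty-valid : ∀ {K m} X Y → NonNegative Y → Valid K m X Y (0ℚ , [])
empty-valid X Y nn = valid (minimum X) z≤n [] (nonneg Y nn)
  where
  nonneg : ∀ Y → NonNegative Y → 0ℚ ℚ.≤ total (earned []) Y
  nonneg []      nn = ℚ.≤-refl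
  nonneg (j ∷ Y) nn = ℚ.+-mono-≤ (earned-nonneg [] j (nn (here refl))) (nonneg Y (nn ∘ there))

join-valid : ∀ {K m X X′ Y Y′ e e′} → NonNegative Y → NonNegative Y′ →
  Valid K m X Y e → Valid K m X′ Y′ e′ → length (proj₂ (join e e′)) ≤ K →
  Valid K m (append X X′) (append Y Y′) (join e e′)
join-valid {X = X} {X′} {Y} {Y′} {w , ss} {w′ , ss′} nn nn′ (valid s⊑ f vs w≤) (valid s⊑′ f′ vs′ w≤′) len
  rewrite append≡++ X X′ | append≡++ Y Y′ | append≡++ ss ss′ = valid
  (subst (_⊑ X ++ X′) (sym (map-++ proj₁ ss ss′)) (Sub.++⁺ s⊑ s⊑′))
  len
  (All.++⁺ (All.map (weaken-slot ∈-++⁺ˡ) vs) (All.map (weaken-slot (∈-++⁺ʳ Y)) vs′))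
  (subst (w ℚ.+ w′ ℚ.≤_) (sym (total-++ _ Y Y′)) (ℚ.+-mono-≤
    (ℚ.≤-trans w≤ (total-mono Y λ {j} j∈ → earned-mono ss (ss ++ ss′) j (nn j∈)
      (ℕ.≤-trans (ℕ.m≤m+n _ _) (ℕ.≤-reflexive (sym (count-++ (name j) ss ss′))))))
    (ℚ.≤-trans w≤′ (total-mono Y′ λ {j} j∈ → earned-mono ss′ (ss ++ ss′) j (nn′ j∈)
      (ℕ.≤-trans (ℕ.m≤n+m _ (count (name j) ss)) (ℕ.≤-reflexive (sym (count-++ (name j) ss ss′))))))))

chosen-slots : ∀ {m j ss k ss′} → Chosen m j ss k ss′ → map proj₁ ss′ ≡ map proj₁ ss
chosen-slots []               = refl
chosen-slots (skip s ch)      = cong (proj₁ s ∷_) (chosen-slots ch)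
chosen-slots (use t c js _ ch) = cong (t ∷_) (chosen-slots ch)

chosen-length : ∀ {m j ss k ss′} → Chosen m j ss k ss′ → length ss′ ≡ length ss
chosen-length []                = refl
chosen-length (skip s ch)       = cong suc (chosen-length ch)
chosen-length (use t c js _ ch) = cong suc (chosen-length ch)

chosen-count : ∀ {m j ss k ss′} → Chosen m j ss k ss′ → k ≤ count j ss′
chosen-count [] = z≤n
chosen-count {j = j} (skip s ch) with j ∈? jobsAt s
... | yes _ = ℕ.m≤n⇒m≤1+n (chosen-count ch)
... | no  _ = chosen-count ch
chosen-count {j = j} (use t c js {ss′ = ss′} _ ch) =
  subst (_ ≤_) (sym (count-here j (t , + 1 ℤ.+ c , j ∷ js) ss′ (here refl))) (s≤s (chosen-count ch))

chosen-mono : ∀ {m j ss k ss′} i → Chosen m j ss k ss′ → count i ss ≤ count i ss′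
chosen-mono i [] = z≤n
chosen-mono i (skip s ch)        = count-∷-mono i s s id (chosen-mono i ch)
chosen-mono {j = j} i (use t c js _ ch) =
  count-∷-mono i (t , c , js) (t , + 1 ℤ.+ c , j ∷ js) there (chosen-mono i ch)

chosen-valid : ∀ {m j ss k ss′ Y} → Chosen m (name j) ss k ss′ → All (Within j) (map proj₁ ss) →
               All (ValidSlot m Y) ss → All (ValidSlot m (j ∷ Y)) ss′
chosen-valid []           []       []       = []
chosen-valid (skip s ch)  (_ ∷ w)  (v ∷ vs) = weaken-slot there v ∷ chosen-valid ch w vs
-- Matching `counted` with `refl` replaces the stored load by the number of jobs, so the guard `c<`
-- becomes the capacity bound of the enlarged slot.
chosen-valid {j = j} (use t c js c< ch) (t∈ ∷ w) (validSlot refl _ o ∷ vs) =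
  validSlot refl (ℤ.drop‿+≤+ c<)
    (λ { (here refl) → j , here refl , refl , t∈
       ; (there i∈)  → let j′ , j′∈ , n , w′ = o i∈ in j′ , there j′∈ , n , w′ })
  ∷ chosen-valid ch w vs

reward-valid : ∀ {K m X Y e j k ss} → NonNegative (j ∷ Y) → All (Within j) X → Valid K m X Y e →
  Chosen m (name j) (proj₂ e) k ss → Valid K m X (j ∷ Y) (reward j (proj₁ e) (+ k) , ss)
reward-valid {X = X} {Y} {w , ss₀} {j} {k} {ss} nn win (valid s⊑ f vs w≤) ch = valid
  (subst (_⊑ X) (sym (chosen-slots ch)) s⊑)
  (ℕ.≤-trans (ℕ.≤-reflexive (chosen-length ch)) f)
  (chosen-valid ch (Sub.All-resp-⊆ s⊑ win) vs)
  reward≤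
  where
  w≤′ : w ℚ.≤ total (earned ss) Y
  w≤′ = ℚ.≤-trans w≤ (total-mono Y λ {i} i∈ → earned-mono ss₀ ss i (nn (there i∈)) (chosen-mono (name i) ch))
  reward≤ : reward j w (+ k) ℚ.≤ earned ss j ℚ.+ total (earned ss) Y
  reward≤ with work j ℤ.≤? + k | work j ℤ.≤? + count (name j) ss
  ... | yes _  | yes _ = subst (ℚ._≤ _) (ℚ.+-comm (gain j) w) (ℚ.+-monoʳ-≤ (gain j) w≤′)
  ... | yes p≤ | no p≰ = contradiction (ℤ.≤-trans p≤ (ℤ.+≤+ (chosen-count ch))) p≰
  -- Earned without a reward: `j` might already occur in the slots, so its count can exceed `k`. The
  -- gain is nonnegative, hence the claim only becomes more cautious.
  ... | no _   | yes _ = subst (ℚ._≤ _) (ℚ.+-identityˡ w) (ℚ.+-mono-≤ (nn (here refl)) w≤′)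
  ... | no _   | no _  = subst (ℚ._≤ _) (ℚ.+-identityˡ w) (ℚ.+-monoʳ-≤ 0ℚ w≤′)

module _ (K m : ℕ) where

  ValidComponent : Component → Set
  ValidComponent c = (∀ {e} → e ∈ˡ tableOf c → Valid K m (slotsOf c) (tasksOf c) e) ×
                     NonNegative (tasksOf c) × Unique (Keys (tableOf c))

  slots-merge : ∀ cs → slotsOf (mergeComponents (+ K) cs) ≡ concatMap slotsOf cs
  slots-merge []       = refl
  slots-merge (c ∷ cs) = trans (append≡++ (slotsOf c) _) (cong (slotsOf c ++_) (slots-merge cs))

  tasks-merge : ∀ cs → tasksOf (mergeComponents (+ K) cs) ≡ concatMap tasksOf cs
  tasks-merge []       = refl
  tasks-merge (c ∷ cs) = trans (append≡++ (tasksOf c) _) (cong (tasksOf c ++_) (tasks-merge cs))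

  merge-valid : ∀ cs → (∀ {c} → c ∈ˡ cs → ValidComponent c) → ValidComponent (mergeComponents (+ K) cs)
  merge-valid []       v = (λ { (here refl) → valid [] z≤n [] ℚ.≤-refl }) , (λ ()) , [] ∷ []
  merge-valid (c ∷ cs) v with v (here refl) | merge-valid cs (v ∘ there)
  ... | vc , nn , _ | vcs , nns , _ =
    mergeTables-sound K (Valid K m (append (slotsOf c) (slotsOf c′)) (append (tasksOf c) (tasksOf c′)))
      (tableOf c) (tableOf c′) (λ e∈ e′∈ → join-valid nn nns (vc e∈) (vcs e′∈)) ,
    nonneg , mergeTables-unique K (tableOf c) (tableOf c′)
    where
    c′ : Component
    c′ = mergeComponents (+ K) cs
    nonneg : NonNegative (append (tasksOf c) (tasksOf c′))
    nonneg j∈ with ∈-++⁻ (tasksOf c) (subst (_ ∈ˡ_) (append≡++ (tasksOf c) (tasksOf c′)) j∈)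
    ... | inj₁ j∈c  = nn j∈c
    ... | inj₂ j∈c′ = nns j∈c′

  module _ (X : List ℤ) where

    -- `united` characterises components: distinct slots share one only if some processed window
    -- contains both. `number` holds because a task adds at most one component to the initial
    -- singletons.
    record Invariant (D : List Task) (cs : List Component) : Set where
      field
        valid↓ : ∀ {c} → c ∈ˡ cs → ValidComponent c
        slots↭ : concatMap slotsOf cs ↭ X
        tasks↭ : concatMap tasksOf cs ↭ D
        united : ∀ {c t t′} → c ∈ˡ cs → t ∈ˡ slotsOf c → t′ ∈ˡ slotsOf c →
                 t ≡ t′ ⊎ ∃[ i ] (i ∈ˡ D × Within i t × Within i t′)
        number : length cs ≤ length X + length D

    open Invariant public

    -- Suppose the window of `j` contains `t`. Any other slot of the component shares with `t` an
    -- earlier window, which meets that of `j` and hence lies inside it. So the window contains the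
    -- whole component, which would then be an inner one.
    outer-disjoint : ∀ {D j cs c t} → Nested D j → Invariant D cs → c ∈ˡ outer j cs → t ∈ˡ slotsOf c → ¬ Within j t
    outer-disjoint {j = j} {cs} {c} {t} nest inv c∈ t∈ jt with ∈-outer⁻ j cs c∈
    ... | c∈cs , ¬all = ¬all (All.tabulate within)
      where
      within : ∀ {t′} → t′ ∈ˡ slotsOf c → Within j t′
      within t′∈ with united inv c∈cs t∈ t′∈
      ... | inj₁ refl = jt
      ... | inj₂ (i , i∈ , it , it′) with nest i∈
      ...   | inj₁ sub = sub _ it′
      ...   | inj₂ dis = contradiction jt (dis _ it)

    split : ∀ {D cs} j → Invariant D cs →
            concatMap slotsOf (inner j cs) ++ concatMap slotsOf (outer j cs) ↭ X
    split {cs = cs} j inv =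
      ↭-trans (↭-reflexive (sym (concatMap-++ slotsOf (inner j cs) (outer j cs))))
      (↭-trans (concatMap-↭ slotsOf (inner++outer j cs)) (slots↭ inv))

    process-invariant : ∀ {D j cs} → 0ℚ ℚ.≤ gain j → Invariant D cs → Invariant (j ∷ D) (process (+ K) (+ m) j cs)
    process-invariant {D} {j} {cs} 0≤g inv = record
      { valid↓ = λ { (here refl) → validNew
                   ; (there c∈)  → valid↓ inv (proj₁ (∈-outer⁻ j cs c∈)) }
      ; slots↭ = ↭-trans (↭-reflexive (cong (_++ concatMap slotsOf (outer j cs)) (slots-merge (inner j cs))))
                         (split j inv)
      ; tasks↭ = ↭-prep j (↭-trans (↭-reflexive (trans (cong (_++ concatMap tasksOf (outer j cs)) (tasks-merge (inner j cs)))
                                              (sym (concatMap-++ tasksOf (inner j cs) (outer j cs)))))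
                 (↭-trans (concatMap-↭ tasksOf (inner++outer j cs)) (tasks↭ inv)))
      ; united = λ { (here refl) t∈ t′∈ → inj₂ (j , here refl , All.lookup within t∈ , All.lookup within t′∈)
                   ; (there c∈)  t∈ t′∈ → weaken (united inv (proj₁ (∈-outer⁻ j cs c∈)) t∈ t′∈) }
      ; number = ℕ.≤-trans (s≤s (ℕ.≤-trans (length-outer j cs) (number inv)))
                           (ℕ.≤-reflexive (sym (ℕ.+-suc (length X) (length D))))
      }
      where
      merged : Component
      merged = mergeComponents (+ K) (inner j cs)
      within : All (Within j) (slotsOf merged)
      within = subst (All (Within j)) (sym (slots-merge (inner j cs)))
        (All.concat⁺ (All.map⁺ (All.tabulate λ c∈ → proj₂ (∈-inner⁻ j cs c∈))))
      weaken : ∀ {t t′} → t ≡ t′ ⊎ ∃[ i ] (i ∈ˡ D × Within i t × Within i t′) →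
               t ≡ t′ ⊎ ∃[ i ] (i ∈ˡ j ∷ D × Within i t × Within i t′)
      weaken (inj₁ eq)            = inj₁ eq
      weaken (inj₂ (i , i∈ , ws)) = inj₂ (i , there i∈ , ws)
      validNew : ValidComponent (slotsOf merged , j ∷ tasksOf merged , addTask (+ m) j (tableOf merged))
      validNew with merge-valid (inner j cs) (λ c∈ → valid↓ inv (proj₁ (∈-inner⁻ j cs c∈)))
      ... | v , nn , _ =
        addTask-sound m j (Valid K m (slotsOf merged) (j ∷ tasksOf merged)) (tableOf merged)
          (λ e∈ ch → reward-valid nonneg within (v e∈) ch) ,
        nonneg , addTask-unique m j (tableOf merged)
        where
        nonneg : NonNegative (j ∷ tasksOf merged)
        nonneg (here refl) = 0≤g
        nonneg (there i∈)  = nn i∈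

    -- An open singleton already spends one unit of the budget, so candidates may exist only if K is
    -- positive.
    initial-invariant : (∀ {t} → t ∈ˡ X → 1 ≤ K) → Invariant [] (components (+ K) (+ m) [] X)
    initial-invariant 1≤K = record
      { valid↓ = valid₀ X 1≤K
      ; slots↭ = ↭-reflexive (slots₀ X)
      ; tasks↭ = ↭-reflexive (tasks₀ X)
      ; united = λ c∈ t∈ t′∈ → inj₁ (single X c∈ t∈ t′∈)
      ; number = ℕ.≤-trans (ℕ.≤-reflexive (number₀ X)) (ℕ.m≤m+n (length X) 0)
      }
      where
      start₀ : List ℤ → List Component
      start₀ = foldr (λ t acc → singleton t ∷ acc) []
      valid₀ : ∀ Z → (∀ {t} → t ∈ˡ Z → 1 ≤ K) → ∀ {c} → c ∈ˡ start₀ Z → ValidComponent c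
      valid₀ (t ∷ Z) 1≤K (here refl) =
        (λ { (here refl)         → valid (refl ∷ []) (1≤K (here refl)) (validSlot refl z≤n (λ ()) ∷ []) ℚ.≤-refl
           ; (there (here refl)) → valid (t ∷ʳ []) z≤n [] ℚ.≤-refl }) ,
        (λ ()) , ((λ ()) ∷ []) ∷ ([] ∷ [])
      valid₀ (t ∷ Z) 1≤K (there c∈)  = valid₀ Z (1≤K ∘ there) c∈
      slots₀ : ∀ Z → concatMap slotsOf (start₀ Z) ≡ Z
      slots₀ []      = refl
      slots₀ (t ∷ Z) = cong (t ∷_) (slots₀ Z)
      tasks₀ : ∀ Z → concatMap tasksOf (start₀ Z) ≡ []
      tasks₀ []      = refl
      tasks₀ (t ∷ Z) = tasks₀ Z
      number₀ : ∀ Z → length (start₀ Z) ≡ length Z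
      number₀ []      = refl
      number₀ (t ∷ Z) = cong suc (number₀ Z)
      single : ∀ Z {c t t′} → c ∈ˡ start₀ Z → t ∈ˡ slotsOf c → t′ ∈ˡ slotsOf c → t ≡ t′
      single (u ∷ Z) (here refl) (here refl) (here refl) = refl
      single (u ∷ Z) (there c∈)  t∈ t′∈ = single Z c∈ t∈ t′∈

    components-invariant : (∀ {t} → t ∈ˡ X → 1 ≤ K) → ∀ D → NonNegative D →
                           Invariant D (components (+ K) (+ m) D X)
    components-invariant 1≤K []      nn = initial-invariant 1≤K
    components-invariant 1≤K (j ∷ D) nn = process-invariant (nn (here refl)) (components-invariant 1≤K D (nn ∘ there))

-- Completeness of the tables with respect to a given schedule

module _ (K m : ℕ) (X : List ℤ) (active : ℤ → Bool) (on : ℤ → ℤ → Bool) where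

  chosenBy : Task → ℤ → Bool
  chosenBy j t = on t (name j)

  load : List Task → ℤ → ℕ
  load D t = length (filterᵇ (λ j → on t (name j)) D)

  profile : List Task → List ℤ → List ℤ
  profile D Z = map (λ t → + load D t) (filterᵇ active Z)

  served : Task → List ℤ → ℕ
  served j Z = length (filterᵇ (chosenBy j) (filterᵇ active Z))

  -- Units are counted over all candidates, so the worth does not depend on the current component.
  -- `process-complete` shows that only the component of the task contributes.
  worth : Task → ℚ
  worth j = if does (work j ℤ.≤? + served j X) then gain j else 0ℚ

  Complete : List Task → List Component → Set
  Complete D cs = ∀ {c} → c ∈ˡ cs → Covers (tableOf c) (profile D (slotsOf c)) (total worth (tasksOf c))

  served-++ : ∀ j Y Z → served j (Y ++ Z) ≡ served j Y + served j Z
  served-++ j Y Z = trans (cong (length ∘ filterᵇ (chosenBy j)) (filter-++ (T? ∘ active) Y Z))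
    (trans (cong length (filter-++ (T? ∘ chosenBy j) (filterᵇ active Y) (filterᵇ active Z)))
           (length-++ (filterᵇ (chosenBy j) (filterᵇ active Y))))

  served-↭ : ∀ j {Y Z} → Y ↭ Z → served j Y ≡ served j Z
  served-↭ j p = ↭-length (filter-↭ (T? ∘ chosenBy j) (filter-↭ (T? ∘ active) p))

  served-none : ∀ j Z → (∀ {t} → t ∈ˡ Z → on t (name j) ≡ false) → served j Z ≡ 0
  served-none j []      off = refl
  served-none j (t ∷ Z) off with active t
  ... | false = served-none j Z (off ∘ there)
  ... | true rewrite off (here refl) = served-none j Z (off ∘ there)

  profile-++ : ∀ D Y Z → profile D (Y ++ Z) ≡ profile D Y ++ profile D Z
  profile-++ D Y Z = trans (cong (map _) (filter-++ (T? ∘ active) Y Z)) (map-++ _ (filterᵇ active Y) (filterᵇ active Z))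

  profile-∷ : ∀ j D Z → (∀ {t} → t ∈ˡ Z → on t (name j) ≡ false) → profile (j ∷ D) Z ≡ profile D Z
  profile-∷ j D []      off = refl
  profile-∷ j D (t ∷ Z) off with active t
  ... | false = profile-∷ j D Z (off ∘ there)
  ... | true rewrite off (here refl) = cong (_ ∷_) (profile-∷ j D Z (off ∘ there))

  -- The exchange argument. The slots of the entry may differ from the active slots of the reference
  -- schedule, but the keys agree, so they are paired by position and `j` is placed exactly where
  -- the reference places it. Equal loads let each capacity test succeed.
  choose : ∀ j D → (∀ t → load (j ∷ D) t ≤ m) → ∀ zs ss → key ss ≡ map (λ t → + load D t) zs →
    ∃[ ss′ ] (Chosen m (name j) ss (length (filterᵇ (chosenBy j) zs)) ss′ ×
              key ss′ ≡ map (λ t → + load (j ∷ D) t) zs)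
  choose j D cap []       []               k≡ = [] , [] , refl
  choose j D cap (z ∷ zs) ((t , c , js) ∷ ss) k≡
    with choose j D cap zs ss (∷-injectiveʳ k≡) | proj₁ (∷-injective k≡) | cap z
  ... | ss′ , ch , k≡′ | refl | cap-z with on z (name j)
  ... | true  = _ , use t c js (ℤ.+≤+ cap-z) ch , cong (_ ∷_) k≡′
  ... | false = _ , skip (t , c , js) ch , cong (_ ∷_) k≡′

  -- The combined key has one number for each active slot of the reference schedule in these
  -- components. There are at most K of them, so `mergeEntry` does not drop the combination.
  merge-complete : ∀ D cs → Complete D cs → length (filterᵇ active (concatMap slotsOf cs)) ≤ K →
    let c = mergeComponents (+ K) cs in
    Covers (tableOf c) (profile D (slotsOf c)) (total worth (tasksOf c))
  merge-complete D []       comp len = covered (here refl) refl ℚ.≤-refl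
  merge-complete D (c ∷ cs) comp len
    rewrite append≡++ (slotsOf c) (slotsOf (mergeComponents (+ K) cs))
          | append≡++ (tasksOf c) (tasksOf (mergeComponents (+ K) cs))
          | profile-++ D (slotsOf c) (slotsOf (mergeComponents (+ K) cs))
          | total-++ worth (tasksOf c) (tasksOf (mergeComponents (+ K) cs)) =
    mergeTables-covers K (comp (here refl)) (merge-complete D cs (comp ∘ there) len′)
      (ℕ.≤-trans (ℕ.≤-reflexive lengths) len)
    where
    len≡ : length (filterᵇ active (slotsOf c)) + length (filterᵇ active (concatMap slotsOf cs)) ≡
           length (filterᵇ active (concatMap slotsOf (c ∷ cs)))
    len≡ = trans (sym (length-++ (filterᵇ active (slotsOf c))))
                 (cong length (sym (filter-++ (T? ∘ active) (slotsOf c) (concatMap slotsOf cs))))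
    len′ : length (filterᵇ active (concatMap slotsOf cs)) ≤ K
    len′ = ℕ.≤-trans (ℕ.m≤n+m _ _) (ℕ.≤-trans (ℕ.≤-reflexive len≡) len)
    lengths : length (profile D (slotsOf c) ++ profile D (slotsOf (mergeComponents (+ K) cs))) ≡
              length (filterᵇ active (concatMap slotsOf (c ∷ cs)))
    lengths = trans (length-++ (profile D (slotsOf c)))
              (trans (cong₂ _+_ (length-map _ (filterᵇ active (slotsOf c)))
                                (trans (length-map _ (filterᵇ active (slotsOf (mergeComponents (+ K) cs))))
                                       (cong (length ∘ filterᵇ active) (slots-merge K m cs)))) len≡)

  length-active-↭ : ∀ {Y Z} → Y ↭ Z → length (filterᵇ active Y) ≡ length (filterᵇ active Z)
  length-active-↭ p = ↭-length (filter-↭ (T? ∘ active) p)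

  module _ (few-active : length (filterᵇ active X) ≤ K) where

    -- Outer components avoid the window of `j`, so their profiles stay the same. In the new
    -- component, an entry with the reference profile before `j` is extended by the choices that the
    -- reference makes for `j`.
    process-complete : ∀ {D j cs} → (∀ {t} → ¬ Within j t → on t (name j) ≡ false) →
      (∀ t → load (j ∷ D) t ≤ m) → Nested D j → Invariant K m X D cs → Complete D cs →
      Complete (j ∷ D) (process (+ K) (+ m) j cs)
    process-complete {D} {j} {cs} off cap nest inv comp (there {x = _} c∈) =
      subst (λ κ → Covers _ κ _) (sym (profile-∷ j D _ λ t∈ → off (outer-disjoint K m X {j = j} nest inv c∈ t∈)))
            (comp (proj₁ (∈-outer⁻ j cs c∈)))
    process-complete {D} {j} {cs} off cap nest inv comp (here refl)
      with merge-complete D (inner j cs) (λ c∈ → comp (proj₁ (∈-inner⁻ j cs c∈))) few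
      where
      few : length (filterᵇ active (concatMap slotsOf (inner j cs))) ≤ K
      few = begin
        length (filterᵇ active (concatMap slotsOf (inner j cs)))
          ≤⟨ ℕ.m≤m+n _ _ ⟩
        length (filterᵇ active (concatMap slotsOf (inner j cs))) + length (filterᵇ active (concatMap slotsOf (outer j cs)))
          ≡⟨ length-++ (filterᵇ active (concatMap slotsOf (inner j cs))) ⟨
        length (filterᵇ active (concatMap slotsOf (inner j cs)) ++ filterᵇ active (concatMap slotsOf (outer j cs)))
          ≡⟨ cong length (filter-++ (T? ∘ active) (concatMap slotsOf (inner j cs)) (concatMap slotsOf (outer j cs))) ⟨
        length (filterᵇ active (concatMap slotsOf (inner j cs) ++ concatMap slotsOf (outer j cs)))
          ≡⟨ length-active-↭ (split K m X j inv) ⟩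
        length (filterᵇ active X)
          ≤⟨ few-active ⟩
        K ∎
        where open ℕ.≤-Reasoning
    ... | covered {w , ss} e∈ k≡ w≥
      with choose j D cap (filterᵇ active (slotsOf (mergeComponents (+ K) (inner j cs)))) ss k≡
    ... | ss′ , ch , k≡′ with addTask-covers m j (tableOf (mergeComponents (+ K) (inner j cs))) e∈ ch
    ... | covered y∈ ky w≥′ = covered y∈ (trans ky k≡′) (ℚ.≤-trans worth≤ w≥′)
      where
      Z = slotsOf (mergeComponents (+ K) (inner j cs))
      -- The reference processes `j` only in its window, which meets no outer component, so all
      -- units of `j` fall into the merged one.
      served≡ : served j X ≡ served j Z
      served≡ = begin
        served j X                                          ≡⟨ served-↭ j (split K m X j inv) ⟨
        served j (concatMap slotsOf (inner j cs) ++ concatMap slotsOf (outer j cs))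
          ≡⟨ served-++ j (concatMap slotsOf (inner j cs)) (concatMap slotsOf (outer j cs)) ⟩
        served j (concatMap slotsOf (inner j cs)) + served j (concatMap slotsOf (outer j cs))
          ≡⟨ cong (_+_ (served j (concatMap slotsOf (inner j cs)))) (served-none j _ off-outer) ⟩
        served j (concatMap slotsOf (inner j cs)) + 0       ≡⟨ ℕ.+-identityʳ _ ⟩
        served j (concatMap slotsOf (inner j cs))           ≡⟨ cong (served j) (slots-merge K m (inner j cs)) ⟨
        served j Z                                          ∎
        where
        open ≡-Reasoning
        off-outer : ∀ {t} → t ∈ˡ concatMap slotsOf (outer j cs) → on t (name j) ≡ false
        off-outer t∈ with find (∈-concatMap⁻ slotsOf {xs = outer j cs} t∈)
        ... | c , c∈ , t∈c = off (outer-disjoint K m X {j = j} nest inv c∈ t∈c)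
      worth≤ : worth j ℚ.+ total worth (tasksOf (mergeComponents (+ K) (inner j cs))) ℚ.≤ reward j w (+ served j Z)
      worth≤ rewrite served≡ with work j ℤ.≤? + served j Z
      ... | yes _ = subst (ℚ._≤ _) (ℚ.+-comm _ (gain j)) (ℚ.+-monoˡ-≤ (gain j) w≥)
      ... | no  _ = subst (ℚ._≤ _) (sym (ℚ.+-identityˡ _)) w≥

    initial-complete : Complete [] (components (+ K) (+ m) [] X)
    initial-complete = go X
      where
      go : ∀ Z {c} → c ∈ˡ foldr (λ t acc → singleton t ∷ acc) [] Z →
           Covers (tableOf c) (profile [] (slotsOf c)) (total worth (tasksOf c))
      go (t ∷ Z) (there c∈)  = go Z c∈
      go (t ∷ Z) (here refl) with active t
      ... | true  = covered (here refl) refl ℚ.≤-refl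
      ... | false = covered (there (here refl)) refl ℚ.≤-refl

    load-∷ : ∀ j D t → load D t ≤ load (j ∷ D) t
    load-∷ j D t with on t (name j)
    ... | true  = ℕ.n≤1+n _
    ... | false = ℕ.≤-refl

    components-complete : (∀ {t} → t ∈ˡ X → 1 ≤ K) → ∀ D → NonNegative D → Nesting D →
      (∀ {j} → j ∈ˡ D → ∀ {t} → ¬ Within j t → on t (name j) ≡ false) → (∀ t → load D t ≤ m) →
      Complete D (components (+ K) (+ m) D X)
    components-complete 1≤K []      nn nest off cap = initial-complete
    components-complete 1≤K (j ∷ D) nn (nj , nest) off cap =
      process-complete (off (here refl)) cap nj (components-invariant K m X 1≤K D (nn ∘ there))
        (components-complete 1≤K D (nn ∘ there) nest (off ∘ there) (λ t → ℕ.≤-trans (load-∷ j D t) (cap t)))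

-- Order of the jobs and candidate slots

-- Leaves a ring identity for the solver in place of a linear inequality.
≤-by-difference : ∀ {a b c d} → c ℤ.≤ d → d ℤ.- c ≡ b ℤ.- a → a ℤ.≤ b
≤-by-difference c≤d eq = ℤ.0≤i-j⇒j≤i (subst (+ 0 ℤ.≤_) eq (ℤ.i≤j⇒0≤j-i c≤d))

-- Ascending in the order of a right fold: read from the head, the lengths decrease.
Ascending : List Task → Set
Ascending = AllPairs (λ x y → span y ℤ.≤ span x)

insertTask-pair : ∀ x ys → proj₁ (foldr (insertBefore x) ([] , x ∷ []) ys) ≡ ys
insertTask-pair x []       = refl
insertTask-pair x (y ∷ ys) = cong (y ∷_) (insertTask-pair x ys)

insertTask-↭ : ∀ x ys → insertTask x ys ↭ x ∷ ys
insertTask-↭ x []       = ↭-refl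
insertTask-↭ x (y ∷ ys) with span y ℤ.≤? span x
... | yes _ = ↭-reflexive (cong (λ zs → x ∷ y ∷ zs) (insertTask-pair x ys))
... | no  _ = ↭-trans (↭-prep y (insertTask-↭ x ys)) (↭-swap y x ↭-refl)

insertTask-ascending : ∀ x ys → Ascending ys → Ascending (insertTask x ys)
insertTask-ascending x []       [] = [] ∷ []
insertTask-ascending x (y ∷ ys) (y≥ ∷ asc) with span y ℤ.≤? span x
... | yes y≤x = subst (λ zs → Ascending (x ∷ y ∷ zs)) (sym (insertTask-pair x ys))
                  ((y≤x ∷ All.map (λ z≤y → ℤ.≤-trans z≤y y≤x) y≥) ∷ (y≥ ∷ asc))
... | no  y≰x = All-resp-↭ (↭-sym (insertTask-↭ x ys)) (ℤ.<⇒≤ (ℤ.≰⇒> y≰x) ∷ y≥) ∷ insertTask-ascending x ys asc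

tasks-ascending : ∀ js → Ascending (tasks js)
tasks-ascending js = foldr-preserves (Ascending ∘ proj₂) numberAndInsert js
  (λ {j} {acc} _ → insertTask-ascending (proj₁ acc ℤ.- + 1 , j) (proj₂ acc)) []

-- The offset makes the induction work: the tail is numbered from `suc o` and leaves the counter at
-- `suc o`, so the head gets the name `o`.
number-↭ : ∀ o n (f : Fin n → ⟦ Job ⟧ᵀ) →
  let acc = foldr numberAndInsert (+ (o + n) , []) (tabulate f) in
  proj₁ acc ≡ + o × proj₂ acc ↭ tabulate (λ i → + (o + toℕ i) , f i)
number-↭ o zero    f = cong +_ (ℕ.+-identityʳ o) , ↭-refl
number-↭ o (suc n) f with number-↭ (suc o) n (f ∘ Fin.suc)
... | o≡ , p rewrite ℕ.+-suc o n | o≡ | ℕ.+-identityʳ o =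
  refl , ↭-trans (insertTask-↭ (+ o , f Fin.zero) _)
    (↭-prep (+ o , f Fin.zero) (↭-trans p (↭-reflexive (tabulate-cong λ i →
      cong (λ k → + k , f (Fin.suc i)) (sym (ℕ.+-suc o (toℕ i)))))))

tasks-↭ : ∀ n (f : Fin n → ⟦ Job ⟧ᵀ) → tasks (tabulate f) ↭ tabulate (λ i → + toℕ i , f i)
tasks-↭ n f = subst (λ k → proj₂ (foldr numberAndInsert (k , []) (tabulate f)) ↭ tabulate (λ i → + toℕ i , f i))
  (sym (trans (size≡length (tabulate f)) (cong +_ (length-tabulate f)))) (proj₂ (number-↭ 0 n f))

elem : ℤ → List ℤ → Bool
elem t = foldr (λ u acc → if sameℤ u t then true else acc) false

elem-reflects : ∀ t ts → Reflects (t ∈ˡ ts) (elem t ts)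
elem-reflects t []       = ofⁿ λ ()
elem-reflects t (u ∷ ts) with sameℤ u t | sameℤ-reflects u t
... | true  | ofʸ u≡t = ofʸ (here (sym u≡t))
... | false | ofⁿ u≢t with elem t ts | elem-reflects t ts
...   | true  | ofʸ t∈ = ofʸ (there t∈)
...   | false | ofⁿ t∉ = ofⁿ λ { (here t≡u) → u≢t (sym t≡u) ; (there t∈) → t∉ t∈ }

addSlot-∈ : ∀ t ts → t ∈ˡ addSlot t ts
addSlot-∈ t ts with elem t ts | elem-reflects t ts
... | true  | ofʸ t∈ = t∈
... | false | _      = here refl

addSlot-⊆ : ∀ t ts {u} → u ∈ˡ ts → u ∈ˡ addSlot t ts
addSlot-⊆ t ts u∈ with elem t ts
... | true  = u∈
... | false = there u∈

addSlot-unique : ∀ t ts → Unique ts → Unique (addSlot t ts)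
addSlot-unique t ts u with elem t ts | elem-reflects t ts
... | true  | _      = u
... | false | ofⁿ t∉ = All.¬Any⇒All¬ ts t∉ ∷ u

addSlot-length : ∀ t ts → length (addSlot t ts) ≤ suc (length ts)
addSlot-length t ts with elem t ts
... | true  = ℕ.n≤1+n _
... | false = ℕ.≤-refl

deadlineOf : ⟦ Job ⟧ᵀ → ℤ
deadlineOf j = proj₁ (proj₂ j)

length-addSlots : ∀ d is ts → length (foldr (λ i acc → addSlot (d ℤ.- i) acc) ts is) ≤ length is + length ts
length-addSlots d []       ts = ℕ.≤-refl
length-addSlots d (i ∷ is) ts = ℕ.≤-trans
  (addSlot-length (d ℤ.- i) (foldr (λ i acc → addSlot (d ℤ.- i) acc) ts is)) (s≤s (length-addSlots d is ts))

module _ (K : ℕ) where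

  length-below : length (below (+ K)) ≡ K
  length-below = trans (length-map +_ (downFrom K)) (length-downFrom K)

  candidates-unique : ∀ js → Unique (candidates (+ K) js)
  candidates-unique js = foldr-preserves Unique _ js
    (λ {j} _ → foldr-preserves Unique _ (below (+ K)) λ {i} {ts} _ → addSlot-unique (deadlineOf j ℤ.- i) ts) []

  ∈-candidates : ∀ {js j i} → j ∈ˡ js → i < K → deadlineOf j ℤ.- + i ∈ˡ candidates (+ K) js
  ∈-candidates {js} {j} {i} j∈ i<K = foldr-establishes P _ js j∈
    (λ ts → foldr-establishes P _ (below (+ K)) (∈-map⁺ +_ (∈-downFrom⁺ i<K)) (addSlot-∈ (deadlineOf j ℤ.- + i))
              (λ {i′} {ts} → addSlot-⊆ (deadlineOf j ℤ.- i′) ts))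
    (λ {j′} → foldr-preserves P _ (below (+ K)) λ {i′} {ts} _ → addSlot-⊆ (deadlineOf j′ ℤ.- i′) ts)
    where
    P : List ℤ → Set
    P ts = deadlineOf j ℤ.- + i ∈ˡ ts

  length-candidates : ∀ js → length (candidates (+ K) js) ≤ length js * K
  length-candidates []       = z≤n
  length-candidates (j ∷ js) = ℕ.≤-trans (length-addSlots (deadlineOf j) (below (+ K)) (candidates (+ K) js))
    (ℕ.+-mono-≤ (ℕ.≤-reflexive length-below) (length-candidates js))

∈⇒length≥1 : ∀ {A : Set} {x : A} {xs} → x ∈ˡ xs → 1 ≤ length xs
∈⇒length≥1 (here _)  = s≤s z≤n
∈⇒length≥1 (there _) = s≤s z≤n

candidates-positive : ∀ K js {t} → t ∈ˡ candidates (+ K) js → 1 ≤ K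
candidates-positive (suc K) js t∈ = s≤s z≤n
candidates-positive zero    js t∈ = ℕ.≤-trans (∈⇒length≥1 t∈)
  (ℕ.≤-trans (length-candidates 0 js) (ℕ.≤-reflexive (ℕ.*-zeroʳ (length js))))

∈-slots⁻ : ∀ a b {t} → t ∈ˡ slots a b → a ℤ.≤ t × t ℤ.≤ b
∈-slots⁻ a b t∈ with ∈-applyUpTo⁻ (λ i → a ℤ.+ + i) t∈
... | i , i< , refl = ℤ.i≤i+j a (+ i) , upper (ℤ.suc b ℤ.- a) refl i<
  where
  upper : ∀ z → z ≡ ℤ.suc b ℤ.- a → i < ℤ.∣ + 0 ℤ.⊔ z ∣ → a ℤ.+ + i ℤ.≤ b
  upper (+ k) eq i<k = ≤-by-difference (subst (+ suc i ℤ.≤_) eq (ℤ.+≤+ i<k)) (arith a b (+ i))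
    where arith : ∀ a b i → (ℤ.1ℤ ℤ.+ b) ℤ.- a ℤ.- (ℤ.1ℤ ℤ.+ i) ≡ b ℤ.- (a ℤ.+ i)
          arith = ℤRing.solve-∀

∈-slots⁺ : ∀ a b {t} → a ℤ.≤ t → t ℤ.≤ b → t ∈ˡ slots a b
∈-slots⁺ a b {t} a≤t t≤b = subst (_∈ˡ slots a b) t≡ (∈-applyUpTo⁺ (λ i → a ℤ.+ + i) i<)
  where
  i = ℤ.∣ t ℤ.- a ∣
  i≡ : + i ≡ t ℤ.- a
  i≡ = ℤ.0≤i⇒+∣i∣≡i (ℤ.i≤j⇒0≤j-i a≤t)
  arith₁ : ∀ a t → a ℤ.+ (t ℤ.- a) ≡ t
  arith₁ = ℤRing.solve-∀
  arith₂ : ∀ a b t → b ℤ.- t ≡ (ℤ.1ℤ ℤ.+ b) ℤ.- a ℤ.- (ℤ.1ℤ ℤ.+ (t ℤ.- a))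
  arith₂ = ℤRing.solve-∀
  t≡ : a ℤ.+ + i ≡ t
  t≡ = trans (cong (ℤ._+_ a) i≡) (arith₁ a t)
  i< : i < ℤ.∣ + 0 ℤ.⊔ (ℤ.suc b ℤ.- a) ∣
  i< with ℤ.suc b ℤ.- a | ≤-by-difference {ℤ.1ℤ ℤ.+ (t ℤ.- a)} {ℤ.suc b ℤ.- a} t≤b (arith₂ a b t)
  ... | z | le rewrite sym i≡ with z | le
  ...   | + k | ℤ.+≤+ i<k = i<k

slots-unique : ∀ a b → Unique (slots a b)
slots-unique a b = Unique.applyUpTo⁺₁ _ _ λ {i} {j} i<j _ eq → ℕ.<⇒≢ i<j (ℤ.+-injective (∙-cancelˡ a (+ i) (+ j) eq))

-- Moving active slots to the right onto candidates.

within? : ∀ j t → Dec (Within j t)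
within? j t = (start j ℤ.≤? t) ×-dec (t ℤ.≤? end j)

-- A slot that moves right from `t` up to this deadline stays in every window that contains `t`.
earliest : ∀ J t → (∃[ j ] (j ∈ˡ J × Within j t)) →
           ∃[ j ] (j ∈ˡ J × Within j t × (∀ {i} → i ∈ˡ J → Within i t → end j ℤ.≤ end i))
earliest J t (j₀ , j₀∈ , w₀) = go J (λ j∈ → j∈) j₀∈
  where
  Least : List Task → Set
  Least J′ = ∃[ j ] (j ∈ˡ J × Within j t × (∀ {i} → i ∈ˡ J′ → Within i t → end j ℤ.≤ end i))
  go : ∀ J′ → (∀ {i} → i ∈ˡ J′ → i ∈ˡ J) → j₀ ∈ˡ J → Least J′
  go []       sub _ = j₀ , j₀∈ , w₀ , λ ()
  go (i ∷ J′) sub _ with go J′ (sub ∘ there) j₀∈ | within? i t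
  ... | j , j∈ , w , least | no ¬w = j , j∈ , w , λ { (here refl) w′ → contradiction w′ ¬w ; (there k∈) w′ → least k∈ w′ }
  ... | j , j∈ , w , least | yes wi with ℤ.≤-total (end j) (end i)
  ...   | inj₁ j≤i = j , j∈ , w , λ { (here refl) _ → j≤i ; (there k∈) w′ → least k∈ w′ }
  ...   | inj₂ i≤j = i , sub (here refl) , wi , λ { (here refl) _ → ℤ.≤-refl ; (there k∈) w′ → ℤ.≤-trans i≤j (least k∈ w′) }

-- Walk left from `d` while the slots are taken. The walk ends at `t` at the latest, since `t` is
-- not taken, and the `i` slots passed are distinct members of `us`, so `i` is at most its length.
free : ∀ {t d} us → t ℤ.≤ d → t ∉ˡ us → ∃[ i ] (t ℤ.≤ d ℤ.- + i × d ℤ.- + i ∉ˡ us × i ≤ length us)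
free {t} {d} us t≤d t∉ = go ℤ.∣ d ℤ.- t ∣ 0 (λ ()) (trans (ℤ.0≤i⇒+∣i∣≡i (ℤ.i≤j⇒0≤j-i t≤d)) (arith₀ d t))
  where
  arith₀ : ∀ d t → d ℤ.- t ≡ (d ℤ.- + 0) ℤ.- t
  arith₀ = ℤRing.solve-∀
  arith₁ : ∀ d t i → (d ℤ.- t) ≡ i → t ≡ d ℤ.- i
  arith₁ d t i refl = arith d t
    where arith : ∀ d t → t ≡ d ℤ.- (d ℤ.- t)
          arith = ℤRing.solve-∀
  arith₂ : ∀ d t i → (d ℤ.- i) ℤ.- t ℤ.- ℤ.1ℤ ≡ (d ℤ.- (ℤ.1ℤ ℤ.+ i)) ℤ.- t
  arith₂ = ℤRing.solve-∀
  injective : ∀ {i j} → d ℤ.- + i ≡ d ℤ.- + j → i ≡ j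
  injective {i} {j} eq = ℤ.+-injective (ℤ.neg-injective (∙-cancelˡ d (ℤ.- + i) (ℤ.- + j) eq))
  taken : ∀ i → (∀ {k} → k < i → d ℤ.- + k ∈ˡ us) → i ≤ length us
  taken i below∈ = subst (_≤ length us) (length-applyUpTo (λ k → d ℤ.- + k) i)
    (unique-⊆⇒length-≤ (Unique.applyUpTo⁺₁ (λ k → d ℤ.- + k) i λ i<j _ eq → ℕ.<⇒≢ i<j (injective eq))
      λ u∈ → let k , k< , u≡ = ∈-applyUpTo⁻ (λ k → d ℤ.- + k) u∈ in subst (_∈ˡ us) (sym u≡) (below∈ k<))
  go : ∀ n i → (∀ {k} → k < i → d ℤ.- + k ∈ˡ us) → + n ≡ (d ℤ.- + i) ℤ.- t →
       ∃[ i ] (t ℤ.≤ d ℤ.- + i × d ℤ.- + i ∉ˡ us × i ≤ length us)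
  go n i below∈ n≡ with d ℤ.- + i ∈? us
  ... | no u∉ = i , ℤ.0≤i-j⇒j≤i (subst (+ 0 ℤ.≤_) n≡ (ℤ.+≤+ z≤n)) , u∉ , taken i below∈
  go zero    i below∈ n≡ | yes u∈ = contradiction (subst (_∈ˡ us) (ℤ.i-j≡0⇒i≡j _ _ (sym n≡)) u∈) t∉
  go (suc n) i below∈ n≡ | yes u∈ = go n (suc i) below∈′ (trans (cong (ℤ._- ℤ.1ℤ) n≡) (arith₂ d t (+ i)))
    where
    below∈′ : ∀ {k} → k < suc i → d ℤ.- + k ∈ˡ us
    below∈′ {k} (s≤s k≤i) with ℕ.m≤n⇒m<n∨m≡n k≤i
    ... | inj₁ k<i  = below∈ k<i
    ... | inj₂ refl = u∈

-- The map goes from the new slot back to the old one, so that the moved schedule is the old one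
-- composed with `ψ`.
Moved : List Task → (ℤ → ℤ) → ℤ → ℤ → Set
Moved J ψ t u = ψ u ≡ t × t ℤ.≤ u × (∀ {j} → j ∈ˡ J → Within j t → Within j u)

-- Handling the rightmost slots first, each slot t can be moved right to the last free slot
-- that does not exceed the least deadline of the windows containing t; ψ undoes the moves.
shift-right : ∀ {K J X} → (∀ {j i} → j ∈ˡ J → i < K → end j ℤ.- + i ∈ˡ X) → ∀ ts → AllPairs ℤ._<_ ts →
  All (λ t → ∃[ j ] (j ∈ˡ J × Within j t)) ts → length ts ≤ K →
  ∃[ us ] Σ[ ψ ∈ (ℤ → ℤ) ] (Unique us × All (_∈ˡ X) us ×
    Pointwise (Moved J ψ) ts us)
shift-right X-has []       _ _ _ = [] , id , [] , [] , []
shift-right {J = J} X-has (t ∷ ts) (t< ∷ sorted) (window ∷ windows) len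
  with shift-right X-has ts sorted windows (ℕ.<⇒≤ len) | earliest J t window
... | us , ψ , uniq , us∈ , moves | j , j∈ , (_ , t≤d) , least with free us t≤d (t∉ t< moves)
  where
  t∉ : ∀ {ts us} → All (t ℤ.<_) ts → Pointwise (Moved J ψ) ts us → t ∉ˡ us
  t∉ (t<t′ ∷ _) ((_ , t′≤t , _) ∷ _) (here refl) = ℤ.<⇒≱ t<t′ t′≤t
  t∉ (_ ∷ t<)   (_ ∷ moves)          (there t∈)  = t∉ t< moves t∈
... | i , t≤u , u∉ , i≤ = u ∷ us , ψ′ , All.¬Any⇒All¬ us u∉ ∷ uniq , X-has j∈ i<K ∷ us∈ ,
  (ψ′-u , t≤u , λ k∈ w → ℤ.≤-trans (proj₁ w) t≤u , ℤ.≤-trans (ℤ.i≤j⇒i-k≤j (+ i) ℤ.≤-refl) (least k∈ w)) ∷ extend′ u∉ moves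
  where
  u = end j ℤ.- + i
  -- `free` skips at most as many slots as were placed before, and these together with `t` number at
  -- most K. This is why K candidates per deadline suffice.
  i<K : i < _
  i<K = ℕ.≤-trans (s≤s (subst (i ≤_) (sym (Pointwise.Pointwise-length moves)) i≤)) len
  ψ′ : ℤ → ℤ
  ψ′ x = if does (x ℤ.≟ u) then t else ψ x
  ψ′-u : ψ′ u ≡ t
  ψ′-u with u ℤ.≟ u
  ... | yes _  = refl
  ... | no u≢u = contradiction refl u≢u
  ψ′-≢ : ∀ {x} → x ≢ u → ψ′ x ≡ ψ x
  ψ′-≢ {x} x≢u with x ℤ.≟ u
  ... | yes x≡u = contradiction x≡u x≢u
  ... | no _    = refl
  extend′ : ∀ {ts us} → u ∉ˡ us →
    Pointwise (Moved J ψ) ts us →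
    Pointwise (Moved J ψ′) ts us
  extend′ u∉ [] = []
  extend′ u∉ ((eq , rest) ∷ moves) = (trans (ψ′-≢ (u∉ ∘ here ∘ sym)) eq , rest) ∷ extend′ (u∉ ∘ there) moves

-- Bounds on the lengths of lists

-- An explicit enumeration of the possible profiles, used for counting: its length bounds every
-- table with distinct keys.
keysUpTo : ℕ → ℕ → List (List ℤ)
keysUpTo m zero    = [] ∷ []
keysUpTo m (suc K) = [] ∷ concatMap (λ c → map (+ c ∷_) (keysUpTo m K)) (upTo (suc m))

Small : ℕ → ℤ → Set
Small m i = ∃[ c ] (c ≤ m × i ≡ + c)

∈-keysUpTo : ∀ m K {κ} → length κ ≤ K → All (Small m) κ → κ ∈ˡ keysUpTo m K
∈-keysUpTo m zero    {[]}    _         []                     = here refl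
∈-keysUpTo m (suc K) {[]}    _         []                     = here refl
∈-keysUpTo m (suc K) {_ ∷ κ} (s≤s len) ((c , c≤m , refl) ∷ sm) =
  there (∈-concatMap⁺ _ (lose (∈-upTo⁺ (s≤s c≤m)) (∈-map⁺ _ (∈-keysUpTo m K len sm))))

matchList-all : ∀ {A : Set} (xs : List A) {P : A → List A → Set} → (∀ y ys → P y ys) → matchList xs ⊤ P
matchList-all []       h = tt
matchList-all (x ∷ xs) h = h x xs

-- One hypothesis for each kind of list whose length is independent of n: two entries concatenated
-- before the budget test, the choices for one job, a table, and the jobs of one slot.
module _ (B K m : ℕ) (2K≤B : K + K ≤ B) (2^K≤B : 2 ^ K ≤ B) (keys≤B : length (keysUpTo m K) ≤ B) (m≤B : m ≤ B) where

  K≤B : K ≤ B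
  K≤B = ℕ.≤-trans (ℕ.m≤m+n K K) 2K≤B

  Fits : Entry → Set
  Fits e = length (proj₂ e) ≤ K × All (Small m) (key (proj₂ e))

  Compact : Table → Set
  Compact T = Unique (Keys T) × (∀ {e} → e ∈ˡ T → Fits e)

  compact-length : ∀ {T} → Compact T → length T ≤ B
  compact-length {T} (uniq , fits) = ℕ.≤-trans
    (subst (_≤ length (keysUpTo m K)) (length-map _ T) (unique-⊆⇒length-≤ uniq sub)) keys≤B
    where
    sub : ∀ {κ} → κ ∈ˡ Keys T → κ ∈ˡ keysUpTo m K
    sub κ∈ with ∈-map⁻ (key ∘ proj₂) κ∈
    ... | e , e∈ , refl = ∈-keysUpTo m K (subst (_≤ K) (sym (length-map _ (proj₂ e))) (proj₁ (fits e∈))) (proj₂ (fits e∈))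

  insert-compact : ∀ {e T} → Fits e → Compact T → Compact (insert e T)
  insert-compact {e} {T} fe (uniq , fits) = insert-unique e T uniq , λ x∈ → go (∈-insert⁻ e T x∈)
    where
    go : ∀ {x} → x ≡ e ⊎ x ∈ˡ T → Fits x
    go (inj₁ refl) = fe
    go (inj₂ x∈)   = fits x∈

  length-append : ∀ {A : Set} (xs ys : List A) → length (append xs ys) ≡ length xs + length ys
  length-append xs ys = trans (cong length (append≡++ xs ys)) (length-++ xs)

  join-fits : ∀ {e₁ e₂} → Fits e₁ → Fits e₂ → length (proj₂ (join e₁ e₂)) ≤ K → Fits (join e₁ e₂)
  join-fits {e₁} {e₂} (_ , s₁) (_ , s₂) len = len ,
    subst (All (Small m)) (sym (trans (cong key (append≡++ (proj₂ e₁) (proj₂ e₂))) (map-++ _ (proj₂ e₁) (proj₂ e₂))))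
          (All.++⁺ s₁ s₂)

  chosen-small : ∀ {j ss k ss′} → Chosen m j ss k ss′ → All (Small m) (key ss) → All (Small m) (key ss′)
  chosen-small []               []       = []
  chosen-small (skip s ch)      (x ∷ xs) = x ∷ chosen-small ch xs
  chosen-small (use t c js c< ch) ((c′ , _ , refl) ∷ xs) = (suc c′ , ℤ.drop‿+≤+ c< , refl) ∷ chosen-small ch xs

  mergeTables-compact : ∀ A C → (∀ {e} → e ∈ˡ A → Fits e) → (∀ {e} → e ∈ˡ C → Fits e) → Compact (mergeTables (+ K) A C)
  mergeTables-compact A C fA fC = mergeTables-unique K A C ,
    mergeTables-sound K Fits A C λ {e₁} {e₂} e₁∈ e₂∈ len → join-fits {e₁} {e₂} (fA e₁∈) (fC e₂∈) len

  sameKey-bounded : ∀ xs ys → length xs ≤ B → Bounded B sameKeyᴱ (xs ∷ ys ∷ [])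
  sameKey-bounded xs ys len =
    (_ , _ , len , Boundedˡ-all B xs λ x st → _ , (_ , _ , matchList-all (proj₂ st) λ y ys → _)) ,
    (_ , _ , matchList-all (proj₂ (foldl matchSlot (true , ys) xs)) λ y ys → _)

  insert-bounded : ∀ e T → length (proj₂ e) ≤ B → length T ≤ B → Bounded B insertᴱ (e ∷ T ∷ [])
  insert-bounded e T le lT =
    (_ , _ , lT , Boundedʳ-all B T λ x acc → ((_ , sameKey-bounded (proj₂ e) (proj₂ x) le) , _) , _) ,
    _ ,
    (_ , (_ , _ , lT , Boundedʳ-all B T λ x acc → (_ , sameKey-bounded (proj₂ e) (proj₂ x) le) , _))

  append-bounded : ∀ {τ} (xs ys : List ⟦ τ ⟧ᵀ) → length xs ≤ B → Bounded B (appendᴱ {τ}) (xs ∷ ys ∷ [])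
  append-bounded xs ys len = _ , _ , len , Boundedʳ-all B xs λ _ _ → _

  size-bounded : ∀ {τ} (xs : List ⟦ τ ⟧ᵀ) → length xs ≤ B → Bounded B (sizeᴱ {τ}) (xs ∷ [])
  size-bounded xs len = _ , _ , len , Boundedʳ-all B xs λ _ _ → _

  mergeTables-bounded : ∀ A C → length A ≤ B → length C ≤ B → (∀ {e} → e ∈ˡ A → Fits e) → (∀ {e} → e ∈ˡ C → Fits e) →
    Bounded B mergeTablesᴱ (+ K ∷ A ∷ C ∷ [])
  mergeTables-bounded A C lA lC fA fC = _ , _ , lA ,
    Boundedʳ-intro B (λ _ → Compact) A ([] , λ ()) λ e₁ _ _ sub _ _ cpt →
      (_ , _ , lC , Boundedʳ-intro B (λ _ → Compact) C cpt λ e₂ _ T sub′ _ _ cpt′ →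
        (_ , body e₁ e₂ T (fA (sub (here refl))) (fC (sub′ (here refl))) cpt′) ,
        step e₁ e₂ T (fA (sub (here refl))) (fC (sub′ (here refl))) cpt′) ,
      foldr-preserves Compact _ C (λ {e₂} {T} e₂∈ → step e₁ e₂ T (fA (sub (here refl))) (fC e₂∈)) cpt
    where
    appended : Entry → Entry → List Slot
    appended e₁ e₂ = append (proj₂ e₁) (proj₂ e₂)
    short : ∀ e₁ e₂ → Fits e₁ → Fits e₂ → length (appended e₁ e₂) ≤ B
    short e₁ e₂ (l₁ , _) (l₂ , _) = ℕ.≤-trans (ℕ.≤-reflexive (length-append (proj₂ e₁) (proj₂ e₂)))
                                              (ℕ.≤-trans (ℕ.+-mono-≤ l₁ l₂) 2K≤B)
    step : ∀ e₁ e₂ T → Fits e₁ → Fits e₂ → Compact T → Compact (mergeEntry (+ K) e₁ e₂ T)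
    step e₁ e₂ T f₁ f₂ cpt with size (appended e₁ e₂) ℤ.≤? + K
    ... | no _   = cpt
    ... | yes s≤ = insert-compact {join e₁ e₂} {T}
      (join-fits {e₁} {e₂} f₁ f₂ (ℤ.drop‿+≤+ (subst (ℤ._≤ + K) (size≡length (appended e₁ e₂)) s≤))) cpt
    body : ∀ e₁ e₂ T → Fits e₁ → Fits e₂ → Compact T → Bounded B mergeEntryᴱ (+ K ∷ e₁ ∷ e₂ ∷ T ∷ [])
    body e₁ e₂ T f₁ f₂ cpt =
      (_ , append-bounded {slot} (proj₂ e₁) (proj₂ e₂) (ℕ.≤-trans (proj₁ f₁) K≤B)) ,
      ((_ , size-bounded {slot} (appended e₁ e₂) (short e₁ e₂ f₁ f₂)) , _) ,
      (_ , insert-bounded (join e₁ e₂) T (short e₁ e₂ f₁ f₂) (compact-length cpt)) , _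

  -- Each slot at most doubles the number of choices: the job uses it or skips it.
  length-choices : ∀ j ss → length (choices (+ m) j ss) ≤ 2 ^ length ss
  length-choices j []       = ℕ.≤-refl
  length-choices j (s ∷ ss) = ℕ.≤-trans (go (choices (+ m) j ss)) (ℕ.≤-trans
    (ℕ.+-mono-≤ (length-choices j ss) (length-choices j ss))
    (ℕ.≤-reflexive (cong (_+_ (2 ^ length ss)) (sym (ℕ.+-identityʳ _)))))
    where
    extend-length : ∀ q out → length (extend m j s q out) ≤ 2 + length out
    extend-length q out with + 1 ℤ.+ proj₁ (proj₂ s) ℤ.≤? + m
    ... | yes _ = ℕ.≤-refl
    ... | no  _ = ℕ.n≤1+n _
    go : ∀ qs → length (foldr (extend m j s) [] qs) ≤ length qs + length qs
    go []       = z≤n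
    go (q ∷ qs) = ℕ.≤-trans (extend-length q (foldr (extend m j s) [] qs))
      (ℕ.≤-trans (s≤s (s≤s (go qs))) (ℕ.≤-reflexive (cong suc (sym (ℕ.+-suc (length qs) (length qs))))))

  choices-short : ∀ j ss → length ss ≤ K → length (choices (+ m) j ss) ≤ B
  choices-short j ss len = ℕ.≤-trans (length-choices j ss) (ℕ.≤-trans (ℕ.^-monoʳ-≤ 2 len) 2^K≤B)

  choices-bounded : ∀ j ss → length ss ≤ K → Bounded B choicesᴱ (+ m ∷ j ∷ ss ∷ [])
  choices-bounded j ss len = _ , _ , ℕ.≤-trans len K≤B ,
    Boundedʳ-intro B (λ _ _ → ⊤) ss tt λ { s ys _ _ len′ refl _ →
      (_ , _ , choices-short j ys (ℕ.≤-trans (ℕ.<⇒≤ len′) len) , Boundedʳ-all B (choices (+ m) j ys) λ _ _ → _) , tt }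

  addTask-bounded : ∀ j T → Compact T → Bounded B addTaskᴱ (+ m ∷ j ∷ T ∷ [])
  addTask-bounded j T cT@(_ , fT) = _ , _ , compact-length cT ,
    Boundedʳ-intro B (λ _ → Compact) T ([] , λ ()) λ e _ _ sub _ _ cpt →
      ((_ , choices-bounded (name j) (proj₂ e) (proj₁ (fT (sub (here refl))))) , _ ,
        choices-short (name j) (proj₂ e) (proj₁ (fT (sub (here refl)))) ,
        Boundedʳ-intro B (λ _ → Compact) (choices (+ m) (name j) (proj₂ e)) cpt λ q _ T′ sub′ _ _ cpt′ →
          (_ , insert-bounded (reward j (proj₁ e) (proj₁ q) , proj₂ q) T′
                 (ℕ.≤-trans (proj₁ (fits e q (fT (sub (here refl))) (sub′ (here refl)))) K≤B) (compact-length cpt′)) ,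
          step e q T′ (fT (sub (here refl))) (sub′ (here refl)) cpt′) ,
      foldr-preserves Compact _ (choices (+ m) (name j) (proj₂ e))
        (λ {q} {T′} q∈ → step e q T′ (fT (sub (here refl))) q∈) cpt
    where
    fits : ∀ e q → Fits e → q ∈ˡ choices (+ m) (name j) (proj₂ e) → Fits (reward j (proj₁ e) (proj₁ q) , proj₂ q)
    fits e q (len , sm) q∈ with choices-sound m (name j) (proj₂ e) q∈
    ... | k , ss , ch , refl = subst (_≤ K) (sym (chosen-length ch)) len , chosen-small ch sm
    step : ∀ e q T′ → Fits e → q ∈ˡ choices (+ m) (name j) (proj₂ e) → Compact T′ →
           Compact (insert (reward j (proj₁ e) (proj₁ q) , proj₂ q) T′)
    step e q T′ fe q∈ = insert-compact {reward j (proj₁ e) (proj₁ q) , proj₂ q} {T′} (fits e q fe q∈)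

  Manageable : Component → Set
  Manageable c = length (slotsOf c) ≤ B × length (tasksOf c) ≤ B × Compact (tableOf c)

  -- `append` recurses on its first argument, so only the component being added needs short lists of
  -- slots and tasks. Of the accumulator only the table is traversed.
  mergeComponents-bounded : ∀ cs → length cs ≤ B → (∀ {c} → c ∈ˡ cs → Manageable c) →
    Bounded B mergeComponentsᴱ (+ K ∷ cs ∷ []) × Compact (tableOf (mergeComponents (+ K) cs))
  mergeComponents-bounded cs len man = (_ , _ , len ,
    Boundedʳ-intro B (λ _ → Compact ∘ tableOf) cs base λ c _ acc sub _ _ cpt →
      ((_ , append-bounded {int} (slotsOf c) (slotsOf acc) (proj₁ (man (sub (here refl))))) ,
       (_ , append-bounded {task} (tasksOf c) (tasksOf acc) (proj₁ (proj₂ (man (sub (here refl)))))) ,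
       (_ , mergeTables-bounded (tableOf c) (tableOf acc) (compact-length (proj₂ (proj₂ (man (sub (here refl)))))) (compact-length cpt)
              (proj₂ (proj₂ (proj₂ (man (sub (here refl)))))) (proj₂ cpt))) ,
      step c acc (man (sub (here refl))) cpt) ,
    foldr-preserves (Compact ∘ tableOf) (mergeComponent (+ K)) cs (λ {c} {c′} c∈ → step c c′ (man c∈)) base
    where
    base : Compact (tableOf noComponent)
    base = ([] ∷ []) , λ { (here refl) → z≤n , [] }
    step : ∀ c c′ → Manageable c → Compact (tableOf c′) → Compact (tableOf (mergeComponent (+ K) c c′))
    step c c′ (_ , _ , cpt) cpt′ = mergeTables-compact (tableOf c) (tableOf c′) (proj₂ cpt) (proj₂ cpt′)

  covers-bounded : ∀ j X → length X ≤ B → Bounded B coversᴱ (j ∷ X ∷ [])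
  covers-bounded j X len = _ , _ , len , Boundedʳ-all B X λ _ _ → _

  inner-bounded : ∀ j cs → length cs ≤ B → (∀ {c} → c ∈ˡ cs → Manageable c) → Bounded B innerᴱ (j ∷ cs ∷ [])
  inner-bounded j cs len man = _ , _ , len , Boundedʳ-intro B (λ _ _ → ⊤) cs tt λ c _ _ sub _ _ _ →
    ((_ , covers-bounded j (slotsOf c) (proj₁ (man (sub (here refl))))) , _) , tt

  outer-bounded : ∀ j cs → length cs ≤ B → (∀ {c} → c ∈ˡ cs → Manageable c) → Bounded B outerᴱ (j ∷ cs ∷ [])
  outer-bounded j cs len man = _ , _ , len , Boundedʳ-intro B (λ _ _ → ⊤) cs tt λ c _ _ sub _ _ _ →
    ((_ , covers-bounded j (slotsOf c) (proj₁ (man (sub (here refl))))) , _) , tt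

  length-inner : ∀ j cs → length (inner j cs) ≤ length cs
  length-inner j []       = z≤n
  length-inner j (c ∷ cs) with covers j (slotsOf c)
  ... | true  = s≤s (length-inner j cs)
  ... | false = ℕ.m≤n⇒m≤1+n (length-inner j cs)

  process-bounded : ∀ j cs → length cs ≤ B → (∀ {c} → c ∈ˡ cs → Manageable c) →
    Bounded B processᴱ (+ K ∷ + m ∷ j ∷ cs ∷ [])
  process-bounded j cs len man
    with mergeComponents-bounded (inner j cs) (ℕ.≤-trans (length-inner j cs) len) (λ c∈ → man (proj₁ (∈-inner⁻ j cs c∈)))
  ... | b , cpt = ((_ , ((_ , inner-bounded j cs len man) , _)) , b) ,
    (_ , _ , (_ , addTask-bounded j (tableOf (mergeComponents (+ K) (inner j cs))) cpt)) ,
    (_ , outer-bounded j cs len man)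

  insertTask-bounded : ∀ x ys → length ys ≤ B → Bounded B insertTaskᴱ (x ∷ ys ∷ [])
  insertTask-bounded x ys len = _ , _ , len , Boundedʳ-all B ys λ _ _ → _

  tasks-bounded : ∀ js → length js ≤ B → Bounded B tasksᴱ (js ∷ [])
  tasks-bounded js len = _ , ((_ , size-bounded {Job} js len) , _) , len ,
    Boundedʳ-intro B (λ ys acc → length (proj₂ acc) ≡ length ys) js refl λ j ys acc _ len′ _ eq →
      (_ , (_ , (_ , insertTask-bounded (proj₁ acc ℤ.- + 1 , j) (proj₂ acc) (ℕ.≤-trans (ℕ.≤-reflexive eq) (ℕ.≤-trans (ℕ.<⇒≤ len′) len))))) ,
      trans (↭-length (insertTask-↭ (proj₁ acc ℤ.- + 1 , j) (proj₂ acc))) (cong suc eq)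

  addSlot-bounded : ∀ t ts → length ts ≤ B → Bounded B addSlotᴱ (t ∷ ts ∷ [])
  addSlot-bounded t ts len = (_ , _ , len , Boundedʳ-all B ts λ _ _ → _) , _

  candidates-bounded : ∀ js → length js ≤ B → length js * K ≤ B → Bounded B candidatesᴱ (+ K ∷ js ∷ [])
  candidates-bounded js len len′ = _ , _ , len ,
    Boundedʳ-intro B (λ ys acc → length acc ≤ length ys * K) js z≤n λ j ys acc _ ys< _ short →
      ((_ , range≤B) , _ , range≤B ,
        Boundedʳ-intro B (λ is acc′ → length acc′ ≤ length is + length acc) (below (+ K)) ℕ.≤-refl
          λ i is acc′ _ is< _ short′ →
          (_ , addSlot-bounded (deadlineOf j ℤ.- i) acc′ (begin
            length acc′              ≤⟨ short′ ⟩
            length is + length acc   ≤⟨ ℕ.+-mono-≤ (ℕ.≤-trans (ℕ.<⇒≤ is<) (ℕ.≤-reflexive (length-below K))) short ⟩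
            K + length ys * K        ≤⟨ ℕ.*-monoˡ-≤ K ys< ⟩
            length js * K            ≤⟨ len′ ⟩
            B                        ∎)) ,
          ℕ.≤-trans (addSlot-length (deadlineOf j ℤ.- i) acc′) (s≤s short′)) ,
      ℕ.≤-trans (length-addSlots (deadlineOf j) (below (+ K)) acc)
                (ℕ.+-mono-≤ (ℕ.≤-reflexive (length-below K)) short)
    where
    open ℕ.≤-Reasoning
    range≤B : length (below (+ K)) ≤ B
    range≤B = ℕ.≤-trans (ℕ.≤-reflexive (length-below K)) K≤B

  assignment-bounded : ∀ ss → length ss ≤ B → All (λ s → length (jobsAt s) ≤ B) ss → Bounded B assignmentᴱ (ss ∷ [])
  assignment-bounded ss len js≤ = _ , _ , len , Boundedʳ-intro B (λ _ _ → ⊤) ss tt λ s _ _ sub _ _ _ →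
    (_ , _ , All.lookup js≤ (sub (here refl)) , Boundedʳ-all B (jobsAt s) λ _ _ → _) , tt

  length-member : ∀ {A C : Set} (f : A → List C) {x} {xs} → x ∈ˡ xs → length (f x) ≤ length (concatMap f xs)
  length-member f {xs = y ∷ xs} (here refl) = ℕ.≤-trans (ℕ.m≤m+n _ _) (ℕ.≤-reflexive (sym (length-++ (f y))))
  length-member f {xs = y ∷ xs} (there x∈)  = ℕ.≤-trans (length-member f x∈)
    (ℕ.≤-trans (ℕ.m≤n+m _ (length (f y))) (ℕ.≤-reflexive (sym (length-++ (f y)))))

  valid-fits : ∀ {X Y e} → Valid K m X Y e → Fits e
  valid-fits {e = w , ss} v = Valid.few v , go (Valid.validSlots v)
    where
    go : ∀ {Y ss} → All (ValidSlot m Y) ss → All (Small m) (key ss)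
    go []       = []
    go (validSlot c l _ ∷ vs) = (_ , l , c) ∷ go vs

  -- The slots of all components together are a permutation of `X`, and their tasks one of `D`, so
  -- no single component can hold more.
  invariant-manageable : ∀ {X D cs c} → Invariant K m X D cs → length X + length D ≤ B → c ∈ˡ cs → Manageable c
  invariant-manageable {X} {D} {cs} inv len c∈ =
    ℕ.≤-trans (length-member slotsOf c∈) (ℕ.≤-trans (ℕ.≤-reflexive (↭-length (slots↭ inv))) (ℕ.m+n≤o⇒m≤o (length X) len)) ,
    ℕ.≤-trans (length-member tasksOf c∈) (ℕ.≤-trans (ℕ.≤-reflexive (↭-length (tasks↭ inv))) (ℕ.m+n≤o⇒n≤o (length X) len)) ,
    proj₂ (proj₂ (valid↓ inv c∈)) , λ e∈ → valid-fits (proj₁ (valid↓ inv c∈) e∈)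

  singletons-bounded : ∀ X → length X ≤ B → Bounded B singletonsᴱ (X ∷ [])
  singletons-bounded X len = _ , _ , len , Boundedʳ-all B X λ _ _ → _

  components-bounded : ∀ D X → (∀ {t} → t ∈ˡ X → 1 ≤ K) → NonNegative D → length X + length D ≤ B →
    Bounded B componentsᴱ (+ K ∷ + m ∷ D ∷ X ∷ [])
  components-bounded D X 1≤K nn len = _ , (_ , singletons-bounded X (ℕ.m+n≤o⇒m≤o (length X) len)) , ℕ.m+n≤o⇒n≤o (length X) len ,
    Boundedʳ-intro B (λ ys cs → NonNegative ys → Invariant K m X ys cs) D
      (λ _ → initial-invariant K m X 1≤K)
      λ j ys cs sub ys< _ inv →
        let inv′  = inv (nn ∘ sub ∘ there)
            short = ℕ.≤-trans (ℕ.+-monoʳ-≤ (length X) (ℕ.<⇒≤ ys<)) len in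
        (_ , process-bounded j cs (ℕ.≤-trans (number inv′) short) (invariant-manageable inv′ short)) ,
        λ nn′ → process-invariant K m X (nn′ (here refl)) inv′

  bestSchedule-bounded : ∀ T → Compact T → (∀ {e} → e ∈ˡ T → All (λ s → length (jobsAt s) ≤ B) (proj₂ e)) →
    Bounded B bestScheduleᴱ (T ∷ [])
  bestSchedule-bounded T cpt jobs≤ =
    ((_ , (_ , _ , compact-length cpt , Boundedʳ-all B T λ _ _ → _)) , _) ,
    uncurry (assignment-bounded (proj₂ (best T)))
      (best-induction (λ e → length (proj₂ e) ≤ B × All (λ s → length (jobsAt s) ≤ B) (proj₂ e)) T (z≤n , [])
        λ e∈ → ℕ.≤-trans (proj₁ (proj₂ cpt e∈)) K≤B , jobs≤ e∈)

  final-bounded : ∀ D X → (∀ {t} → t ∈ˡ X → 1 ≤ K) → NonNegative D → length X + length D ≤ B →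
    Bounded B finalᴱ (+ K ∷ + m ∷ D ∷ X ∷ []) × Compact (final (+ K) (+ m) D X)
  final-bounded D X 1≤K nn len = ((_ , (_ , components-bounded D X 1≤K nn len) , _) , proj₁ merged) , proj₂ merged
    where
    inv : Invariant K m X D (components (+ K) (+ m) D X)
    inv = components-invariant K m X 1≤K D nn
    merged = mergeComponents-bounded (components (+ K) (+ m) D X)
               (ℕ.≤-trans (number inv) len) (invariant-manageable inv len)

  final-jobs : ∀ D X → (∀ {t} → t ∈ˡ X → 1 ≤ K) → NonNegative D →
    ∀ {e} → e ∈ˡ final (+ K) (+ m) D X → All (λ s → length (jobsAt s) ≤ B) (proj₂ e)
  final-jobs D X 1≤K nn e∈ = All.map (λ v → ℕ.≤-trans (ValidSlot.capacity v) m≤B) (Valid.validSlots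
    (proj₁ (merge-valid K m (components (+ K) (+ m) D X) (valid↓ (components-invariant K m X 1≤K D nn))) e∈))

  solve-bounded : ∀ js → NonNegative (tasks js) → length (tasks js) ≡ length js → length js * K + length js ≤ B →
    Bounded B solveᴱ (+ K ∷ + m ∷ js ∷ [])
  solve-bounded js nn len≡ len =
    (((_ , _ , (_ , tasks-bounded js js≤B) , (_ , candidates-bounded js js≤B (ℕ.m+n≤o⇒m≤o (length js * K) len)) , _) ,
      proj₁ fin) , _) ,
    bestSchedule-bounded (final (+ K) (+ m) (tasks js) (candidates (+ K) js)) (proj₂ fin)
      (final-jobs (tasks js) (candidates (+ K) js) (candidates-positive K js) nn)
    where
    js≤B : length js ≤ B
    js≤B = ℕ.m+n≤o⇒n≤o (length js * K) len
    fin = final-bounded (tasks js) (candidates (+ K) js) (candidates-positive K js) nn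
            (ℕ.≤-trans (ℕ.+-mono-≤ (length-candidates K js) (ℕ.≤-reflexive len≡)) len)

-- Schedules of an instance

Unique-resp-↭ : ∀ {A : Set} {xs ys : List A} → xs ↭ ys → Unique xs → Unique ys
Unique-resp-↭ {A} p = Permutationₛ.Unique-resp-↭ (setoid A) (↭⇒↭ₛ p)

members : ∀ {n} → Subset n → List (Fin n)
members Vec.[]            = []
members (true  Vec.∷ p) = Fin.zero ∷ map Fin.suc (members p)
members (false Vec.∷ p) = map Fin.suc (members p)

length-members : ∀ {n} (p : Subset n) → length (members p) ≡ ∣ p ∣
length-members Vec.[]          = refl
length-members (true  Vec.∷ p) = cong suc (trans (length-map Fin.suc (members p)) (length-members p))
length-members (false Vec.∷ p) = trans (length-map Fin.suc (members p)) (length-members p)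

∈-members⁺ : ∀ {n} (p : Subset n) {j} → j ∈ˢ p → j ∈ˡ members p
∈-members⁺ (true  Vec.∷ p) Vec.here       = here refl
∈-members⁺ (true  Vec.∷ p) (Vec.there j∈) = there (∈-map⁺ Fin.suc (∈-members⁺ p j∈))
∈-members⁺ (false Vec.∷ p) (Vec.there j∈) = ∈-map⁺ Fin.suc (∈-members⁺ p j∈)

∈-members⁻ : ∀ {n} (p : Subset n) {j} → j ∈ˡ members p → j ∈ˢ p
∈-members⁻ (true  Vec.∷ p) (here refl) = Vec.here
∈-members⁻ (true  Vec.∷ p) (there j∈) with ∈-map⁻ Fin.suc j∈
... | _ , i∈ , refl = Vec.there (∈-members⁻ p i∈)
∈-members⁻ (false Vec.∷ p) j∈ with ∈-map⁻ Fin.suc j∈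
... | _ , i∈ , refl = Vec.there (∈-members⁻ p i∈)

members-unique : ∀ {n} (p : Subset n) → Unique (members p)
members-unique Vec.[]          = []
members-unique (true  Vec.∷ p) = All.map⁺ (All.tabulate λ _ ()) ∷ Unique.map⁺ Fin.suc-injective (members-unique p)
members-unique (false Vec.∷ p) = Unique.map⁺ Fin.suc-injective (members-unique p)

assignment-∈⁻ : ∀ ss {x} → x ∈ˡ assignment ss → ∃[ s ] (s ∈ˡ ss × proj₁ x ≡ proj₁ s × proj₂ x ∈ˡ jobsAt s)
assignment-∈⁻ ss {x} = foldr-preserves P _ ss
  (λ {s} s∈ → foldr-preserves P _ (jobsAt s) λ { j∈ _ (here refl) → s , s∈ , refl , j∈
                                               ; _  h (there x∈)  → h x∈ }) (λ ()) {x}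
  where
  P : List (ℤ × ℤ) → Set
  P acc = ∀ {x} → x ∈ˡ acc → ∃[ s ] (s ∈ˡ ss × proj₁ x ≡ proj₁ s × proj₂ x ∈ˡ jobsAt s)

assignment-∈⁺ : ∀ {s ss i} → s ∈ˡ ss → i ∈ˡ jobsAt s → (proj₁ s , i) ∈ˡ assignment ss
assignment-∈⁺ {s} {ss} {i} s∈ i∈ = foldr-establishes P _ ss s∈
  (λ acc → foldr-establishes P _ (jobsAt s) i∈ (λ _ → here refl) there)
  (λ {s′} → foldr-preserves P _ (jobsAt s′) λ _ → there)
  where
  P : List (ℤ × ℤ) → Set
  P acc = (proj₁ s , i) ∈ˡ acc

-- The lengths matter only if the window of `j` lies inside that of `i`. Either it is empty, and
-- then disjoint from the other, or it is at least as long as the window containing it and so both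
-- are equal.
nested-windows : ∀ i j → span i ℤ.≤ span j →
  (∀ t → Within i t → ¬ Within j t) ⊎ (∀ t → Within i t → Within j t) ⊎ (∀ t → Within j t → Within i t) →
  (∀ t → Within i t → Within j t) ⊎ (∀ t → Within i t → ¬ Within j t)
nested-windows i j len (inj₁ disjoint)     = inj₂ disjoint
nested-windows i j len (inj₂ (inj₁ i⊆j))   = inj₁ i⊆j
nested-windows i j len (inj₂ (inj₂ j⊆i)) with start j ℤ.≤? end j
... | no  empty = inj₂ λ t _ (s≤ , ≤e) → empty (ℤ.≤-trans s≤ ≤e)
... | yes r≤d with j⊆i (start j) (ℤ.≤-refl , r≤d) | j⊆i (end j) (r≤d , ℤ.≤-refl)
...   | ri≤rj , _ | _ , dj≤di = inj₁ λ t (ri≤t , t≤di) →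
  ℤ.≤-trans (≤-by-difference {start j} {start i} (ℤ.≤-trans (ℤ.+-monoˡ-≤ (ℤ.- start i) dj≤di) len) (arith (start i) (start j) (end i) (end j))) ri≤t ,
  ℤ.≤-trans t≤di (≤-by-difference {end i} {end j} (ℤ.≤-trans len (ℤ.+-monoʳ-≤ (end j) (ℤ.neg-mono-≤ ri≤rj))) (arith′ (start i) (start j) (end i) (end j)))
  where
  arith : ∀ ri rj di dj → (dj ℤ.- rj) ℤ.- (dj ℤ.- ri) ≡ ri ℤ.- rj
  arith = ℤRing.solve-∀
  arith′ : ∀ ri rj di dj → (dj ℤ.- ri) ℤ.- (di ℤ.- ri) ≡ dj ℤ.- di
  arith′ = ℤRing.solve-∀

filterᵇ-does : ∀ {A : Set} {P : A → Set} (P? : ∀ x → Dec (P x)) {x xs} → x ∈ˡ filterᵇ (does ∘ P?) xs → x ∈ˡ xs × P x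
filterᵇ-does P? {x} {xs} x∈ with ∈-filter⁻ (T? ∘ does ∘ P?) {xs = xs} x∈
... | x∈xs , Tx = x∈xs , toWitness {a? = P? x} (subst T (sym (isYes≗does (P? x))) Tx)

∈-filterᵇ-does : ∀ {A : Set} {P : A → Set} (P? : ∀ x → Dec (P x)) {x xs} → x ∈ˡ xs → P x → x ∈ˡ filterᵇ (does ∘ P?) xs
∈-filterᵇ-does P? {x} x∈ p = ∈-filter⁺ (T? ∘ does ∘ P?) x∈ (subst T (sym (dec-true (P? x) p)) tt)

module _ (I : Instance) where

  open Instance I

  job : Fin n → ⟦ Job ⟧ᵀ
  job j = release j , deadline j , + processing j , weight j

  taskOf : Fin n → Task
  taskOf j = + toℕ j , job j

  allTasks : List Task
  allTasks = tabulate taskOf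

  toℕ⁺-injective : ∀ {i j : Fin n} → + toℕ i ≡ + toℕ j → i ≡ j
  toℕ⁺-injective = Fin.toℕ-injective ∘ ℤ.+-injective

  ∈-allTasks⁻ : ∀ {D j} → D ↭ allTasks → j ∈ˡ D → ∃[ i ] (j ≡ taskOf i)
  ∈-allTasks⁻ D↭ j∈ = ∈-tabulate⁻ (∈-resp-↭ D↭ j∈)

  allTasks-nonnegative : ∀ {D} → D ↭ allTasks → NonNegative D
  allTasks-nonnegative D↭ j∈ with ∈-allTasks⁻ D↭ j∈
  ... | i , refl = weight-nonneg i

  allTasks-unique : ∀ {D} → D ↭ allTasks → Unique D
  allTasks-unique D↭ = Unique-resp-↭ (↭-sym D↭) (Unique.tabulate⁺ (toℕ⁺-injective ∘ cong proj₁))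

  total-allTasks : ∀ {D} → D ↭ allTasks → ∀ g → total g D ≡ total (g ∘ taskOf) (allFin n)
  total-allTasks D↭ g = trans (total-↭ g D↭) (trans (cong (total g) (sym (map-tabulate id taskOf)))
    (cong (foldr ℚ._+_ 0ℚ) (sym (map-∘ (allFin n)))))

  ∈-window⁻ : ∀ {i t} → t ∈ˡ window I i → Within (taskOf i) t
  ∈-window⁻ {i} = ∈-slots⁻ (release i) (deadline i)

  ∈-window⁺ : ∀ {i t} → Within (taskOf i) t → t ∈ˡ window I i
  ∈-window⁺ {i} (r≤ , ≤d) = ∈-slots⁺ (release i) (deadline i) r≤ ≤d

  laminarTasks : Laminar I → ∀ i j → (∀ t → Within (taskOf i) t → ¬ Within (taskOf j) t) ⊎
    (∀ t → Within (taskOf i) t → Within (taskOf j) t) ⊎ (∀ t → Within (taskOf j) t → Within (taskOf i) t)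
  laminarTasks laminar i j with laminar i j
  ... | inj₁ disjoint    = inj₁ λ t wi wj → disjoint (∈-window⁺ {i} wi , ∈-window⁺ {j} wj)
  ... | inj₂ (inj₁ i⊆j) = inj₂ (inj₁ λ t wi → ∈-window⁻ {j} (i⊆j (∈-window⁺ {i} wi)))
  ... | inj₂ (inj₂ j⊆i) = inj₂ (inj₂ λ t wj → ∈-window⁻ {i} (j⊆i (∈-window⁺ {j} wj)))

  laminar-nesting : Laminar I → ∀ D → (∀ {j} → j ∈ˡ D → ∃[ i ] (j ≡ taskOf i)) → Ascending D → Nesting D
  laminar-nesting laminar []      is-task []         = tt
  laminar-nesting laminar (j ∷ D) is-task (j≥ ∷ asc) =
    nested , laminar-nesting laminar D (is-task ∘ there) asc
    where
    nested : Nested D j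
    nested i∈ with is-task (there i∈) | is-task (here refl)
    ... | i′ , refl | j′ , refl = nested-windows (taskOf i′) (taskOf j′) (All.lookup j≥ i∈) (laminarTasks laminar i′ j′)

  profit : Schedule I → Fin n → ℚ
  profit S j = if does (completed? I S j) then weight j else 0ℚ

  value≡ : ∀ S → value I S ≡ total (profit S) (allFin n)
  value≡ S = cong (foldr ℚ._+_ 0ℚ) (sym (map-tabulate id (profit S)))

  -- Stated for arbitrary `X` and `D`, because entries of the final table are valid with respect to
  -- slots and tasks in merging order, which are permutations of the candidates and of the sorted
  -- tasks.
  module FromEntry (X : List ℤ) (D : List Task) (e : Entry) (e-valid : Valid K m X D e)
                   (X-unique : Unique X) (D↭ : D ↭ allTasks) where

    ss : List Slot
    ss = proj₂ e

    xs : List (ℤ × ℤ)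
    xs = assignment ss

    S : Schedule I
    S t = Vec.tabulate λ j → does ((t , + toℕ j) ∈²? xs)

    ∈-S⁻ : ∀ {t j} → j ∈ˢ S t → (t , + toℕ j) ∈ˡ xs
    ∈-S⁻ {t} {j} j∈ with (t , + toℕ j) ∈²? xs | trans (sym (Vec.lookup∘tabulate (λ j → does ((t , + toℕ j) ∈²? xs)) j)) (Vec.[]=⇒lookup j∈)
    ... | yes x∈ | _ = x∈

    ∈-S⁺ : ∀ {t j} → (t , + toℕ j) ∈ˡ xs → j ∈ˢ S t
    ∈-S⁺ {t} {j} x∈ = Vec.lookup⇒[]= j (S t)
      (trans (Vec.lookup∘tabulate (λ j → does ((t , + toℕ j) ∈²? xs)) j) (dec-true ((t , + toℕ j) ∈²? xs) x∈))

    times-unique : Unique (map proj₁ ss)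
    times-unique = Unique-⊑ (Valid.slots⊑ e-valid) X-unique

    same-time : ∀ {ss : List Slot} {s s′} → Unique (map proj₁ ss) → s ∈ˡ ss → s′ ∈ˡ ss → proj₁ s ≡ proj₁ s′ → s ≡ s′
    same-time (_ ∷ _)  (here refl) (here refl)  eq = refl
    same-time (x∉ ∷ _) (here refl) (there s′∈)  eq = contradiction eq (All.lookup x∉ (∈-map⁺ proj₁ s′∈))
    same-time (x∉ ∷ _) (there s∈)  (here refl)  eq = contradiction (sym eq) (All.lookup x∉ (∈-map⁺ proj₁ s∈))
    same-time (_ ∷ u)  (there s∈)  (there s′∈)  eq = same-time u s∈ s′∈ eq

    origin : ∀ {t j} → (t , j) ∈ˡ xs → ∃[ i ] (j ≡ + toℕ i × Within (taskOf i) t)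
    origin x∈ with assignment-∈⁻ ss x∈
    ... | s , s∈ , refl , j∈ with ValidSlot.origin (All.lookup (Valid.validSlots e-valid) s∈) j∈
    ...   | k , k∈ , refl , w with ∈-allTasks⁻ D↭ k∈
    ...     | i , refl = i , refl , w

    represents : Represents I xs S
    represents (t , j) = mk⇔
      (λ x∈ → let i , j≡ , _ = origin x∈ in t , i , ∈-S⁺ (subst (λ k → (t , k) ∈ˡ xs) j≡ x∈) , cong (t ,_) j≡)
      (λ { (t , i , i∈ , refl) → ∈-S⁻ i∈ })

    feasible : Feasible I S
    feasible = record
      { capacity  = λ t → subst (_≤ m) (length-members (S t)) (few t (members (S t)) (members-unique (S t)) (∈-S⁻ ∘ ∈-members⁻ (S t)))
      ; in-window = λ t j j∈ → in-window t j (origin (∈-S⁻ j∈))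
      ; budget    = map proj₁ ss , subst (_≤ K) (sym (length-map proj₁ ss)) (Valid.few e-valid) ,
                    λ { t (j , j∈) → let s , s∈ , t≡ , _ = assignment-∈⁻ ss (∈-S⁻ j∈) in subst (_∈ˡ map proj₁ ss) (sym t≡) (∈-map⁺ proj₁ s∈) }
      }
      where
      in-window : ∀ t j → ∃[ i ] (+ toℕ j ≡ + toℕ i × Within (taskOf i) t) → t ∈ˡ window I j
      in-window t j (i , j≡ , w) with toℕ⁺-injective {j} {i} j≡
      ... | refl = ∈-window⁺ {i} w
      -- Times are distinct, so all jobs processed at `t` are listed by one slot of the entry, whose
      -- capacity bound applies.
      few : ∀ t (js : List (Fin n)) → Unique js → (∀ {j} → j ∈ˡ js → (t , + toℕ j) ∈ˡ xs) → length js ≤ m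
      few t []       _    _  = z≤n
      few t (j ∷ js) uniq on with assignment-∈⁻ ss (on (here refl))
      ... | s , s∈ , refl , _ = ℕ.≤-trans
        (subst (_≤ length (jobsAt s)) (length-map (+_ ∘ toℕ) (j ∷ js)) (unique-⊆⇒length-≤ (Unique.map⁺ toℕ⁺-injective uniq) sub))
        (ValidSlot.capacity (All.lookup (Valid.validSlots e-valid) s∈))
        where
        sub : ∀ {k} → k ∈ˡ map (+_ ∘ toℕ) (j ∷ js) → k ∈ˡ jobsAt s
        sub k∈ with ∈-map⁻ (+_ ∘ toℕ) k∈
        ... | i , i∈ , refl with assignment-∈⁻ ss (on i∈)
        ...   | s′ , s′∈ , t≡ , j∈ with same-time times-unique s∈ s′∈ t≡
        ...     | refl = j∈

    count≤units : ∀ j → count (+ toℕ j) ss ≤ units I S j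
    count≤units j = subst (_≤ units I S j) (length-map proj₁ holding)
      (unique-⊆⇒length-≤ (Unique-⊑ (Sub.map⁺ proj₁ (Sub.filter-⊆ holds? ss)) times-unique) sub)
      where
      holds? : ∀ s → Dec (+ toℕ j ∈ˡ jobsAt s)
      holds? s = + toℕ j ∈? jobsAt s
      holding : List Slot
      holding = filter holds? ss
      sub : ∀ {t} → t ∈ˡ map proj₁ holding → t ∈ˡ filter (λ t → j ∈ˢ? S t) (window I j)
      sub t∈ with ∈-map⁻ proj₁ t∈
      ... | s , s∈ , refl with ∈-filter⁻ holds? {xs = ss} s∈
      ...   | s∈ss , j∈ = ∈-filter⁺ (λ t → j ∈ˢ? S t) (Feasible.in-window feasible (proj₁ s) j j∈S) j∈S
        where j∈S = ∈-S⁺ (assignment-∈⁺ s∈ss j∈)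

    earned≤profit : ∀ j → earned ss (taskOf j) ℚ.≤ profit S j
    earned≤profit j = if-mono (+ processing j ℤ.≤? + count (+ toℕ j) ss) (completed? I S j) (weight-nonneg j)
      λ p≤ → ℕ.≤-trans (ℤ.drop‿+≤+ p≤) (count≤units j)

    value≥ : proj₁ e ℚ.≤ value I S
    value≥ = begin
      proj₁ e                            ≤⟨ Valid.weight≤ e-valid ⟩
      total (earned ss) D                     ≡⟨ total-allTasks D↭ (earned ss) ⟩
      total (earned ss ∘ taskOf) (allFin n)   ≤⟨ total-mono (allFin n) (λ {j} _ → earned≤profit j) ⟩
      total (profit S) (allFin n)             ≡⟨ value≡ S ⟨
      value I S                               ∎
      where open ℚ.≤-Reasoning

  module FromSchedule (X : List ℤ) (D : List Task) (X-unique : Unique X) (D↭ : D ↭ allTasks)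
                      (X-has : ∀ {j i} → j ∈ˡ D → i ℕ.< K → end j ℤ.- + i ∈ˡ X)
                      (S′ : Schedule I) (feasible′ : Feasible I S′) where

    open Feasible feasible′

    bs : List ℤ
    bs = proj₁ (budget)

    active? : ∀ t → Dec (Active I S′ t)
    active? t = nonempty? (S′ t)

    -- The list witnessing the budget may contain repetitions and inactive slots; `shift-right`
    -- expects strictly increasing slots that each lie in a window.
    distinct : List ℤ
    distinct = deduplicate ℤ._≟_ (filter active? bs)

    ts : List ℤ
    ts = Sort.sort distinct

    ∈-ts⁺ : ∀ {t} → Active I S′ t → t ∈ˡ ts
    ∈-ts⁺ {t} at = ∈-resp-↭ (↭-sym (Sort.sort-↭ distinct))
      (∈-deduplicate⁺ ℤ._≟_ (∈-filter⁺ active? (proj₂ (proj₂ (budget)) t at) at))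

    ∈-distinct⁻ : ∀ {t} → t ∈ˡ distinct → t ∈ˡ bs × Active I S′ t
    ∈-distinct⁻ t∈ = ∈-filter⁻ active? {xs = bs} (∈-deduplicate⁻ ℤ._≟_ (filter active? bs) t∈)

    ∈-ts⁻ : ∀ {t} → t ∈ˡ ts → Active I S′ t
    ∈-ts⁻ t∈ = proj₂ (∈-distinct⁻ (∈-resp-↭ (Sort.sort-↭ distinct) t∈))

    ts-unique : Unique ts
    ts-unique = Unique-resp-↭ (↭-sym (Sort.sort-↭ distinct)) (deduplicate-! (filter active? bs))

    increasing : AllPairs ℤ._<_ ts
    increasing = AllPairs.zipWith (λ (t≤u , t≢u) → ℤ.≤∧≢⇒< t≤u t≢u) (Sorted⇒AllPairs ℤ.≤-totalOrder (Sort.sort-↗ distinct) , ts-unique)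

    few-ts : length ts ≤ K
    few-ts = ℕ.≤-trans (unique-⊆⇒length-≤ ts-unique λ t∈ → proj₁ (∈-distinct⁻ (∈-resp-↭ (Sort.sort-↭ distinct) t∈)))
                       (proj₁ (proj₂ (budget)))

    windows : All (λ t → ∃[ j ] (j ∈ˡ D × Within j t)) ts
    windows = All.tabulate λ t∈ → let j , j∈ = ∈-ts⁻ t∈ in taskOf j , ∈-resp-↭ (↭-sym D↭) (∈-tabulate⁺ j) , ∈-window⁻ {j} (in-window _ j j∈)

    shifted : ∃[ us ] Σ[ ψ ∈ (ℤ → ℤ) ] (Unique us × All (_∈ˡ X) us × Pointwise (Moved D ψ) ts us)
    shifted = shift-right X-has ts increasing windows few-ts

    module Shift (us : List ℤ) (ψ : ℤ → ℤ) (us-unique : Unique us) (us⊆X : All (_∈ˡ X) us)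
                 (moved : Pointwise (Moved D ψ) ts us) where

      -- `ψ` is meaningful only on `us`, hence the guard.
      On : ℤ → ℤ → Set
      On u i = u ∈ˡ us × ∃[ j ] (+ toℕ j ≡ i × j ∈ˢ S′ (ψ u))

      on? : ∀ u i → Dec (On u i)
      on? u i = (u ∈? us) ×-dec (Fin.any? λ j → (+ toℕ j ℤ.≟ i) ×-dec (j ∈ˢ? S′ (ψ u)))

      active : ℤ → Bool
      active u = does (u ∈? us)

      on : ℤ → ℤ → Bool
      on u i = does (on? u i)

      few-active : length (filterᵇ active X) ≤ K
      few-active = begin
        length (filterᵇ active X)  ≤⟨ unique-⊆⇒length-≤ (Unique.filter⁺ (T? ∘ active) (X-unique))
                                        (λ u∈ → proj₂ (filterᵇ-does (_∈? us) {xs = X} u∈)) ⟩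
        length us                  ≡⟨ Pointwise.Pointwise-length moved ⟨
        length ts                  ≤⟨ few-ts ⟩
        K                          ∎
        where open ℕ.≤-Reasoning

      source : ∀ {u ts us} → Pointwise (Moved D ψ) ts us → u ∈ˡ us → ∃[ t ] Moved D ψ t u
      source (mv ∷ _)  (here refl) = _ , mv
      source (_ ∷ mvs) (there u∈)  = source mvs u∈

      -- A job on at `u` was processed at `ψ u` inside its window, and moving right kept every
      -- window of `ψ u`.
      off : ∀ {j} → j ∈ˡ D → ∀ {u} → ¬ Within j u → on u (name j) ≡ false
      off {j} j∈ {u} ¬w = dec-false (on? u (name j)) (λ x → go j∈ ¬w x)
        where
        go : ∀ {j} → j ∈ˡ D → ¬ Within j u → ¬ On u (name j)
        go j∈ ¬w (u∈ , i , i≡ , i∈) with ∈-allTasks⁻ D↭ j∈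
        ... | j , refl with toℕ⁺-injective {i} {j} i≡ | source moved u∈
        ...   | refl | t , refl , _ , keeps = ¬w (keeps j∈ (∈-window⁻ {i} (in-window _ i i∈)))

      loaded : ∀ u → load K m X active on D u ≤ m
      loaded u = begin
        length (filterᵇ (on u ∘ name) D)             ≤⟨ unique-⊆⇒length-≤ (Unique.filter⁺ (T? ∘ on u ∘ name) (allTasks-unique D↭)) sub ⟩
        length (map taskOf (members (S′ (ψ u))))     ≡⟨ length-map taskOf (members (S′ (ψ u))) ⟩
        length (members (S′ (ψ u)))                  ≡⟨ length-members (S′ (ψ u)) ⟩
        ∣ S′ (ψ u) ∣                                 ≤⟨ capacity (ψ u) ⟩
        m                                            ∎
        where
        open ℕ.≤-Reasoning
        sub : ∀ {j} → j ∈ˡ filterᵇ (on u ∘ name) D → j ∈ˡ map taskOf (members (S′ (ψ u)))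
        sub j∈ with filterᵇ-does (on? u ∘ name) {xs = D} j∈
        ... | j∈D , _ , i , i≡ , i∈ with ∈-allTasks⁻ D↭ j∈D
        ...   | j , refl with toℕ⁺-injective {i} {j} i≡
        ...     | refl = ∈-map⁺ taskOf (∈-members⁺ (S′ (ψ u)) i∈)

      worth′ : Task → ℚ
      worth′ = worth K m X active on

      moved-count : ∀ j {ts us} → Pointwise (Moved D ψ) ts us →
        length (filter (λ t → j ∈ˢ? S′ t) ts) ≡ length (filter (λ u → j ∈ˢ? S′ (ψ u)) us)
      moved-count j [] = refl
      moved-count j {us = u ∷ us} ((refl , _) ∷ mvs) with does (j ∈ˢ? S′ (ψ u))
      ... | true  = cong suc (moved-count j mvs)
      ... | false = moved-count j mvs

      -- Slots of the window that process `j` are active, hence among `ts`; moving them preserves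
      -- their number, and the new slots are active candidates at which `j` is on.
      units≤served : ∀ j → units I S′ j ≤ served K m X active on (taskOf j) X
      units≤served j = begin
        length (filter at? (window I j))
          ≤⟨ unique-⊆⇒length-≤ (Unique.filter⁺ at? (slots-unique (release j) (deadline j)))
               (λ t∈ → let _ , j∈ = ∈-filter⁻ at? {xs = window I j} t∈ in ∈-filter⁺ at? (∈-ts⁺ (j , j∈)) j∈) ⟩
        length (filter at? ts)
          ≡⟨ moved-count j moved ⟩
        length (filter at′? us)
          ≤⟨ unique-⊆⇒length-≤ (Unique.filter⁺ at′? us-unique) sub ⟩
        served K m X active on (taskOf j) X  ∎
        where
        open ℕ.≤-Reasoning
        at? : ∀ t → Dec (j ∈ˢ S′ t)
        at? t = j ∈ˢ? S′ t
        at′? : ∀ u → Dec (j ∈ˢ S′ (ψ u))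
        at′? u = j ∈ˢ? S′ (ψ u)
        sub : ∀ {u} → u ∈ˡ filter at′? us → u ∈ˡ filterᵇ (λ t → on t (+ toℕ j)) (filterᵇ active X)
        sub u∈ with ∈-filter⁻ at′? {xs = us} u∈
        ... | u∈us , j∈ = ∈-filterᵇ-does (λ t → on? t (+ toℕ j))
          (∈-filterᵇ-does (_∈? us) (All.lookup us⊆X u∈us) u∈us) (u∈us , j , refl , j∈)

      profit≤worth : ∀ j → profit S′ j ℚ.≤ worth′ (taskOf j)
      profit≤worth j = if-mono (completed? I S′ j) (+ processing j ℤ.≤? + served K m X active on (taskOf j) X)
        (weight-nonneg j) λ p≤ → ℤ.+≤+ (ℕ.≤-trans p≤ (units≤served j))

      value≤worth : ∀ {D′} → D′ ↭ allTasks → value I S′ ℚ.≤ total worth′ D′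
      value≤worth {D′} D′↭ = begin
        value I S′                          ≡⟨ value≡ S′ ⟩
        total (profit S′) (allFin n)        ≤⟨ total-mono (allFin n) (λ {j} _ → profit≤worth j) ⟩
        total (worth′ ∘ taskOf) (allFin n)  ≡⟨ total-allTasks D′↭ worth′ ⟨
        total worth′ D′                     ∎
        where open ℚ.≤-Reasoning

-- Constants, optimality and running time of the program.

^-distribʳ-* : ∀ a b c → (a * b) ^ c ≡ a ^ c * b ^ c
^-distribʳ-* a b zero    = refl
^-distribʳ-* a b (suc c) = trans (cong (a * b *_) (^-distribʳ-* a b c)) (ℕ.[m*n]*[o*p]≡[m*o]*[n*p] a b (a ^ c) (b ^ c))

-- Bounds the constants of Cost and the lengths of all lists that do not grow with n.
factor : ℕ → ℕ → ℕ
factor K m = (K + K) + (2 ^ K + (length (keysUpTo m K) + (m + (suc K + 40))))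

program : Program
program = compile solveᴱ id

module _ (I : Instance) where

  open Instance I

  jobs : List ⟦ Job ⟧ᵀ
  jobs = tabulate (job I)

  D : List Task
  D = tasks jobs

  X : List ℤ
  X = candidates (+ K) jobs

  cs : List Component
  cs = components (+ K) (+ m) D X

  D↭ : D ↭ allTasks I
  D↭ = tasks-↭ n (job I)

  invariant : Invariant K m X D cs
  invariant = components-invariant K m X (candidates-positive K jobs) D (allTasks-nonnegative I D↭)

  X⁺ : List ℤ
  X⁺ = slotsOf (mergeComponents (+ K) cs)

  D⁺ : List Task
  D⁺ = tasksOf (mergeComponents (+ K) cs)

  X⁺-unique : Unique X⁺
  X⁺-unique = Unique-resp-↭ (↭-sym (↭-trans (↭-reflexive (slots-merge K m cs)) (slots↭ invariant)))
                            (candidates-unique K jobs)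

  D⁺↭ : D⁺ ↭ allTasks I
  D⁺↭ = ↭-trans (↭-reflexive (tasks-merge K m cs)) (↭-trans (tasks↭ invariant) D↭)

  F : Table
  F = tableOf (mergeComponents (+ K) cs)

  best-valid : Valid K m X⁺ D⁺ (best F)
  best-valid = best-induction (Valid K m X⁺ D⁺) F
    (empty-valid X⁺ D⁺ (allTasks-nonnegative I D⁺↭))
    (proj₁ (merge-valid K m cs (valid↓ invariant)))

  X-has : ∀ {j i} → j ∈ˡ D → i ℕ.< K → end j ℤ.- + i ∈ˡ X
  X-has j∈ i<K with ∈-allTasks⁻ I D↭ j∈
  ... | j , refl = ∈-candidates K (∈-tabulate⁺ j) i<K

  module Chosen′ = FromEntry I X⁺ D⁺ (best F) best-valid X⁺-unique D⁺↭

  optimal : Laminar I → Optimal I Chosen′.S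
  optimal laminar = Chosen′.feasible , λ S′ feasible′ →
    let open FromSchedule I X D (candidates-unique K jobs) D↭ X-has S′ feasible′
        us , ψ , us-unique , us⊆X , moved = shifted
        open Shift us ψ us-unique us⊆X moved
    in
    -- The competitor's value is at most the worth of all tasks; the final table has an entry of at
    -- least this weight, the best entry weighs no less, and its schedule earns what the entry
    -- claims.
    ℚ.≤-trans (value≤worth D⁺↭) (ℚ.≤-trans
      (covers-best (merge-complete K m X active on D cs
        (components-complete K m X active on few-active (candidates-positive K jobs) D (allTasks-nonnegative I D↭)
          (laminar-nesting I laminar D (∈-allTasks⁻ I D↭) (tasks-ascending jobs)) off loaded)
        (ℕ.≤-trans (ℕ.≤-reflexive (length-active-↭ K m X active on (slots↭ invariant))) few-active)))
      Chosen′.value≥)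

  -- With `n ⊔ 1` the bound stays at least `factor K m` for an instance without jobs, as `Cost` and
  -- the fixed lengths require.
  B : ℕ
  B = factor K m * (n ⊔ 1)

  factor≤B : ∀ {x} → x ≤ factor K m → x ≤ B
  factor≤B x≤ = ℕ.≤-trans x≤ (ℕ.≤-trans (ℕ.≤-reflexive (sym (ℕ.*-identityʳ (factor K m)))) (ℕ.*-monoʳ-≤ (factor K m) (ℕ.m≤n⊔m n 1)))

  agrees : Agrees (+ K ∷ + m ∷ jobs ∷ []) (input I) id
  agrees (here refl)                 = refl
  agrees (there (here refl))         = refl
  agrees (there (there (here refl))) = cong list (sym (map-tabulate (job I) (encode Job)))

  factor≤ : ∀ a b c d e {x} → x ≤ e → x ≤ a + (b + (c + (d + e)))
  factor≤ a b c d e x≤ = ℕ.≤-trans x≤ (ℕ.≤-trans (ℕ.m≤n+m e d) (ℕ.≤-trans (ℕ.m≤n+m (d + e) c)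
    (ℕ.≤-trans (ℕ.m≤n+m (c + (d + e)) b) (ℕ.m≤n+m (b + (c + (d + e))) a))))

  length-jobs : length jobs ≡ n
  length-jobs = length-tabulate (job I)

  keys : ℕ
  keys = length (keysUpTo m K)

  lengths : length jobs * K + length jobs ≤ B
  lengths = begin
    length jobs * K + length jobs ≡⟨ cong₂ (λ x y → x * K + y) length-jobs length-jobs ⟩
    n * K + n         ≡⟨ ℕ.+-comm (n * K) n ⟩
    n + n * K         ≡⟨ ℕ.*-suc n K ⟨
    n * suc K         ≡⟨ ℕ.*-comm n (suc K) ⟩
    suc K * n         ≤⟨ ℕ.*-mono-≤ (factor≤ (K + K) (2 ^ K) keys m (suc K + 40) (ℕ.m≤m+n (suc K) 40)) (ℕ.m≤m⊔n n 1) ⟩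
    B                 ∎
    where open ℕ.≤-Reasoning

  bounded : Bounded B solveᴱ (+ K ∷ + m ∷ jobs ∷ [])
  bounded = solve-bounded B K m
    (factor≤B (ℕ.m≤m+n (K + K) _))
    -- Leading zeros vanish by computation, so that `factor≤` for five summands also skips fewer
    -- than four.
    (factor≤B (factor≤ 0 0 0 (K + K) _ (ℕ.m≤m+n (2 ^ K) _)))
    (factor≤B (factor≤ 0 0 (K + K) (2 ^ K) _ (ℕ.m≤m+n keys _)))
    (factor≤B (factor≤ 0 (K + K) (2 ^ K) keys _ (ℕ.m≤m+n m _)))
    jobs (allTasks-nonnegative I D↭)
    (trans (↭-length D↭) (trans (length-tabulate (taskOf I)) (sym length-jobs)))
    lengths

  evaluates : Evaluates (input I) program (output (Chosen′.xs)) (B ^ degree solveᴱ)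
  evaluates = subst (λ v → Evaluates (input I) program v (B ^ degree solveᴱ))
    (cong (encode (list (int ⊗ int))) (eval-solve (+ K) (+ m) jobs))
    (Cost.compile-evaluates B (factor≤B (factor≤ (K + K) (2 ^ K) keys m (suc K + 40) (ℕ.m≤n+m 40 (suc K))))
      solveᴱ (+ K ∷ + m ∷ jobs ∷ []) bounded {r = id} agrees)

theorem4 : Σ[ P ∈ Program ] Σ[ f ∈ (ℕ → ℕ → ℕ) ] Σ[ c ∈ ℕ ]
    ((I : Instance) → Laminar I →
    let open Instance I in
    SolvesWithin P I (f K m * (n ⊔ 1) ^ c))
-- The power of `factor K m * (n ⊔ 1)` splits into the parameter part `f` and a power of `n ⊔ 1`
-- whose exponent is read off the fixed expression.
theorem4 = program , (λ K m → factor K m ^ degree solveᴱ) , degree solveᴱ , λ I laminar →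
  let open Instance I
      t , run , t≤ = evaluates I
  in t , Chosen′.xs I , Chosen′.S I , run ,
     subst (t ≤_) (^-distribʳ-* (factor K m) (n ⊔ 1) (degree solveᴱ)) t≤ ,
     Chosen′.represents I , optimal I laminar
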